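{- Let $0\le k\le n-2$ and let $G\in\mathfrak{H}_{n,k}$, i.e. $G$ is a connected graph on $n$ vertices with exactly $k$ pendant vertices. Then: (i) For $2\le k\le n-2$, $W(G)\le W\left(T(\lfloor \frac{k}{2}\rfloor,\lceil\frac{k}{2}\rceil,n-k)\right)$, and equality holds if and only if $G= T(\lfloor\frac{k}{2}\rfloor,\lceil \frac{k}{2}\rceil,n-k)$. Furthermore, $W\left(T(\lfloor\frac{k}{2}\rfloor,\lceil \frac{k}{2}\rceil,n-k)\right)$ equals $$\binom{n-k+1}{3}+\frac{k^2}{4}(n-k+3)+\frac{k}{2}\left[(n-k)^2+n-k-2\right]$$ if $k$ is even, and $$\binom{n-k+1}{3}+\frac{k^2-1}{4}(n-k+3)+\frac{k}{2}\left[(n-k)^2+n-k-2\right]+1$$ if $k$ is odd. (ii) For $k=1$ (and $n\ge 4$), $W(G)\le W(U_{n,3}^l)$, and equality holds if and only if $G=U_{n,3}^l$. Furthermore, $W(U_{n,3}^l)=\frac{n^3-7n+12}{6}$. (iii) For $k=0$ and $n\ge 7$, $W(G)\le W(C_{3,3}^n)$, and equality holds if and only if $G=C_{3,3}^n$. Furthermore, $W(C_{3,3}^n)=\frac{n^3-13n+24}{6}$.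
   Context: All graphs are finite, simple, connected and undirected; equality of graphs means isomorphism. The Wiener index of a connected graph $G$ is $W(G)=\sum_{\{u,v\}\subseteq V(G)}d_G(u,v)$, where the sum is over unordered pairs of vertices and $d_G$ is the shortest-path distance. A pendant vertex is a vertex of degree one. $\mathfrak{H}_{n,k}$ is the class of all connected graphs on $n$ vertices with exactly $k$ pendant vertices. $P_d$ is the path $v_1v_2\ldots v_d$ on $d$ vertices; $C_g$ is the cycle on $g$ vertices ($g\ge 3$). For positive integers $a,b,d$, $T(a,b,d)$ is the tree on $a+b+d$ vertices obtained from the path $P_d=v_1\ldots v_d$ by adding $a$ pendant vertices adjacent to $v_1$ and $b$ pendant vertices adjacent to $v_d$. For $3\le g<n$, $U_{n,g}^l$ is the graph on $n$ vertices obtained by joining, by an edge, an end vertex of the path $P_{n-g}$ to a vertex of the cycle $C_g$ (here the superscript $l$ is just a label). For integers $m_1,m_2\ge 3$ and $n\ge m_1+m_2-1$, the graph $C_{m_1,m_2}^n$ on $n$ vertices is defined as follows: if $n>m_1+m_2-1$, take a path on $n-(m_1+m_2)+2$ vertices and identify one of its end vertices with a vertex of $C_{m_1}$ and the other end vertex with a vertex of $C_{m_2}$; if $n=m_1+m_2-1$, identify one vertex of $C_{m_1}$ with one vertex of $C_{m_2}$. -}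

module Defs where

open import Data.Bool.Base using (if_then_else_)
open import Data.Fin.Base using (Fin; toℕ)
open import Data.Fin.Properties as Fin using (any?)
open import Data.Fin.Subset using (Subset; ∣_∣)
open import Data.Integer.Base using (+_)
open import Data.List.Base using (List; []; _∷_; _++_; map; upTo)
open import Data.List.Membership.Propositional using (_∈_)
open import Data.Nat.Base
open import Data.Nat.Properties using (_≟_; +-0-commutativeMonoid)
open import Data.Product.Base using (Σ-syntax; ∃-syntax; _×_; _,_)
open import Data.Product.Properties using (≡-dec)
open import Data.Rational.Base as ℚ using (ℚ)
import Data.Sum.Base as Sum
open import Data.Sum.Base using (_⊎_)
open import Data.Vec.Base using (tabulate)
open import Function.Base using (_∘_)
open import Function.Bundles using (_↔_; _⇔_; Inverse)
open import Level using (0ℓ)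
open import Relation.Binary.Core using (Rel)
open import Relation.Binary.Definitions using (Decidable; Irreflexive; Symmetric)
open import Relation.Binary.PropositionalEquality.Core using (_≡_; _≢_; refl; sym; ≢-sym)
open import Relation.Nullary.Decidable using (Dec; yes; no; does; map′; ¬?; _×-dec_; _⊎-dec_)
import Relation.Unary as U

open import Algebra.Properties.CommutativeMonoid.Sum +-0-commutativeMonoid
  using (sum-syntax)
open import Data.List.Membership.DecPropositional (≡-dec _≟_ _≟_) using (_∈?_)

record Graph (n : ℕ) : Set₁ where
  field
    Adj    : Rel (Fin n) 0ℓ
    adj?   : Decidable Adj
    symm   : Symmetric Adj
    irrefl : Irreflexive _≡_ Adj

open Graph public

infix 4 _≅_

-- Isomorphism; the vertex counts may be different expressions, as for the
-- a + b + d vertices of T a b d.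
_≅_ : ∀ {m n} → Graph m → Graph n → Set
_≅_ {m} {n} G H = Σ[ f ∈ Fin m ↔ Fin n ]
  (∀ u v → Adj G u v ⇔ Adj H (Inverse.to f u) (Inverse.to f v))

data Walk {n} (G : Graph n) : ℕ → Fin n → Fin n → Set where
  []  : ∀ {u} → Walk G 0 u u
  _∷_ : ∀ {ℓ u w v} → Adj G u w → Walk G ℓ w v → Walk G (suc ℓ) u v

Connected : ∀ {n} → Graph n → Set
Connected G = ∀ u v → ∃[ ℓ ] Walk G ℓ u v

walk? : ∀ {n} (G : Graph n) ℓ u v → Dec (Walk G ℓ u v)
walk? G zero    u v = map′ (λ { refl → [] }) (λ { [] → refl }) (u Fin.≟ v)
walk? G (suc ℓ) u v = map′ (λ { (_ , a , p) → a ∷ p }) (λ { (a ∷ p) → _ , a , p })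
  (any? (λ w → adj? G u w ×-dec walk? G ℓ w v))

-- The least i < b satisfying P, or b if there is none.
least : {P : ℕ → Set} → U.Decidable P → ℕ → ℕ
least P? zero    = zero
least P? (suc b) with P? 0
... | yes _ = zero
... | no  _ = suc (least (P? ∘ suc) b)

-- The least length of a walk from u to v. A shortest walk repeats no vertex,
-- so it has length less than n and the bounded search finds it; the value n
-- is taken only when u and v lie in different components.
dist : ∀ {n} → Graph n → Fin n → Fin n → ℕ
dist {n} G u v = least (λ ℓ → walk? G ℓ u v) n

-- Each unordered pair {u , v} is counted once, through its representative
-- with u < v.
W : ∀ {n} → Graph n → ℕ
W {n} G = ∑[ u < n ] ∑[ v < n ] (if does (u Fin.<? v) then dist G u v else 0)

neighbours : ∀ {n} → Graph n → Fin n → Subset n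
neighbours G u = tabulate (λ v → does (adj? G u v))

degree : ∀ {n} → Graph n → Fin n → ℕ
degree G u = ∣ neighbours G u ∣

pendants : ∀ {n} → Graph n → Subset n
pendants G = tabulate (λ u → does (degree G u ≟ 1))

-- Membership in the class 𝔥_{n,k}.
InH : ∀ {n} → ℕ → Graph n → Set
InH k G = Connected G × ∣ pendants G ∣ ≡ k

-- The graph on the vertices 0, …, n − 1 with the listed pairs as edges.
fromEdges : ∀ n → List (ℕ × ℕ) → Graph n
fromEdges n es = record
  { Adj    = λ i j → i ≢ j × (Listed i j ⊎ Listed j i)
  ; adj?   = λ i j → ¬? (i Fin.≟ j) ×-dec (listed? i j ⊎-dec listed? j i)
  ; symm   = λ { (i≢j , e) → ≢-sym i≢j , Sum.swap e }
  ; irrefl = λ { i≡j (i≢j , _) → i≢j i≡j }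
  }
  where
  Listed : Rel (Fin n) 0ℓ
  Listed i j = (toℕ i , toℕ j) ∈ es

  listed? : Decidable Listed
  listed? i j = (toℕ i , toℕ j) ∈? es

-- Edges of the path s, s + 1, …, s + p − 1 on p vertices.
pathEdges : (s p : ℕ) → List (ℕ × ℕ)
pathEdges s p = map (λ i → s + i , suc (s + i)) (upTo (p ∸ 1))

-- Edges of the cycle s, s + 1, …, s + g − 1 on g ≥ 3 vertices.
cycleEdges : (s g : ℕ) → List (ℕ × ℕ)
cycleEdges s g = (s , s + (g ∸ 1)) ∷ pathEdges s g

-- Edges joining c to each of s, s + 1, …, s + a − 1.
starEdges : (c s a : ℕ) → List (ℕ × ℕ)
starEdges c s a = map (λ i → c , s + i) (upTo a)

-- For a, b, d ≥ 1. The path v₁ … v_d is 0, …, d − 1; the a pendant vertices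
-- d, …, d + a − 1 hang from v₁ = 0, and the remaining b from v_d = d − 1.
T : (a b d : ℕ) → Graph (a + b + d)
T a b d = fromEdges (a + b + d)
  (pathEdges 0 d ++ starEdges 0 d a ++ starEdges (d ∸ 1) (d + a) b)

-- U_{n,g}^l for 3 ≤ g < n. The cycle is 0, …, g − 1, the path P_{n−g} is
-- g, …, n − 1, and the joining edge is {g − 1 , g}.
Uˡ : (n g : ℕ) → Graph n
Uˡ n g = fromEdges n
  (cycleEdges 0 g ++ (g ∸ 1 , g) ∷ pathEdges g (n ∸ g))

-- C_{m₁,m₂}^n for m₁, m₂ ≥ 3 and n ≥ m₁ + m₂ − 1. The cycles are
-- 0, …, m₁ − 1 and n − m₂, …, n − 1. The path has n − (m₁ + m₂) + 2 vertices
-- m₁ − 1, …, n − m₂, so its ends are shared with the cycles. When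
-- n = m₁ + m₂ − 1 it is the single vertex common to both cycles.
C : (m₁ m₂ n : ℕ) → Graph n
C m₁ m₂ n = fromEdges n
  (cycleEdges 0 m₁ ++ pathEdges (m₁ ∸ 1) (n + 2 ∸ (m₁ + m₂)) ++ cycleEdges (n ∸ m₂) m₂)

ι : ℕ → ℚ
ι m = + m ℚ./ 1

{-# OPTIONS --safe #-}
module Submission where

-- List the vertices so that each is adjacent to an earlier one; then the distances from the last
-- vertex have no gaps, so among m vertices they sum to at most 0 + 1 + … + (m − 1), with equality
-- only along a path. Deleting vertices from the end of the list bounds W by that of a path, and
-- each constraint on the degrees costs something. A deletable vertex with two neighbours has two
-- vertices at distance 1; if there are no pendant vertices, the last level also has at least two
-- vertices, and a further deletable vertex with two remaining neighbours exists unless the rest is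
-- a Hamiltonian path, which gives a cycle with its much smaller W. With k ≥ 2 pendant vertices,
-- the inner pairs and the mixed pairs are bounded in this way, and the pairs of pendant vertices by
-- moving the ends of the pendant edges across one inner vertex at a time: with a of the k ends on
-- one side, a (k − a) ≤ ⌊k/2⌋⌈k/2⌉ pairs are affected.
-- The extremal graphs are paths of levels, all of size one except for the first and the last, which
-- are cliques or independent; equality forces this structure, and it determines the graph.

open import Defs

-- Distances are always those of the whole graph, also when only a part of the list is left, and
-- that part need not be isometric. What survives is that the distance from a vertex changes by at
-- most 1 along an edge, and this alone makes its values on a connected set containing the vertex
-- gap-free. No metric of a subgraph is compared with that of the graph. Equality is not traced back
-- through all the estimates. For one pendant vertex, the distances from it suffice. For k ≥ 2, the
-- mixed pairs alone show that the graph is T(a, b, n - k) for some a + b = k; its index is then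
-- computed, and comparison with the bound shows that a and b are balanced. Without pendant
-- vertices, only the distances from the first deleted vertex are recovered, and a second such
-- vertex at the other end completes the picture. The condition n ≥ 7 comes from the Hamiltonian
-- case: on six vertices the cycle and C_{3,3}^6 both have Wiener index 27.

module WienerIndex where

  open import Data.Bool.Base using (if_then_else_)
  open import Data.Empty using (⊥)
  open import Data.Fin.Base using (Fin; suc; toℕ; zero)
  open import Data.Fin.Properties as Fin using (toℕ-injective; toℕ<n)
  open import Data.Fin.Subset using (∣_∣)
  import Data.Integer.Base as ℤ
  import Data.Integer.Properties as ℤ
  open import Data.List.Base
    using (List; []; _++_; _∷_; _∷ʳ_; allFin; applyDownFrom; applyUpTo; downFrom; filter; length;
      map; replicate; tabulate; upTo)
  open import Data.List.Extrema.Nat using (argmax; f[xs]≤f[argmax])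
  open import Data.List.Membership.Propositional using (_∈_; _∉_; find)
  open import Data.List.Membership.Propositional.Properties
    using (∈-++⁺ʳ; ∈-++⁺ˡ; ∈-++⁻; ∈-allFin; ∈-downFrom⁺; ∈-downFrom⁻; ∈-filter⁺; ∈-filter⁻; ∈-map⁺;
      ∈-map⁻; ∈-tabulate⁻; ∈-upTo⁺; ∈-upTo⁻; ∈-∃++)
  open import Data.List.Properties
    using (++-assoc; applyUpTo-∷ʳ; downFrom-∷ʳ; length-++; length-downFrom; length-map;
      length-replicate; length-tabulate; map-++; map-cong-local; map-downFrom; map-replicate;
      map-tabulate; map-∘; ∷-injective; ∷-injectiveʳ; ∷-injectiveˡ)
  open import Data.List.Relation.Binary.Permutation.Propositional
    using (_↭_; prep; refl; swap; ↭-reflexive; ↭-sym; ↭-trans)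
  open import Data.List.Relation.Binary.Permutation.Propositional.Properties
    using (++-comm; ++-identityʳ; ++⁺; ++⁺ʳ; ++⁺ˡ; All-resp-↭; drop-∷; map⁺; shift; shifts;
      ↭-length; ↭-map-inv; ↭-singleton-inv; ∈-resp-↭; ∷↭∷ʳ)
  open import Data.List.Relation.Unary.All as All using (All; []; _∷_)
  open import Data.List.Relation.Unary.All.Properties as All using (¬Any⇒All¬)
  open import Data.List.Relation.Unary.AllPairs using ([]; _∷_)
  open import Data.List.Relation.Unary.Any as Any using (any?; here; there)
  open import Data.List.Relation.Unary.Unique.Propositional using (Unique)
  open import Data.List.Relation.Unary.Unique.Propositional.Properties as Unique
    using (Unique[x∷xs]⇒x∉xs; allFin⁺; downFrom⁺; filter⁺)
  open import Data.Nat.Base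
  open import Data.Nat.Combinatorics
    using (nC1≡n; nCk+nC[k+1]≡[n+1]C[k+1]) renaming (_C_ to _choose_)
  open import Data.Nat.Induction using (<-wellFounded)
  open import Data.Nat.ListAction using (sum)
  open import Data.Nat.ListAction.Properties using (sum-++; sum-↭)
  open import Data.Nat.Properties
  open import Data.Nat.Tactic.RingSolver using (solve-∀)
  open import Data.Product.Base using (-,_; _,_; _×_; proj₁; proj₂; ∃; ∃₂)
  import Data.Rational.Base as ℚ
  import Data.Rational.Properties as ℚ
  open import Data.Rational.Unnormalised.Base as ℚᵘ using (*≡*; mkℚᵘ)
  import Data.Rational.Unnormalised.Properties as ℚᵘ
  open import Data.Sum.Base as Sum using ([_,_]′; _⊎_; inj₁; inj₂)
  import Data.Vec.Base as Vec
  open import Function.Base using (_∘_; id)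
  open import Function.Bundles using (Equivalence; Inverse; _⇔_; mk↔ₛ′; mk⇔)
  open import Induction.WellFounded using (Acc; acc)
  open import Relation.Binary.Definitions using (tri<; tri>; tri≈)
  open import Relation.Binary.PropositionalEquality hiding ([_])
  open import Relation.Nullary using (_×-dec_; contradiction; does; no; yes; ¬?; ¬_)
  open import Relation.Nullary.Decidable using (decidable-stable)
  open import Relation.Unary using (Decidable)
  open import Algebra.Properties.CommutativeMonoid.Sum +-0-commutativeMonoid
    using (sum-syntax) renaming (sum to ∑)

  private variable
    A B : Set

  -- Every equality case passes through this: when a total attains its bound, each separately
  -- estimated summand attains its own.
  ≤-split : ∀ {a b c d} → a ≤ c → b ≤ d → a + b ≡ c + d → a ≡ c × b ≡ d
  ≤-split {a} {b} {c} {d} a≤c b≤d eq = a≡c , +-cancelˡ-≡ c b d (trans (cong (_+ b) (sym a≡c)) eq)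
    where
    a≡c : a ≡ c
    a≡c = ≤-antisym a≤c (+-cancelʳ-≤ d c a (≤-trans (≤-reflexive (sym eq)) (+-monoʳ-≤ a b≤d)))

  -- Sums over lists and over unordered pairs

  sumOf : (A → ℕ) → List A → ℕ
  sumOf f xs = sum (map f xs)

  sumOf-++ : ∀ (f : A → ℕ) xs ys → sumOf f (xs ++ ys) ≡ sumOf f xs + sumOf f ys
  sumOf-++ f xs ys = trans (cong sum (map-++ f xs ys)) (sum-++ (map f xs) (map f ys))

  sumOf-↭ : ∀ (f : A → ℕ) {xs ys} → xs ↭ ys → sumOf f xs ≡ sumOf f ys
  sumOf-↭ f p = sum-↭ (map⁺ f p)

  sumOf-≤ : ∀ {f g : A → ℕ} xs → All (λ x → f x ≤ g x) xs → sumOf f xs ≤ sumOf g xs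
  sumOf-≤ []       []       = z≤n
  sumOf-≤ (x ∷ xs) (p ∷ ps) = +-mono-≤ p (sumOf-≤ xs ps)

  sumOf-cong : ∀ {f g : A → ℕ} xs → All (λ x → f x ≡ g x) xs → sumOf f xs ≡ sumOf g xs
  sumOf-cong []       []       = refl
  sumOf-cong (x ∷ xs) (p ∷ ps) = cong₂ _+_ p (sumOf-cong xs ps)

  sumOf-+ : ∀ (f g : A → ℕ) xs → sumOf (λ x → f x + g x) xs ≡ sumOf f xs + sumOf g xs
  sumOf-+ f g []       = refl
  sumOf-+ f g (x ∷ xs) = trans (cong (f x + g x +_) (sumOf-+ f g xs)) (lemma (f x) (g x) _ _)
    where
    lemma : ∀ a b c d → a + b + (c + d) ≡ a + c + (b + d)
    lemma = solve-∀

  sumOf-map : ∀ (f : B → ℕ) (h : A → B) xs → sumOf f (map h xs) ≡ sumOf (f ∘ h) xs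
  sumOf-map f h xs = cong sum (sym (map-∘ xs))

  sumOf-const : ∀ c (xs : List A) → sumOf (λ _ → c) xs ≡ length xs * c
  sumOf-const c []       = refl
  sumOf-const c (x ∷ xs) = cong (c +_) (sumOf-const c xs)

  sumOf-replicate : ∀ (f : A → ℕ) a x → sumOf f (replicate a x) ≡ a * f x
  sumOf-replicate f zero    x = refl
  sumOf-replicate f (suc a) x = cong (f x +_) (sumOf-replicate f a x)

  sumOf-≤-const : ∀ {f : A → ℕ} {c} xs → All (λ x → f x ≤ c) xs → sumOf f xs ≤ length xs * c
  sumOf-≤-const {c = c} xs ps = ≤-trans (sumOf-≤ xs ps) (≤-reflexive (sumOf-const c xs))

  sumOf-≡-const : ∀ {f : A → ℕ} {c} xs → All (λ x → f x ≤ c) xs →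
                  sumOf f xs ≡ length xs * c → All (λ x → f x ≡ c) xs
  sumOf-≡-const []       []       eq = []
  sumOf-≡-const (x ∷ xs) (p ∷ ps) eq =
    let e₁ , e₂ = ≤-split p (sumOf-≤-const xs ps) eq in e₁ ∷ sumOf-≡-const xs ps e₂

  -- Pairs of positions rather than of values are counted, so that a list can stand for a multiset:
  -- levels repeat, and so do the ends of pendant edges.
  pairs : (A → A → ℕ) → List A → ℕ
  pairs f []       = 0
  pairs f (x ∷ xs) = sumOf (f x) xs + pairs f xs

  module _ (f : A → A → ℕ) (f-sym : ∀ x y → f x y ≡ f y x) where

    pairs-↭ : ∀ {xs ys} → xs ↭ ys → pairs f xs ≡ pairs f ys
    pairs-↭ refl         = refl
    pairs-↭ (prep x p)   = cong₂ _+_ (sumOf-↭ (f x) p) (pairs-↭ p)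
    pairs-↭ (swap {xs} {ys} x y p) rewrite f-sym x y | sumOf-↭ (f x) p | sumOf-↭ (f y) p | pairs-↭ p =
      lemma (f y x) (sumOf (f x) ys) (sumOf (f y) ys) (pairs f ys)
      where
      lemma : ∀ a b c d → a + b + (c + d) ≡ a + c + (b + d)
      lemma = solve-∀
    pairs-↭ (_↭_.trans p q) = trans (pairs-↭ p) (pairs-↭ q)

  pairs-++ : ∀ (f : A → A → ℕ) xs ys →
             pairs f (xs ++ ys) ≡ pairs f xs + sumOf (λ x → sumOf (f x) ys) xs + pairs f ys
  pairs-++ f []       ys = refl
  pairs-++ f (x ∷ xs) ys rewrite sumOf-++ (f x) xs ys | pairs-++ f xs ys =
    lemma (sumOf (f x) xs) (sumOf (f x) ys) (pairs f xs) _ (pairs f ys)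
    where
    lemma : ∀ a b c d e → a + b + (c + d + e) ≡ a + c + (b + d) + e
    lemma = solve-∀

  pairs-map : ∀ (f : B → B → ℕ) (h : A → B) xs → pairs f (map h xs) ≡ pairs (λ x y → f (h x) (h y)) xs
  pairs-map f h []       = refl
  pairs-map f h (x ∷ xs) = cong₂ _+_ (sumOf-map (f (h x)) h xs) (pairs-map f h xs)

  -- A duplicate-free list has no diagonal pairs, so agreement off the diagonal is enough. This
  -- matters for `τ`, which is not 0 there.
  pairs-cong : ∀ {f g : A → A → ℕ} {xs} → Unique xs → (∀ {x y} → x ≢ y → f x y ≡ g x y) →
               pairs f xs ≡ pairs g xs
  pairs-cong []            eq = refl
  pairs-cong (x∉xs ∷ uniq) eq =
    cong₂ _+_ (sumOf-cong _ (All.map eq x∉xs)) (pairs-cong uniq eq)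

  -- tri m is the sum of the distances from an end of a path on m vertices, tet m its Wiener index.
  tri : ℕ → ℕ
  tri zero    = 0
  tri (suc m) = m + tri m

  tet : ℕ → ℕ
  tet zero    = 0
  tet (suc m) = tri (suc m) + tet m

  sum-downFrom : ∀ m → sum (downFrom m) ≡ tri m
  sum-downFrom zero    = refl
  sum-downFrom (suc m) = cong (m +_) (sum-downFrom m)

  -- Permutations and duplicate-free lists

  ∈⇒↭ : ∀ {x : A} {xs} → x ∈ xs → ∃ λ ys → xs ↭ x ∷ ys
  ∈⇒↭ {x = x} x∈xs with ∈-∃++ x∈xs
  ... | ys , zs , refl = ys ++ zs , shift x ys zs

  unique-resp-↭ : ∀ {xs ys : List A} → xs ↭ ys → Unique xs → Unique ys
  unique-resp-↭ refl         u                         = u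
  unique-resp-↭ (prep x p)   (x∉ ∷ u)                  = All-resp-↭ p x∉ ∷ unique-resp-↭ p u
  unique-resp-↭ (swap x y p) ((x≢y ∷ x∉) ∷ (y∉ ∷ u)) =
    (≢-sym x≢y ∷ All-resp-↭ p y∉) ∷ All-resp-↭ p x∉ ∷ unique-resp-↭ p u
  unique-resp-↭ (_↭_.trans p q) u = unique-resp-↭ q (unique-resp-↭ p u)

  unique-⊆ : ∀ {xs ys : List A} → Unique xs → (∀ {z} → z ∈ xs → z ∈ ys) → ∃ λ zs → ys ↭ xs ++ zs
  unique-⊆ []                     sub = -, refl
  unique-⊆ {xs = x ∷ xs} {ys} u@(_ ∷ uxs) sub with ∈⇒↭ (sub (here refl))
  ... | ys′ , p with unique-⊆ {ys = ys′} uxs sub′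
    where
    sub′ : ∀ {z} → z ∈ xs → z ∈ ys′
    sub′ z∈xs with ∈-resp-↭ p (sub (there z∈xs))
    ... | here refl = contradiction z∈xs (Unique[x∷xs]⇒x∉xs u)
    ... | there z∈  = z∈
  ... | zs , q = zs , ↭-trans p (prep x q)

  unique-⊆-length : ∀ {xs ys : List A} → Unique xs → (∀ {z} → z ∈ xs → z ∈ ys) → length xs ≤ length ys
  unique-⊆-length {xs = xs} u sub with unique-⊆ u sub
  ... | zs , p = ≤-trans (m≤m+n _ (length zs)) (≤-reflexive (sym (trans (↭-length p) (length-++ xs))))

  unique-⊆⊇ : ∀ {xs ys : List A} → Unique xs → Unique ys →
              (∀ {z} → z ∈ xs → z ∈ ys) → (∀ {z} → z ∈ ys → z ∈ xs) → ys ↭ xs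
  unique-⊆⊇ {xs = xs} ux uy sub sup with unique-⊆ ux sub
  ... | []     , p = ↭-trans p (++-identityʳ xs)
  ... | z ∷ zs , p = contradiction (sup (∈-resp-↭ (↭-sym q) (here refl)))
                                   (λ z∈xs → Unique[x∷xs]⇒x∉xs (unique-resp-↭ q uy) (∈-++⁺ˡ z∈xs))
    where
    q = ↭-trans p (shift z xs zs)

  unique-map-injective : ∀ (f : A → B) {xs x y} → Unique (map f xs) → x ∈ xs → y ∈ xs → f x ≡ f y → x ≡ y
  unique-map-injective f u (here refl) (here refl) eq = refl
  unique-map-injective f {xs = x ∷ xs} u (here refl) (there y∈) eq =
    contradiction (subst (_∈ map f xs) (sym eq) (∈-map⁺ f y∈)) (Unique[x∷xs]⇒x∉xs u)
  unique-map-injective f {xs = y ∷ xs} u (there x∈) (here refl) eq =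
    contradiction (subst (_∈ map f xs) eq (∈-map⁺ f x∈)) (Unique[x∷xs]⇒x∉xs u)
  unique-map-injective f (_ ∷ u) (there x∈) (there y∈) eq = unique-map-injective f u x∈ y∈ eq

  filter-partition : ∀ {P : A → Set} (P? : Decidable P) xs → xs ↭ filter P? xs ++ filter (¬? ∘ P?) xs
  filter-partition P? []       = refl
  filter-partition P? (x ∷ xs) with P? x
  ... | yes _ = prep x (filter-partition P? xs)
  ... | no  _ = ↭-trans (prep x (filter-partition P? xs)) (↭-sym (shift x (filter P? xs) _))

  two-valued : ∀ (s t : A) xs → All (λ x → x ≡ s ⊎ x ≡ t) xs →
               ∃₂ λ a b → xs ↭ replicate a s ++ replicate b t × a + b ≡ length xs
  two-valued s t []       []       = 0 , 0 , refl , refl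
  two-valued s t (x ∷ xs) (p ∷ ps) with two-valued s t xs ps | p
  ... | a , b , q , eq | inj₁ refl = suc a , b , prep s q , cong suc eq
  ... | a , b , q , eq | inj₂ refl =
    a , suc b , ↭-trans (prep t q) (↭-sym (shift t (replicate a s) _)) , trans (+-suc a b) (cong suc eq)

  -- Gap-free lists

  GapFree : List ℕ → Set
  GapFree xs = ∀ {t} → suc t ∈ xs → t ∈ xs

  gapFree-↭ : ∀ {xs ys} → xs ↭ ys → GapFree xs → GapFree ys
  gapFree-↭ p gf = ∈-resp-↭ p ∘ gf ∘ ∈-resp-↭ (↭-sym p)

  -- The values 0, …, height − 1, each occurring at least once.
  record Staircase (xs : List ℕ) : Set where
    constructor staircase
    field
      height : ℕ
      rest   : List ℕ
      perm   : xs ↭ downFrom height ++ rest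
      below  : All (_< height) rest

    size : height + length rest ≡ length xs
    size = sym (trans (↭-length perm) (trans (length-++ (downFrom height))
             (cong (_+ length rest) (length-downFrom height))))

  gapFree-≤ : ∀ {xs} → GapFree xs → ∀ {s t} → s ≤ t → t ∈ xs → s ∈ xs
  gapFree-≤ {xs} gf {s} s≤t t∈ = go (≤⇒≤′ s≤t) t∈
    where
    go : ∀ {t} → s ≤′ t → t ∈ xs → s ∈ xs
    go ≤′-refl      t∈ = t∈
    go (≤′-step le) t∈ = go le (gf t∈)

  -- The height is raised as long as its value still occurs among the remaining entries. Once `m` is
  -- missing, the absence of gaps keeps every entry below `m`. Each round removes an entry, which
  -- bounds the fuel.
  gapFree⇒staircase : ∀ {xs} → GapFree xs → Staircase xs
  gapFree⇒staircase {xs} gf = climb (length xs) 0 xs refl ≤-refl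
    where
    open import Data.List.Membership.DecPropositional _≟_ using (_∈?_)
    climb : ∀ fuel m rest → xs ↭ downFrom m ++ rest → length rest ≤ fuel → Staircase xs
    climb fuel m rest p le with m ∈? rest
    ... | no m∉ = staircase m rest p (All.tabulate below)
      where
      m∉xs : m ∉ xs
      m∉xs m∈ with ∈-++⁻ (downFrom m) (∈-resp-↭ p m∈)
      ... | inj₁ m∈d = <-irrefl refl (∈-downFrom⁻ m∈d)
      ... | inj₂ m∈r = m∉ m∈r
      below : ∀ {x} → x ∈ rest → x < m
      below {x} x∈ with x <? m
      ... | yes x<m = x<m
      ... | no  x≮m = contradiction
        (gapFree-≤ gf (≮⇒≥ x≮m) (∈-resp-↭ (↭-sym p) (∈-++⁺ʳ (downFrom m) x∈))) m∉xs
    ... | yes m∈ with ∈⇒↭ m∈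
    ...   | rest′ , q with fuel
    ...     | zero     with () ← ≤-trans (≤-reflexive (sym (↭-length q))) le
    ...     | suc fuel = climb fuel (suc m) rest′
      (↭-trans p (↭-trans (++⁺ˡ (downFrom m) q) (shift m (downFrom m) rest′)))
      (s≤s⁻¹ (≤-trans (≤-reflexive (sym (↭-length q))) le))

  -- Compare the entries with m, m + 1, m + 2, ...: being at most m - 1, they fall short by at least
  -- 1, 2, 3, ..., and these losses add up to `tri (suc (length xs))`.
  sum-below : ∀ m xs → All (_< m) xs → sum xs + tri (suc (length xs)) + tri m ≤ tri (m + length xs)
  sum-below m []       []       = ≤-reflexive (cong tri (sym (+-identityʳ m)))
  sum-below (suc m) (x ∷ xs) (x<m ∷ ps) = begin
    x + s + (suc ℓ + (ℓ + tri ℓ)) + t     ≡⟨ lemma x s ℓ (ℓ + tri ℓ) t ⟩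
    (suc x + ℓ) + (s + (ℓ + tri ℓ) + t)   ≤⟨ +-mono-≤ (+-monoˡ-≤ ℓ x<m) (sum-below (suc m) xs ps) ⟩
    (suc m + ℓ) + tri (suc m + ℓ)          ≡⟨ cong tri (+-suc (suc m) ℓ) ⟨
    tri (suc m + suc ℓ)                    ∎
    where
    open ≤-Reasoning
    s = sum xs
    ℓ = length xs
    t = tri (suc m)
    lemma : ∀ x s ℓ r t → x + s + (suc ℓ + r) + t ≡ suc x + ℓ + (s + r + t)
    lemma = solve-∀

  staircase-sum : ∀ {xs} (st : Staircase xs) → sum xs + tri (suc (length (Staircase.rest st))) ≤ tri (length xs)
  staircase-sum {xs} st = begin
    sum xs + r                            ≡⟨ cong (_+ r) (trans (sum-↭ perm) (sum-++ (downFrom height) rest)) ⟩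
    (sum (downFrom height) + sum rest) + r ≡⟨ cong (λ z → z + sum rest + r) (sum-downFrom height) ⟩
    (tri height + sum rest) + r           ≡⟨ lemma (tri height) (sum rest) r ⟩
    sum rest + r + tri height             ≤⟨ sum-below height rest below ⟩
    tri (height + length rest)            ≡⟨ cong tri size ⟩
    tri (length xs)                       ∎
    where
    open Staircase st
    open ≤-Reasoning
    r = tri (suc (length rest))
    lemma : ∀ a b c → a + b + c ≡ b + c + a
    lemma = solve-∀

  gapFree-sum : ∀ {xs} → GapFree xs → sum xs ≤ tri (length xs)
  gapFree-sum gf = ≤-trans (m≤m+n _ _) (staircase-sum (gapFree⇒staircase gf))

  gapFree-tight : ∀ {xs} → GapFree xs → sum xs ≡ tri (length xs) → xs ↭ downFrom (length xs)
  gapFree-tight {xs} gf eq with gapFree⇒staircase gf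
  ... | st@(staircase m [] p b) = subst (λ l → xs ↭ downFrom l) (trans (sym (+-identityʳ m)) (Staircase.size st))
                                    (↭-trans p (++-identityʳ _))
  ... | st@(staircase m (r ∷ rs) p b) =
    contradiction (staircase-sum st) (<⇒≱ (≤-trans (≤-reflexive (cong suc (sym eq))) (m<m+n _ z<s)))

  gapFree-loose : ∀ {xs} → GapFree xs → ¬ (xs ↭ downFrom (length xs)) → suc (sum xs) ≤ tri (length xs)
  gapFree-loose gf ¬p = ≤∧≢⇒< (gapFree-sum gf) (¬p ∘ gapFree-tight gf)

  -- Two repeated entries already cost 1 + 2, so a loss of exactly 1 leaves a single repetition, and
  -- it has to repeat the largest value.
  gapFree-almost : ∀ {xs m} → GapFree xs → suc (sum xs) ≡ tri (length xs) → length xs ≡ suc (suc m) →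
    xs ↭ m ∷ downFrom (suc m)
  gapFree-almost {xs} {m} gf eq len with gapFree⇒staircase gf
  ... | st@(staircase h [] p b) = contradiction (trans (sum-↭ (↭-trans p (++-identityʳ _))) (trans (sum-downFrom h)
    (cong tri (trans (sym (+-identityʳ h)) (Staircase.size st))))) (<⇒≢ (≤-reflexive eq))
  ... | st@(staircase h (r ∷ s ∷ rs) p b) = contradiction (staircase-sum st)
     (<⇒≱ (≤-trans (≤-reflexive (cong suc (sym eq))) (≤-trans (≤-reflexive (sym (+-comm (sum xs) 2)))
       (+-monoʳ-≤ (sum xs) (s≤s (s≤s z≤n))))))
  ... | st@(staircase h (r ∷ []) p (r<h ∷ [])) = ↭-trans p′ (subst (λ z → r ∷ downFrom h ↭ z)
    (cong₂ (λ a b → a ∷ downFrom b) r≡m h≡) refl)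
    where
    p′ : xs ↭ r ∷ downFrom h
    p′ = ↭-trans p (↭-trans (shift r (downFrom h) []) (prep r (++-identityʳ _)))
    h≡ : h ≡ suc m
    h≡ = suc-injective (trans (+-comm 1 h) (trans (Staircase.size st) len))
    eq′ : suc (r + tri (suc m)) ≡ suc m + tri (suc m)
    eq′ = begin
      suc (r + tri (suc m))       ≡⟨ cong (λ z → suc (r + tri z)) h≡ ⟨
      suc (r + tri h)             ≡⟨ cong (λ z → suc (r + z)) (sum-downFrom h) ⟨
      suc (sum (r ∷ downFrom h))  ≡⟨ cong suc (sum-↭ p′) ⟨
      suc (sum xs)                ≡⟨ eq ⟩
      tri (length xs)             ≡⟨ cong tri len ⟩
      tri (suc (suc m))           ∎
      where open ≡-Reasoning
    r≡m : r ≡ m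
    r≡m = suc-injective (+-cancelʳ-≡ (tri (suc m)) (suc r) (suc m) eq′)

  -- The copy of `x` that stays can still serve as the predecessor of `suc x`.
  gapFree-drop : ∀ {x xs} → GapFree (x ∷ xs) → x ∈ xs → GapFree xs
  gapFree-drop gf x∈ t∈ with gf (there t∈)
  ... | here refl = x∈
  ... | there s∈  = s∈

  -- Products of two numbers with a given sum

  balanced : ℕ → ℕ
  balanced k = ⌊ k /2⌋ * ⌈ k /2⌉

  ⌊2a+δ/2⌋ : ∀ a δ → ⌊ a + (a + δ) /2⌋ ≡ a + ⌊ δ /2⌋
  ⌊2a+δ/2⌋ zero    δ = refl
  ⌊2a+δ/2⌋ (suc a) δ = trans (cong (λ z → ⌊ suc z /2⌋) (+-suc a (a + δ))) (cong suc (⌊2a+δ/2⌋ a δ))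

  ⌈2a+δ/2⌉ : ∀ a δ → ⌈ a + (a + δ) /2⌉ ≡ a + ⌈ δ /2⌉
  ⌈2a+δ/2⌉ a δ = trans (cong ⌊_/2⌋ (lemma a δ)) (⌊2a+δ/2⌋ a (suc δ))
    where
    lemma : ∀ a δ → suc (a + (a + δ)) ≡ a + (a + suc δ)
    lemma = solve-∀

  -- A product whose factors differ by δ misses the optimum by exactly `balanced δ`, which vanishes
  -- only for δ ≤ 1. The inequality and its equality case both follow.
  balanced-split : ∀ a δ → balanced (a + (a + δ)) ≡ a * (a + δ) + balanced δ
  balanced-split a δ = begin
    ⌊ a + (a + δ) /2⌋ * ⌈ a + (a + δ) /2⌉  ≡⟨ cong₂ _*_ (⌊2a+δ/2⌋ a δ) (⌈2a+δ/2⌉ a δ) ⟩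
    (a + ⌊ δ /2⌋) * (a + ⌈ δ /2⌉)          ≡⟨ lemma a ⌊ δ /2⌋ ⌈ δ /2⌉ ⟩
    a * (a + (⌊ δ /2⌋ + ⌈ δ /2⌉)) + balanced δ ≡⟨ cong (λ z → a * (a + z) + balanced δ) (⌊n/2⌋+⌈n/2⌉≡n δ) ⟩
    a * (a + δ) + balanced δ                 ∎
    where
    open ≡-Reasoning
    lemma : ∀ a f c → (a + f) * (a + c) ≡ a * (a + (f + c)) + f * c
    lemma = solve-∀

  m*n≤balanced : ∀ a b → a * b ≤ balanced (a + b)
  m*n≤balanced a b with ≤-total a b
  ... | inj₁ a≤b with m≤n⇒∃[o]m+o≡n a≤b
  ...   | δ , refl = ≤-trans (m≤m+n _ _) (≤-reflexive (sym (balanced-split a δ)))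
  m*n≤balanced a b | inj₂ b≤a with m≤n⇒∃[o]m+o≡n b≤a
  ...   | δ , refl = ≤-trans (≤-reflexive (*-comm (b + δ) b))
    (≤-trans (m≤m+n _ _) (≤-reflexive (trans (sym (balanced-split b δ)) (cong balanced (+-comm b (b + δ))))))

  private
    balanced≡0 : ∀ a δ → a * (a + δ) ≡ balanced (a + (a + δ)) → a ≡ ⌊ a + (a + δ) /2⌋
    balanced≡0 a δ eq = trans (sym (+-identityʳ a)) (trans (cong (a +_) (sym (half δ q≡0))) (sym (⌊2a+δ/2⌋ a δ)))
      where
      q≡0 : balanced δ ≡ 0
      q≡0 = sym (+-cancelˡ-≡ (a * (a + δ)) 0 (balanced δ) (trans (+-identityʳ _) (trans eq (balanced-split a δ))))
      half : ∀ δ → balanced δ ≡ 0 → ⌊ δ /2⌋ ≡ 0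
      half zero          _ = refl
      half (suc zero)    _ = refl

  m*n≡balanced : ∀ a b → a * b ≡ balanced (a + b) →
                 (a ≡ ⌊ a + b /2⌋ × b ≡ ⌈ a + b /2⌉) ⊎ (b ≡ ⌊ a + b /2⌋ × a ≡ ⌈ a + b /2⌉)
  m*n≡balanced a b eq = [ (λ e → inj₁ (e , other e (⌊n/2⌋+⌈n/2⌉≡n (a + b)))) ,
                          (λ e → inj₂ (e , other e (trans (⌊n/2⌋+⌈n/2⌉≡n (a + b)) (+-comm a b)))) ]′ side
    where
    other : ∀ {x y f c} → x ≡ f → f + c ≡ x + y → y ≡ c
    other {x} {y} {f} {c} refl e = sym (+-cancelˡ-≡ x c y e)
    side : a ≡ ⌊ a + b /2⌋ ⊎ b ≡ ⌊ a + b /2⌋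
    side with ≤-total a b
    ... | inj₁ a≤b with m≤n⇒∃[o]m+o≡n a≤b
    ...   | δ , refl = inj₁ (balanced≡0 a δ eq)
    side | inj₂ b≤a with m≤n⇒∃[o]m+o≡n b≤a
    ...   | δ , refl = inj₂ (trans
      (balanced≡0 b δ (trans (*-comm b (b + δ)) (trans eq (cong balanced (+-comm (b + δ) b)))))
      (cong ⌊_/2⌋ (+-comm b (b + δ))))

  -- Walks, degrees and the Wiener index in terms of lists

  least-≤ : ∀ {P : ℕ → Set} (P? : Decidable P) b {i} → P i → least P? b ≤ i
  least-≤ P? zero    p = z≤n
  least-≤ P? (suc b) p with P? 0
  least-≤ P? (suc b) p | yes _ = z≤n
  least-≤ P? (suc b) {zero}  p | no ¬p = contradiction p ¬p
  least-≤ P? (suc b) {suc i} p | no _  = s≤s (least-≤ (P? ∘ suc) b p)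

  least-holds : ∀ {P : ℕ → Set} (P? : Decidable P) b {i} → P i → i < b → P (least P? b)
  least-holds P? (suc b) {i} p i<b with P? 0
  least-holds P? (suc b) p i<b | yes p₀ = p₀
  least-holds P? (suc b) {zero}  p i<b       | no ¬p = contradiction p ¬p
  least-holds P? (suc b) {suc i} p (s≤s i<b) | no _  = least-holds (P? ∘ suc) b p i<b

  ∑-tabulate : ∀ {n} (f : Fin n → ℕ) → ∑ f ≡ sum (tabulate f)
  ∑-tabulate {zero}  f = refl
  ∑-tabulate {suc n} f = cong (f zero +_) (∑-tabulate (f ∘ suc))

  ∑∑-pairs : ∀ {n} (f : Fin n → Fin n → ℕ) →
    ∑[ u < n ] ∑[ v < n ] (if does (u Fin.<? v) then f u v else 0) ≡ pairs f (allFin n)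
  ∑∑-pairs {zero}  f = refl
  ∑∑-pairs {suc n} f = cong₂ _+_
    (trans (∑-tabulate (f zero ∘ suc)) (cong sum (sym (map-tabulate suc (f zero)))))
    (begin
      ∑[ u < n ] ∑[ v < n ] (if does (u Fin.<? v) then f (suc u) (suc v) else 0) ≡⟨ ∑∑-pairs (λ u v → f (suc u)
        (suc v)) ⟩
      pairs (λ u v → f (suc u) (suc v)) (allFin n)  ≡⟨ pairs-map f suc (allFin n) ⟨
      pairs f (map suc (allFin n))                  ≡⟨ cong (pairs f) (map-tabulate id suc) ⟩
      pairs f (tabulate suc)                        ∎)
    where open ≡-Reasoning

  ∣tabulate∣ : ∀ {A : Set} {P : A → Set} (P? : Decidable P) {n} (f : Fin n → A) →
               ∣ Vec.tabulate (does ∘ P? ∘ f) ∣ ≡ length (filter P? (tabulate f))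
  ∣tabulate∣ P? {zero}  f = refl
  ∣tabulate∣ P? {suc n} f with P? (f zero)
  ... | yes _ = cong suc (∣tabulate∣ P? (f ∘ suc))
  ... | no  _ = ∣tabulate∣ P? (f ∘ suc)

  module _ {n} (G : Graph n) where

    snoc : ∀ {ℓ u v w} → Walk G ℓ u v → Adj G v w → Walk G (suc ℓ) u w
    snoc []      b = b ∷ []
    snoc (a ∷ p) b = a ∷ snoc p b

    reverseWalk : ∀ {ℓ u v} → Walk G ℓ u v → Walk G ℓ v u
    reverseWalk []      = []
    reverseWalk (a ∷ p) = snoc (reverseWalk p) (symm G a)

    appendWalk : ∀ {ℓ m u v w} → Walk G ℓ u v → Walk G m v w → Walk G (ℓ + m) u w
    appendWalk []      q = q
    appendWalk (a ∷ p) q = a ∷ appendWalk p q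

    dist-≤ : ∀ {ℓ u v} → Walk G ℓ u v → dist G u v ≤ ℓ
    dist-≤ {u = u} {v} = least-≤ (λ ℓ → walk? G ℓ u v) n

    neighbourList : Fin n → List (Fin n)
    neighbourList u = filter (adj? G u) (allFin n)

    degree-length : ∀ u → degree G u ≡ length (neighbourList u)
    degree-length u = ∣tabulate∣ (adj? G u) id

    ∈-neighbourList : ∀ {u v} → Adj G u v → v ∈ neighbourList u
    ∈-neighbourList {u} {v} = ∈-filter⁺ (adj? G u) (∈-allFin v)

    neighbourList-adj : ∀ {u v} → v ∈ neighbourList u → Adj G u v
    neighbourList-adj {u} v∈ = proj₂ (∈-filter⁻ (adj? G u) {xs = allFin n} v∈)

    neighbourList-unique : ∀ u → Unique (neighbourList u)
    neighbourList-unique u = filter⁺ (adj? G u) (allFin⁺ n)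

    Pendant : Fin n → Set
    Pendant u = degree G u ≡ 1

    pendant? : Decidable Pendant
    pendant? u = degree G u ≟ 1

    pendantList : List (Fin n)
    pendantList = filter pendant? (allFin n)

    pendants-length : ∣ pendants G ∣ ≡ length pendantList
    pendants-length = ∣tabulate∣ pendant? id

    pendant-unique : ∀ {u v w} → Pendant u → Adj G u v → Adj G u w → v ≡ w
    pendant-unique {u} {v} {w} p a b = same (neighbourList u) (trans (sym (degree-length u)) p)
                                 (∈-neighbourList a) (∈-neighbourList b)
      where
      same : ∀ xs → length xs ≡ 1 → v ∈ xs → w ∈ xs → v ≡ w
      same (x ∷ []) _ (here refl) (here refl) = refl

    -- The given edge excludes degree 0, and the other hypothesis excludes degree 1.
    twoNeighbours : ∀ {u v} → ¬ Pendant u → Adj G u v → ∃₂ λ a b → a ≢ b × Adj G u a × Adj G u b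
    twoNeighbours {u} {v} ¬p a
      with neighbourList u in eq | neighbourList-unique u | ∈-neighbourList a
    ... | x ∷ []      | _ | _ = contradiction (trans (degree-length u) (cong length eq)) ¬p
    ... | x ∷ y ∷ xs | (x≢y ∷ _) ∷ _ | _ =
      x , y , x≢y , neighbourList-adj (subst (x ∈_) (sym eq) (here refl))
          , neighbourList-adj (subst (y ∈_) (sym eq) (there (here refl)))

    nonPendant : ∀ {u v w} → Adj G u v → Adj G u w → v ≢ w → ¬ Pendant u
    nonPendant a b v≢w p = v≢w (pendant-unique p a b)

    W-pairs : W G ≡ pairs (dist G) (allFin n)
    W-pairs = ∑∑-pairs (dist G)

  -- The shortest-path metric

  module Metric {n} (G : Graph n) (connected : Connected G) where

    d : Fin n → Fin n → ℕ
    d = dist G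

    -- The unbounded search below a known walk length is correct at once; the
    -- bound n in dist suffices because vertices at distances 0, 1, …, δ u v
    -- from v are distinct.
    private
      δ : Fin n → Fin n → ℕ
      δ u v = least (λ ℓ → walk? G ℓ u v) (suc (proj₁ (connected u v)))

      δ-walk : ∀ u v → Walk G (δ u v) u v
      δ-walk u v = least-holds (λ ℓ → walk? G ℓ u v) _ (proj₂ (connected u v)) ≤-refl

      δ-≤ : ∀ {ℓ u v} → Walk G ℓ u v → δ u v ≤ ℓ
      δ-≤ {u = u} {v} = least-≤ (λ ℓ → walk? G ℓ u v) _

      geodesic : ∀ {ℓ u v} → Walk G ℓ u v → δ u v ≡ ℓ →
                 ∃ λ us → length us ≡ suc ℓ × Unique us × All (λ w → δ w v ≤ ℓ) us
      geodesic {u = u} [] eq = u ∷ [] , refl , [] ∷ [] , ≤-reflexive eq ∷ []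
      geodesic {suc ℓ} {u} {v} (_∷_ {w = w} a p) eq
        with geodesic p (≤-antisym (δ-≤ p) (s≤s⁻¹ (≤-trans (≤-reflexive (sym eq)) (δ-≤ (a ∷ δ-walk w v)))))
      ... | us , len , uniq , le =
        u ∷ us , cong suc len
        , All.map (λ { le refl → <-irrefl refl (≤-trans (≤-reflexive (sym eq)) le) }) le ∷ uniq
        , ≤-reflexive eq ∷ All.map m≤n⇒m≤1+n le

      δ<n : ∀ u v → δ u v < n
      δ<n u v with geodesic (δ-walk u v) refl
      ... | us , len , uniq , _ = begin
        suc (δ u v)        ≡⟨ len ⟨
        length us          ≤⟨ unique-⊆-length uniq (λ _ → ∈-allFin _) ⟩
        length (allFin n)  ≡⟨ length-tabulate id ⟩
        n                  ∎
        where open ≤-Reasoning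

    d-walk : ∀ u v → Walk G (d u v) u v
    d-walk u v = least-holds (λ ℓ → walk? G ℓ u v) n (δ-walk u v) (δ<n u v)

    d-≤ : ∀ {ℓ u v} → Walk G ℓ u v → d u v ≤ ℓ
    d-≤ = dist-≤ G

    d-self : ∀ u → d u u ≡ 0
    d-self u = n≤0⇒n≡0 (d-≤ [])

    d-zero : ∀ {u v} → d u v ≡ 0 → u ≡ v
    d-zero {u} {v} eq with d u v | d-walk u v
    d-zero refl | _ | [] = refl

    d-sym : ∀ u v → d u v ≡ d v u
    d-sym u v = ≤-antisym (d-≤ (reverseWalk G (d-walk v u))) (d-≤ (reverseWalk G (d-walk u v)))

    d-triangle : ∀ u v w → d u w ≤ d u v + d v w
    d-triangle u v w = d-≤ (appendWalk G (d-walk u v) (d-walk v w))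

    d-lipschitz : ∀ r {u v} → Adj G u v → d r u ≤ suc (d r v)
    d-lipschitz r {u} {v} a = d-≤ (snoc G (d-walk r v) (symm G a))

    -- The witness is the second vertex of a shortest walk from `v` to `r`. In the equality cases
    -- such parents supply the edges between consecutive levels.
    d-parent : ∀ {r v t} → d r v ≡ suc t → ∃ λ w → Adj G v w × d r w ≡ t
    d-parent {r} {v} {t} eq = step (subst (λ ℓ → Walk G ℓ v r) (trans (d-sym v r) eq) (d-walk v r))
      where
      step : Walk G (suc t) v r → ∃ λ w → Adj G v w × d r w ≡ t
      step (_∷_ {w = w} a p) = w , a ,
        ≤-antisym (≤-trans (≤-reflexive (d-sym r w)) (d-≤ p))
                  (s≤s⁻¹ (≤-trans (≤-reflexive (sym eq)) (d-lipschitz r a)))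

    d-adj : ∀ {u v} → Adj G u v → d u v ≡ 1
    d-adj {u} {v} a = ≤-antisym (d-≤ (a ∷ [])) (n≢0⇒n>0 (λ eq → irrefl G (d-zero eq) a))

    d-one : ∀ {u v} → d u v ≡ 1 → Adj G u v
    d-one {u} {v} eq with d u v | d-walk u v
    d-one refl | _ | a ∷ [] = a

    d-distinct : ∀ {r v} → r ≢ v → 0 < d r v
    d-distinct r≢v = n≢0⇒n>0 (r≢v ∘ d-zero)

    hasNeighbour : ∀ {u v} → u ≢ v → ∃ (Adj G u)
    hasNeighbour {u} {v} u≢v with d u v | d-walk u v
    ... | _ | []    = contradiction refl u≢v
    ... | _ | a ∷ _ = -, a

    d-close : ∀ r {u v} → Adj G u v → suc (d r u) ≡ d r v ⊎ suc (d r v) ≡ d r u ⊎ d r u ≡ d r v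
    d-close r {u} {v} a with <-cmp (d r u) (d r v)
    ... | tri< lt _ _ = inj₁ (≤-antisym lt (d-lipschitz r (symm G a)))
    ... | tri≈ _ eq _ = inj₂ (inj₂ eq)
    ... | tri> _ _ gt = inj₂ (inj₁ (≤-antisym gt (d-lipschitz r a)))

    farthest : ∀ r → ∃ λ x → ∀ v → d r v ≤ d r x
    farthest r = argmax (d r) r (allFin n) , λ v → All.lookup (f[xs]≤f[argmax] r (allFin n)) (∈-allFin v)

  -- Connected vertex sets and the sums of distances in them

  module Growth {n} (G : Graph n) (connected : Connected G) where

    open Metric G connected
    open import Data.List.Membership.DecPropositional (Fin._≟_ {n}) using (_∈?_)

    -- Built up vertex by vertex, each new head adjacent to an earlier vertex:
    -- the head of a grown list can be deleted without disconnecting it.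
    data Grown : List (Fin n) → Set where
      [_]  : ∀ r → Grown (r ∷ [])
      grow : ∀ {x y vs} → x ∉ vs → y ∈ vs → Adj G x y → Grown vs → Grown (x ∷ vs)

    grown-unique : ∀ {vs} → Grown vs → Unique vs
    grown-unique [ r ]             = [] ∷ []
    grown-unique (grow x∉ _ _ gr)  = ¬Any⇒All¬ _ x∉ ∷ grown-unique gr

    grown-tail : ∀ {x y vs} → Grown (x ∷ vs) → y ∈ vs → Grown vs
    grown-tail (grow _ _ _ gr) _ = gr

    -- Every cut of a connected set is crossed by one of its edges. Either the newest vertex and its
    -- earlier neighbour lie on different sides, or that neighbour can replace it in the smaller
    -- list.
    crossing : ∀ {vs} → Grown vs → {P : Fin n → Set} → Decidable P → ∀ {a b} →
               a ∈ vs → P a → b ∈ vs → ¬ P b →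
               ∃₂ λ u v → u ∈ vs × v ∈ vs × Adj G u v × P u × ¬ P v
    crossing [ r ] P? (here refl) pa (here refl) ¬pb = contradiction pa ¬pb
    crossing (grow x∉ y∈ adj gr) P? (here refl) pa (here refl) ¬pb = contradiction pa ¬pb
    crossing (grow {y = y} x∉ y∈ adj gr) P? (here refl) pa (there b∈) ¬pb with P? y
    ... | no ¬py = -, -, here refl , there y∈ , adj , pa , ¬py
    ... | yes py with crossing gr P? y∈ py b∈ ¬pb
    ...   | u , v , u∈ , v∈ , rest = u , v , there u∈ , there v∈ , rest
    crossing (grow {y = y} x∉ y∈ adj gr) P? (there a∈) pa (here refl) ¬pb with P? y
    ... | yes py = -, -, there y∈ , here refl , symm G adj , py , ¬pb
    ... | no ¬py with crossing gr P? a∈ pa y∈ ¬py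
    ...   | u , v , u∈ , v∈ , rest = u , v , there u∈ , there v∈ , rest
    crossing (grow x∉ y∈ adj gr) P? (there a∈) pa (there b∈) ¬pb with crossing gr P? a∈ pa b∈ ¬pb
    ... | u , v , u∈ , v∈ , rest = u , v , there u∈ , there v∈ , rest

    module _ {ts c₀ : List (Fin n)} (uts : Unique ts)
             (cross : ∀ {c v} → Grown c → (∀ {u} → u ∈ c₀ → u ∈ c) → v ∈ ts → v ∉ c →
                      ∃₂ λ a b → a ∈ c × b ∈ ts × b ∉ c × Adj G b a) where

      private
        missing : ∀ c → (∀ {v} → v ∈ ts → v ∈ c) ⊎ ∃ λ v → v ∈ ts × v ∉ c
        missing c with any? (λ v → ¬? (v ∈? c)) ts
        ... | yes q = inj₂ (find q)
        ... | no ¬q = inj₁ (λ {v} v∈ → decidable-stable (v ∈? c) (λ v∉ → ¬q (Any.map (λ { refl → v∉ }) v∈)))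

        loop : ∀ fuel {y ws} → Grown (y ∷ ws) → y ∉ c₀ →
               (∀ {v} → v ∈ y ∷ ws → v ∈ ts) → (∀ {v} → v ∈ c₀ → v ∈ y ∷ ws) →
               length ts ≤ fuel + length (y ∷ ws) →
               ∃₂ λ y ws → Grown (y ∷ ws) × y ∷ ws ↭ ts × y ∉ c₀
        loop fuel {y} {ws} gr y∉ sub sup le with missing (y ∷ ws)
        ... | inj₁ all = y , ws , gr , ↭-sym (unique-⊆⊇ (grown-unique gr) uts sub all) , y∉
        ... | inj₂ (v , v∈ , v∉) with cross gr sup v∈ v∉
        ...   | a , b , a∈ , b∈ , b∉ , adj with fuel
        ...     | suc fuel = loop fuel (grow b∉ a∈ adj gr) (b∉ ∘ sup)
                    (λ { (here refl) → b∈ ; (there u∈) → sub u∈ }) (there ∘ sup)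
                    (≤-trans le (≤-reflexive (sym (+-suc fuel _))))
        ...     | zero = contradiction (unique-⊆-length (¬Any⇒All¬ _ b∉ ∷ grown-unique gr)
                                         (λ { (here refl) → b∈ ; (there u∈) → sub u∈ })) (<⇒≱ (s≤s le))

      -- Vertices are added greedily to the connected start `c₀`. The one added last becomes the
      -- head and lies outside `c₀`, which yields a deletable vertex that avoids prescribed ones.
      extend : Grown c₀ → (∀ {v} → v ∈ c₀ → v ∈ ts) →
               (c₀ ↭ ts) ⊎ ∃₂ λ y ws → Grown (y ∷ ws) × y ∷ ws ↭ ts × y ∉ c₀
      extend gr sub with missing c₀
      ... | inj₁ all = inj₁ (↭-sym (unique-⊆⊇ (grown-unique gr) uts sub all))
      ... | inj₂ (v , v∈ , v∉) with cross gr id v∈ v∉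
      ...   | a , b , a∈ , b∈ , b∉ , adj = inj₂ (loop (length ts) (grow b∉ a∈ adj gr) b∉
                    (λ { (here refl) → b∈ ; (there u∈) → sub u∈ }) there (m≤m+n _ _))

    -- Parents have smaller rank, so following them from a missing vertex leads to one that is
    -- missing while its parent is present. Their edge prolongs the list.
    grown-ranked : ∀ {ts r} (g : Fin n → ℕ) → Unique ts → r ∈ ts →
                   (∀ {v} → v ∈ ts → v ≢ r → ∃ λ w → w ∈ ts × Adj G v w × g w < g v) →
                   ∃ λ c → Grown c × c ↭ ts
    grown-ranked {ts} {r} g uts r∈ parent
      with extend {c₀ = r ∷ []} uts (λ _ sup v∈ v∉ → cross (sup (here refl)) v∈ v∉ (<-wellFounded _))
                  [ r ] (λ { (here refl) → r∈ })
      where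
      cross : ∀ {c v} → r ∈ c → v ∈ ts → v ∉ c → Acc _<_ (g v) →
              ∃₂ λ a b → a ∈ c × b ∈ ts × b ∉ c × Adj G b a
      cross {c} {v} r∈c v∈ v∉ (acc rec) with parent v∈ (λ { refl → v∉ r∈c })
      ... | w , w∈ , adj , lt with w ∈? c
      ...   | yes w∈c = w , v , w∈c , v∈ , v∉ , adj
      ...   | no  w∉c = cross r∈c w∈ w∉c (rec lt)
    ... | inj₁ p                     = r ∷ [] , [ r ] , p
    ... | inj₂ (y , ws , gr , p , _) = y ∷ ws , gr , p

    -- A parent is nearer to `r` than its child and so is never the farthest vertex `z`. Hence `d r`
    -- still ranks the vertices without `z`, and `z` can be added last.
    grown-farthest : ∀ {r z} → r ≢ z → (∀ v → d r v ≤ d r z) → ∃ λ vs → Grown (z ∷ vs) × z ∷ vs ↭ allFin n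
    grown-farthest {r} {z} r≢z max with ∈⇒↭ (∈-allFin z) | hasNeighbour (≢-sym r≢z)
    ... | ts , split | y , zy with grown-ranked (d r) (uniqueᵗ (unique-resp-↭ split (allFin⁺ n)))
      (∈ts r≢z) parent | ∈ts (λ { refl → irrefl G refl zy })
      where
      uniqueᵗ : ∀ {x} {xs : List (Fin n)} → Unique (x ∷ xs) → Unique xs
      uniqueᵗ (_ ∷ u) = u
      ∈ts : ∀ {v} → v ≢ z → v ∈ ts
      ∈ts {v} v≢z with ∈-resp-↭ split (∈-allFin v)
      ... | here eq  = contradiction eq v≢z
      ... | there v∈ = v∈
      parent : ∀ {v} → v ∈ ts → v ≢ r → ∃ λ w → w ∈ ts × Adj G v w × d r w < d r v
      parent {v} _ v≢r with d r v in eq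
      ... | zero  = contradiction (sym (d-zero eq)) v≢r
      ... | suc t with d-parent eq
      ...   | w , vw , dw = w , ∈ts (λ { refl → 1+n≰n (≤-trans (≤-reflexive (sym eq)) (≤-trans (max v)
        (≤-reflexive dw))) })
                              , vw , s≤s (≤-reflexive dw)
    ...   | vs , gr , p | y∈ =
      vs , grow (Unique[x∷xs]⇒x∉xs (unique-resp-↭ perm (allFin⁺ n))) (∈-resp-↭ (↭-sym p) y∈) zy gr , ↭-sym perm
      where
      perm : allFin n ↭ z ∷ vs
      perm = ↭-trans split (prep z (↭-sym p))

    -- Discrete intermediate values: on an edge across the cut between values at most `t` and values
    -- above `t`, the lower end has exactly the value `t`.
    grown-level : ∀ {vs} → Grown vs → (g : Fin n → ℕ) → (∀ {u v} → Adj G u v → g u ≤ suc (g v)) →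
                  ∀ {a b t} → a ∈ vs → b ∈ vs → g a ≤ t → t ≤ g b → ∃ λ c → c ∈ vs × g c ≡ t
    grown-level gr g lip {a} {b} {t} a∈ b∈ ga≤t t≤gb with g b ≤? t
    ... | yes gb≤t = b , b∈ , ≤-antisym gb≤t t≤gb
    ... | no  gb≰t with crossing gr (λ v → g v ≤? t) a∈ ga≤t b∈ gb≰t
    ...   | u , v , u∈ , v∈ , adj , gu≤t , gv≰t =
      u , u∈ , ≤-antisym gu≤t (s≤s⁻¹ (≤-trans (≰⇒> gv≰t) (lip (symm G adj))))

    grown-gapFree : ∀ {x vs} → Grown vs → x ∈ vs → GapFree (map (d x) vs)
    grown-gapFree {x} {vs} gr x∈ {t} t∈ with ∈-map⁻ (d x) t∈
    ... | v , v∈ , eq with grown-level gr (d x) (d-lipschitz x) x∈ v∈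
                             (≤-trans (≤-reflexive (d-self x)) z≤n)
                             (≤-trans (n≤1+n t) (≤-reflexive eq))
    ...   | c , c∈ , refl = ∈-map⁺ (d x) c∈

    sum-self : ∀ x vs → sum (map (d x) (x ∷ vs)) ≡ sumOf (d x) vs
    sum-self x vs = cong (_+ sumOf (d x) vs) (d-self x)

    gapFree-transmission : ∀ {x vs} → GapFree (map (d x) (x ∷ vs)) → sumOf (d x) vs ≤ tri (suc (length vs))
    gapFree-transmission {x} {vs} gf = begin
      sumOf (d x) vs                     ≡⟨ sum-self x vs ⟨
      sum (map (d x) (x ∷ vs))           ≤⟨ gapFree-sum gf ⟩
      tri (length (map (d x) (x ∷ vs)))  ≡⟨ cong tri (length-map (d x) (x ∷ vs)) ⟩
      tri (suc (length vs))              ∎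
      where open ≤-Reasoning

    transmission : ∀ {x vs} → Grown (x ∷ vs) → sumOf (d x) vs ≤ tri (suc (length vs))
    transmission gr = gapFree-transmission (grown-gapFree gr (here refl))

    transmission-tight : ∀ {x vs} → GapFree (map (d x) (x ∷ vs)) → sumOf (d x) vs ≡ tri (suc (length vs)) →
                         map (d x) (x ∷ vs) ↭ downFrom (suc (length vs))
    transmission-tight {x} {vs} gf eq = subst (λ l → map (d x) (x ∷ vs) ↭ downFrom l) len
      (gapFree-tight gf (trans (sum-self x vs) (trans eq (cong tri (sym len)))))
      where len = length-map (d x) (x ∷ vs)

    grown-pairs : ∀ {vs} → Grown vs → pairs d vs ≤ tet (length vs)
    grown-pairs [ r ]                    = z≤n
    grown-pairs gr@(grow _ _ _ gr′) = +-mono-≤ (transmission gr) (grown-pairs gr′)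

    grown-all : ∀ {vs} → Grown vs → vs ↭ allFin n → W G ≡ pairs d vs
    grown-all gr p = trans (W-pairs G) (sym (pairs-↭ d d-sym p))

    -- The other neighbour b still realises the distance 1.
    omit-neighbour : ∀ {x vs a b} → GapFree (map (d x) (x ∷ vs)) → Adj G x a → Adj G x b → a ∈ vs → b ∈ vs → a ≢ b →
      ∃ λ vs′ → vs ↭ a ∷ vs′ × GapFree (map (d x) (x ∷ vs′)) × length vs ≡ suc (length vs′) ×
                sumOf (d x) vs ≡ suc (sumOf (d x) vs′)
    omit-neighbour {x} {vs} {a} {b} gf₀ xa xb a∈ b∈ a≢b with ∈⇒↭ a∈
    ... | vs′ , p = vs′ , p , gapFree-drop gf a∈′ , ↭-length p
                  , trans (sumOf-↭ (d x) p) (cong (_+ sumOf (d x) vs′) (d-adj xa))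
      where
      gf : GapFree (d x a ∷ map (d x) (x ∷ vs′))
      gf = gapFree-↭ (map⁺ (d x) (↭-trans (prep x p) (swap x a refl))) gf₀
      b∈′ : b ∈ vs′
      b∈′ with ∈-resp-↭ p b∈
      ... | here refl = contradiction refl a≢b
      ... | there b∈  = b∈
      a∈′ : d x a ∈ map (d x) (x ∷ vs′)
      a∈′ = subst (_∈ map (d x) (x ∷ vs′)) (trans (d-adj xb) (sym (d-adj xa))) (∈-map⁺ (d x) (there b∈′))

    -- One of the two neighbours is set aside and contributes 1; the others still have no gaps and
    -- number one less.
    transmission-two : ∀ {x vs a b} → Grown (x ∷ vs) → Adj G x a → Adj G x b → a ∈ vs → b ∈ vs → a ≢ b →
                       sumOf (d x) vs ≤ 1 + tri (length vs)
    transmission-two gr xa xb a∈ b∈ a≢b with omit-neighbour (grown-gapFree gr (here refl)) xa xb a∈ b∈ a≢b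
    ... | vs′ , p , gf , len , sm = ≤-trans (≤-reflexive sm)
      (s≤s (≤-trans (gapFree-transmission gf) (≤-reflexive (cong tri (sym len)))))

    tight-injective : ∀ (f : Fin n → ℕ) {vs m u v} → map f vs ↭ downFrom m → u ∈ vs → v ∈ vs → f u ≡ f v → u ≡ v
    tight-injective f {m = m} p = unique-map-injective f (unique-resp-↭ (↭-sym p) (downFrom⁺ m))

    tight-< : ∀ (f : Fin n → ℕ) {vs m u} → map f vs ↭ downFrom m → u ∈ vs → f u < m
    tight-< f p u∈ = ∈-downFrom⁻ (∈-resp-↭ p (∈-map⁺ f u∈))

    tight-onto : ∀ (f : Fin n → ℕ) vs {m i} → map f vs ↭ downFrom m → i < m → ∃ λ u → u ∈ vs × f u ≡ i
    tight-onto f vs p i<m with ∈-map⁻ f (∈-resp-↭ (↭-sym p) (∈-downFrom⁺ i<m))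
    ... | u , u∈ , eq = u , u∈ , sym eq

    -- A neighbour of `c` in `vs` can lie neither above `c`, where no value remains, nor beside it,
    -- by injectivity; one level below there is only one vertex. Hence a vertex with two neighbours
    -- in `vs` cannot end such a path, which is what rules out equality again and again.
    top-neighbour : ∀ r {vs m c a b} → map (d r) vs ↭ downFrom (suc m) → c ∈ vs → d r c ≡ m →
                    a ∈ vs → b ∈ vs → Adj G c a → Adj G c b → a ≡ b
    top-neighbour r {vs} {m} {c} p c∈ dc a∈ b∈ ca cb =
      tight-injective (d r) p a∈ b∈ (suc-injective (trans (below a∈ ca) (sym (below b∈ cb))))
      where
      below : ∀ {v} → v ∈ vs → Adj G c v → suc (d r v) ≡ m
      below {v} v∈ cv with d-close r cv
      ... | inj₁ eq        = contradiction (tight-< (d r) p v∈)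
        (<⇒≱ (s≤s (≤-reflexive (trans (cong suc (sym dc)) eq))))
      ... | inj₂ (inj₁ eq) = trans eq dc
      ... | inj₂ (inj₂ eq) = contradiction cv (irrefl G (tight-injective (d r) p c∈ v∈ eq))

    -- Simple paths

    data Path : Fin n → Fin n → List (Fin n) → Set where
      [_]  : ∀ v → Path v v (v ∷ [])
      step : ∀ {x y w c} → x ∉ c → Adj G x y → Path y w c → Path x w (x ∷ c)

    path-start : ∀ {x w c} → Path x w c → x ∈ c
    path-start [ v ]        = here refl
    path-start (step _ _ _) = here refl

    path-end : ∀ {x w c} → Path x w c → w ∈ c
    path-end [ v ]        = here refl
    path-end (step _ _ p) = there (path-end p)

    path-grown : ∀ {x w c} → Path x w c → Grown c
    path-grown [ v ]           = [ v ]
    path-grown (step x∉ adj p) = grow x∉ (path-start p) adj (path-grown p)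

    path-snoc : ∀ {u v w c} → Path u v c → w ∉ c → Adj G v w → Path u w (c ++ w ∷ [])
    path-snoc [ v ] w∉ adj = step (λ { (here refl) → w∉ (here refl) }) adj [ _ ]
    path-snoc (step {c = c} x∉ a p) w∉ adj = step
      ([ x∉ , (λ { (here refl) → w∉ (here refl) }) ]′ ∘ ∈-++⁻ c) a (path-snoc p (w∉ ∘ there) adj)

    -- When an end is the newest vertex, the path is continued by the edge to its earlier neighbour;
    -- freshness keeps the path simple.
    pathBetween : ∀ {vs u w} → Grown vs → u ∈ vs → w ∈ vs → ∃ λ c → (∀ {v} → v ∈ c → v ∈ vs) × Path u w c
    pathBetween [ r ] (here refl) (here refl) = r ∷ [] , id , [ r ]
    pathBetween (grow {x} _ _ _ _) (here refl) (here refl) = x ∷ [] , (λ { (here refl) → here refl }) , [ x ]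
    pathBetween (grow x∉ y∈ adj gr) (here refl) (there w∈) with pathBetween gr y∈ w∈
    ... | c , sub , p = -, (λ { (here refl) → here refl ; (there v∈) → there (sub v∈) }) , step (x∉ ∘ sub) adj p
    pathBetween (grow x∉ y∈ adj gr) (there u∈) (here refl) with pathBetween gr u∈ y∈
    ... | c , sub , p = -, [ there ∘ sub , (λ { (here refl) → here refl }) ]′ ∘ ∈-++⁻ c , path-snoc p (x∉ ∘ sub)
      (symm G adj)
    pathBetween (grow x∉ y∈ adj gr) (there u∈) (there w∈) with pathBetween gr u∈ w∈
    ... | c , sub , p = c , there ∘ sub , p

    -- A path from u to w is grown to all of vs; the last vertex added, if any, is the deletable one.
    path-or-deletable : ∀ {vs u w} → Grown vs → u ∈ vs → w ∈ vs →
      (∃ λ c → c ↭ vs × Path u w c) ⊎ (∃₂ λ y ws → Grown (y ∷ ws) × y ∷ ws ↭ vs × y ≢ u × y ≢ w)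
    path-or-deletable {vs} gr u∈ w∈ with pathBetween gr u∈ w∈
    ... | c , sub , p with extend {vs} {c} (grown-unique gr) cross (path-grown p) sub
      where
      cross : ∀ {c′ v} → Grown c′ → (∀ {u} → u ∈ c → u ∈ c′) → v ∈ vs → v ∉ c′ →
              ∃₂ λ a b → a ∈ c′ × b ∈ vs × b ∉ c′ × Adj G b a
      cross {c′} _ sup v∈ v∉ with crossing gr (_∈? c′) u∈ (sup (path-start p)) v∈ v∉
      ... | a , b , a∈ , b∈ , adj , a∈c , b∉c = a , b , a∈c , b∈ , b∉c , symm G adj
    ...   | inj₁ q = inj₁ (c , q , p)
    ...   | inj₂ (y , ws , gr′ , q , y∉) =
      inj₂ (y , ws , gr′ , q , (λ { refl → y∉ (path-start p) }) , (λ { refl → y∉ (path-end p) }))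

    -- The sum s + (s + 1) + ... + (s + p - 1): the largest total over `p` successive vertices of a
    -- path for a function that starts with at most `s` and grows by at most 1 per edge.
    run : ℕ → ℕ → ℕ
    run s zero    = 0
    run s (suc p) = s + run (suc s) p

    -- The first p vertices are bounded from the start of the path, the other suc r from its end.
    path-sum : ∀ {u w c} → Path u w c → (g : Fin n → ℕ) → (∀ {x y} → Adj G x y → g x ≤ suc (g y)) →
               ∀ {s t} → g u ≤ s → g w ≤ t → ∀ p r → length c ≡ p + suc r → sumOf g c ≤ run s p + run t (suc r)
    path-sum (step x∉ adj pa) g lip {s} {t} gu gw (suc p) r eq =
      ≤-trans (+-mono-≤ gu (path-sum pa g lip (≤-trans (lip (symm G adj)) (s≤s gu)) gw p r (suc-injective eq)))
              (≤-reflexive (sym (+-assoc s (run (suc s) p) (run t (suc r)))))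
    path-sum [ v ] g lip gu gw (suc p) r eq with () ← trans (suc-injective eq) (+-suc p r)
    path-sum pa g lip {t = t} gu gw zero r eq = ≤-trans (proj₂ (fromEnd pa gw)) (≤-reflexive (cong (run t) eq))
      where
      run-suc : ∀ t m → run t m + (t + m) ≡ run t (suc m)
      run-suc t zero    = refl
      run-suc t (suc m) = trans (+-assoc t (run (suc t) m) _)
        (cong (t +_) (trans (cong (run (suc t) m +_) (+-suc t m)) (run-suc (suc t) m)))
      fromEnd : ∀ {u w c} → Path u w c → g w ≤ t → suc (g u) ≤ t + length c × sumOf g c ≤ run t (length c)
      fromEnd [ v ] gv = ≤-trans (s≤s gv) (≤-reflexive (+-comm 1 t)) , +-monoˡ-≤ 0 gv
      fromEnd (step {c = c} x∉ adj pa) gw with fromEnd pa gw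
      ... | le , sm = ≤-trans (s≤s le₁) (≤-reflexive (sym (+-suc t (length c))))
                    , ≤-trans (+-mono-≤ le₁ sm) (≤-reflexive (trans (+-comm (t + length c) _) (run-suc t (length c))))
        where le₁ = ≤-trans (lip adj) le

    gather : ∀ {x : Fin n} {vs} qs → All (_∈ x ∷ vs) qs → ∃₂ λ a rest → qs ↭ replicate a x ++ rest × All (_∈ vs) rest
    gather []       []                = 0 , [] , refl , []
    gather (q ∷ qs) (here refl ∷ ps) with gather qs ps
    ... | a , rest , p , all = suc a , rest , prep q p , all
    gather {x} (q ∷ qs) (there q∈ ∷ ps) with gather qs ps
    ... | a , rest , p , all = a , q ∷ rest , ↭-trans (prep q p) (↭-sym (shift q (replicate a x) rest)) , q∈ ∷ all

    pairs-replicate : ∀ a x → pairs d (replicate a x) ≡ 0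
    pairs-replicate zero    x = refl
    pairs-replicate (suc a) x = cong₂ _+_
      (trans (sumOf-replicate (d x) a x) (trans (cong (a *_) (d-self x)) (*-zeroʳ a))) (pairs-replicate a x)

    pairs-gather : ∀ a x rest → pairs d (replicate a x ++ rest) ≡ a * sumOf (d x) rest + pairs d rest
    pairs-gather a x rest = trans (pairs-++ d (replicate a x) rest)
      (cong₂ (λ z w → z + w + pairs d rest) (pairs-replicate a x) (sumOf-replicate (λ y → sumOf (d y) rest) a x))

    sum-neighbour : ∀ {x y} → Adj G x y → ∀ vs → sumOf (d x) vs ≤ length vs + sumOf (d y) vs
    sum-neighbour {x} {y} adj vs = ≤-trans
      (sumOf-≤ {g = λ v → 1 + d y v} vs (All.tabulate (λ {v} _ →
        ≤-trans (d-triangle x y v) (+-monoˡ-≤ (d y v) (≤-reflexive (d-adj adj))))))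
      (≤-reflexive (trans (sumOf-+ (λ _ → 1) (d y) vs) (cong (_+ sumOf (d y) vs) (trans (sumOf-const 1 vs)
        (*-identityʳ _)))))

    -- Moving the a members of qs at x to its neighbour y costs at most 1 for
    -- each of the a (k − a) pairs that they form with the others.
    multiset-pairs : ∀ {vs} → Grown vs → ∀ {qs} → All (_∈ vs) qs →
                     pairs d qs ≤ pred (length vs) * balanced (length qs)
    multiset-pairs [ r ] {qs} all with gather qs all
    ... | a , [] , p , [] = ≤-reflexive (trans (pairs-↭ d d-sym p) (trans (pairs-gather a r []) (trans (+-identityʳ _)
      (*-zeroʳ a))))
    multiset-pairs (grow {x} {y} {vs} x∉ y∈ adj gr) {qs} all with gather qs all
    ... | a , rest , p , all′ = begin
      pairs d qs                                             ≡⟨ pairs-↭ d d-sym p ⟩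
      pairs d (replicate a x ++ rest)                        ≡⟨ pairs-gather a x rest ⟩
      a * sumOf (d x) rest + pairs d rest                    ≤⟨ +-monoˡ-≤ (pairs d rest)
        (*-monoʳ-≤ a (sum-neighbour adj rest)) ⟩
      a * (length rest + sumOf (d y) rest) + pairs d rest    ≡⟨ lemma a (length rest) _ _ ⟩
      a * length rest + (a * sumOf (d y) rest + pairs d rest) ≡⟨ cong (a * length rest +_) (pairs-gather a y rest) ⟨
      a * length rest + pairs d (replicate a y ++ rest)      ≤⟨ +-mono-≤ (m*n≤balanced a (length rest))
                    (multiset-pairs gr (All.++⁺ (All.replicate⁺ a y∈) all′)) ⟩
      balanced (a + length rest) + pred (length vs) * balanced (length (replicate a y ++ rest))
                    ≡⟨ cong₂ (λ i j → balanced i + pred (length vs) * balanced j) len (sizes y) ⟩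
      balanced (length qs) + pred (length vs) * balanced (length qs) ≡⟨ cong (λ z → z * balanced (length qs))
        (suc-pred-length y∈) ⟩
      length vs * balanced (length qs)                        ∎
      where
      open ≤-Reasoning
      len : a + length rest ≡ length qs
      len = sym (trans (↭-length p) (trans (length-++ (replicate a x)) (cong (_+ length rest) (length-replicate a))))
      sizes : ∀ z → length (replicate a z ++ rest) ≡ length qs
      sizes z = trans (length-++ (replicate a z)) (trans (cong (_+ length rest) (length-replicate a)) len)
      lemma : ∀ a r s t → a * (r + s) + t ≡ a * r + (a * s + t)
      lemma = solve-∀
      suc-pred-length : ∀ {z} {zs : List (Fin n)} → z ∈ zs → suc (pred (length zs)) ≡ length zs
      suc-pred-length (here _)  = refl
      suc-pred-length (there _) = refl

  -- Isomorphism invariance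

  module _ {m n} {G : Graph m} {H : Graph n} (iso : G ≅ H) where

    private
      f    = proj₁ iso
      adj  = proj₂ iso
      to   = Inverse.to f
      from = Inverse.from f

      to-from : ∀ v → to (from v) ≡ v
      to-from v = Inverse.inverseˡ f refl

      to-injective : ∀ {u v} → to u ≡ to v → u ≡ v
      to-injective eq = trans (sym (Inverse.inverseʳ f refl)) (trans (cong from eq) (Inverse.inverseʳ f refl))

      walk-to : ∀ {ℓ u v} → Walk G ℓ u v → Walk H ℓ (to u) (to v)
      walk-to []      = []
      walk-to (a ∷ p) = Equivalence.to (adj _ _) a ∷ walk-to p

      -- The ends are variables tied by equations, since the empty walk cannot be matched between
      -- `to u` and `to v` directly.
      walk-from : ∀ {ℓ x y u v} → x ≡ to u → y ≡ to v → Walk H ℓ x y → Walk G ℓ u v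
      walk-from eu ev [] with refl ← to-injective (trans (sym eu) ev) = []
      walk-from {u = u} refl ev (_∷_ {w = w} a p) =
        Equivalence.from (adj u (from w)) (subst (Adj H (to u)) (sym (to-from w)) a)
          ∷ walk-from (sym (to-from w)) ev p

    ≅-connected : Connected G → Connected H
    ≅-connected conn u v with conn (from u) (from v)
    ... | ℓ , p = ℓ , subst₂ (Walk H ℓ) (to-from u) (to-from v) (walk-to p)

    ≅-W : Connected G → W G ≡ W H
    ≅-W conn = begin
      W G                                              ≡⟨ W-pairs G ⟩
      pairs (dist G) (allFin m)                        ≡⟨ pairs-cong (allFin⁺ m) (λ {u} {v} _ → dist-to u v) ⟩
      pairs (λ u v → dist H (to u) (to v)) (allFin m)  ≡⟨ pairs-map (dist H) to (allFin m) ⟨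
      pairs (dist H) (map to (allFin m))               ≡⟨ pairs-↭ (dist H) (Metric.d-sym H connH)
                    (unique-⊆⊇ (allFin⁺ n) (Unique.map⁺ to-injective (allFin⁺ m))
                    (λ {v} _ → subst (_∈ map to (allFin m)) (to-from v) (∈-map⁺ to (∈-allFin (from v))))
                      (λ _ → ∈-allFin _)) ⟩
      pairs (dist H) (allFin n)                        ≡⟨ W-pairs H ⟨
      W H                                              ∎
      where
      open ≡-Reasoning
      connH = ≅-connected conn
      dist-to : ∀ u v → dist G u v ≡ dist H (to u) (to v)
      dist-to u v = ≤-antisym (dist-≤ G (walk-from refl refl (Metric.d-walk H connH (to u) (to v))))
                              (dist-≤ H (walk-to (Metric.d-walk G conn u v)))

  -- Graphs arranged in levels

  Joined : ∀ {n} → (ℕ → Set) → (Fin n → ℕ) → Fin n → Fin n → Set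
  Joined E level u v = suc (level u) ≡ level v ⊎ suc (level v) ≡ level u ⊎ (u ≢ v × level u ≡ level v × E (level u))

  -- All edges between consecutive levels; the levels satisfying E are cliques
  -- and the others are independent. ℓs is the multiset of levels.
  record Levelled {n} (G : Graph n) (ℓs : List ℕ) (E : ℕ → Set) : Set where
    field
      level  : Fin n → ℕ
      levels : map level (allFin n) ↭ ℓs
      adj⇔   : ∀ u v → Adj G u v ⇔ Joined E level u v

  levelled-resp-↭ : ∀ {n} {G : Graph n} {ℓs ℓs′ E} → ℓs ↭ ℓs′ → Levelled G ℓs E → Levelled G ℓs′ E
  levelled-resp-↭ p L = record { level = level ; levels = ↭-trans levels p ; adj⇔ = adj⇔ }
    where open Levelled L

  -- The graph does not determine in which direction its levels are numbered. Counting from a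
  -- pendant vertex can give the reverse of the order in the model graph.
  flip-levels : ∀ {n} {G : Graph n} {ℓs E E′} M → (L : Levelled G ℓs E) → (∀ u → Levelled.level L u ≤ M) →
                (∀ {i} → i ≤ M → E i ⇔ E′ (M ∸ i)) → Levelled G (map (M ∸_) ℓs) E′
  flip-levels {n} {G} {ℓs} {E} {E′} M L bound E⇔ = record
    { level  = λ u → M ∸ level u
    ; levels = subst (_↭ _) (sym (map-∘ (allFin n))) (map⁺ (M ∸_) levels)
    ; adj⇔   = λ u v → mk⇔ (forth u v ∘ Equivalence.to (adj⇔ u v)) (Equivalence.from (adj⇔ u v) ∘ back u v)
    }
    where
    open Levelled L
    down : ∀ {u v} → suc (level u) ≡ level v → suc (M ∸ level v) ≡ M ∸ level u
    down {u} {v} eq = trans (cong (λ z → suc (M ∸ z)) (sym eq))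
                            (sym (+-∸-assoc 1 (≤-trans (≤-reflexive eq) (bound v))))
    up : ∀ {u v} → suc (M ∸ level v) ≡ M ∸ level u → suc (level u) ≡ level v
    up {u} {v} eq = +-cancelˡ-≡ (M ∸ level v) _ _ (begin
      M ∸ level v + suc (level u)   ≡⟨ +-suc (M ∸ level v) (level u) ⟩
      suc (M ∸ level v) + level u   ≡⟨ cong (_+ level u) eq ⟩
      M ∸ level u + level u         ≡⟨ m∸n+n≡m (bound u) ⟩
      M                             ≡⟨ m∸n+n≡m (bound v) ⟨
      M ∸ level v + level v         ∎)
      where open ≡-Reasoning
    forth : ∀ u v → Joined E level u v → Joined E′ (λ u → M ∸ level u) u v
    forth u v (inj₁ eq)                   = inj₂ (inj₁ (down {u} {v} eq))
    forth u v (inj₂ (inj₁ eq))            = inj₁ (down {v} {u} eq)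
    forth u v (inj₂ (inj₂ (u≢v , eq , e))) = inj₂ (inj₂ (u≢v , cong (M ∸_) eq , Equivalence.to (E⇔ (bound u)) e))
    back : ∀ u v → Joined E′ (λ u → M ∸ level u) u v → Joined E level u v
    back u v (inj₁ eq)                   = inj₂ (inj₁ (up {v} {u} eq))
    back u v (inj₂ (inj₁ eq))            = inj₁ (up {u} {v} eq)
    back u v (inj₂ (inj₂ (u≢v , eq , e))) =
      inj₂ (inj₂ (u≢v , ∸-cancelˡ-≡ (bound u) (bound v) eq , Equivalence.from (E⇔ (bound u)) e))

  map≡tabulate : ∀ {A B : Set} (h : A → B) {m} (g : Fin m → B) zs → tabulate g ≡ map h zs →
                 ∃ λ f → zs ≡ tabulate f × (∀ i → h (f i) ≡ g i)
  map≡tabulate h {zero}  g []       eq = (λ ()) , refl , λ ()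
  map≡tabulate h {suc m} g (z ∷ zs) eq with ∷-injective eq
  ... | e₁ , e₂ with map≡tabulate h (g ∘ suc) zs e₂
  ...   | f , refl , hf = (λ { zero → z ; (suc i) → f i }) , refl , λ { zero → sym e₁ ; (suc i) → hf i }

  -- Since the level lists agree up to order, the vertices of `H` can be listed so that the i-th
  -- lies on the level of the i-th vertex of `G`. This matching is an isomorphism because adjacency
  -- depends on levels and distinctness only.
  levelled-≅ : ∀ {m n} {G : Graph m} {H : Graph n} {ℓs E} → Levelled G ℓs E → Levelled H ℓs E → G ≅ H
  levelled-≅ {m} {n} {G} {H} {ℓs} {E} LG LH
    with ↭-map-inv (Levelled.level LH) (↭-trans (Levelled.levels LH) (↭-sym (Levelled.levels LG)))
  ... | zs , eq , all↭zs
    with map≡tabulate (Levelled.level LH) (Levelled.level LG) zs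
      (trans (sym (map-tabulate id (Levelled.level LG))) eq)
  ... | f , refl , level-f = mk↔ₛ′ f (proj₁ ∘ preimage) (sym ∘ proj₂ ∘ preimage)
                               (λ u → f-injective (sym (proj₂ (preimage (f u)))))
                           , λ u v → mk⇔ (Equivalence.from (LH.adj⇔ (f u) (f v)) ∘ forth u v ∘ Equivalence.to
                             (LG.adj⇔ u v))
                                         (Equivalence.from (LG.adj⇔ u v) ∘ back u v ∘ Equivalence.to (LH.adj⇔ (f u)
                                           (f v)))
    where
    module LG = Levelled LG
    module LH = Levelled LH
    f-injective : ∀ {u v} → f u ≡ f v → u ≡ v
    f-injective = unique-map-injective f (subst Unique (sym (map-tabulate id f)) (unique-resp-↭ all↭zs (allFin⁺ n)))
                    (∈-allFin _) (∈-allFin _)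
    preimage : ∀ v → ∃ λ u → v ≡ f u
    preimage v = ∈-tabulate⁻ (∈-resp-↭ all↭zs (∈-allFin v))
    forth : ∀ u v → Joined E LG.level u v → Joined E LH.level (f u) (f v)
    forth u v j rewrite level-f u | level-f v =
      Sum.map₂ (Sum.map₂ (λ (u≢v , rest) → u≢v ∘ f-injective , rest)) j
    back : ∀ u v → Joined E LH.level (f u) (f v) → Joined E LG.level u v
    back u v j rewrite level-f u | level-f v =
      Sum.map₂ (Sum.map₂ (λ (u≢v , rest) → (λ { refl → u≢v refl }) , rest)) j

  module _ {E : ℕ → Set} (E? : Decidable E) where

    within : ℕ → ℕ
    within i with E? i
    ... | yes _ = 1
    ... | no  _ = 2

    -- The distance between distinct vertices on the levels i and j.
    τ : ℕ → ℕ → ℕ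
    τ i j with i ≟ j
    ... | yes _ = within i
    ... | no  _ = ∣ i - j ∣

    τ-≡ : ∀ i → τ i i ≡ within i
    τ-≡ i with i ≟ i
    ... | yes _ = refl
    ... | no ¬p = contradiction refl ¬p

    τ-≢ : ∀ {i j} → i ≢ j → τ i j ≡ ∣ i - j ∣
    τ-≢ {i} {j} i≢j with i ≟ j
    ... | yes p = contradiction p i≢j
    ... | no _  = refl

    τ-sym : ∀ i j → τ i j ≡ τ j i
    τ-sym i j with i ≟ j
    ... | yes refl = sym (τ-≡ i)
    ... | no i≢j   = trans (∣-∣-comm i j) (sym (τ-≢ (≢-sym i≢j)))

    module _ {n} {G : Graph n} {ℓs} (L : Levelled G ℓs E) (gapFree : GapFree ℓs) (1∈ : 1 ∈ ℓs) where
      open Levelled L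

      private
        atLevel : ∀ {i} → i ∈ ℓs → ∃ λ w → i ≡ level w
        atLevel i∈ with ∈-map⁻ level (∈-resp-↭ (↭-sym levels) i∈)
        ... | w , _ , eq = w , eq

        level∈ : ∀ u → level u ∈ ℓs
        level∈ u = ∈-resp-↭ levels (∈-map⁺ level (∈-allFin u))

        up : ∀ t u v → suc t + level u ≡ level v → Walk G (suc t) u v
        up zero    u v eq = Equivalence.from (adj⇔ u v) (inj₁ eq) ∷ []
        up (suc t) u v eq with atLevel (gapFree-≤ gapFree (≤-trans (s≤s (m≤n+m (level u) (suc t))) (≤-reflexive eq))
          (level∈ v))
        ... | w , lw = Equivalence.from (adj⇔ u w) (inj₁ lw)
                     ∷ up t w v (trans (cong (suc t +_) (sym lw)) (trans (+-suc (suc t) (level u)) eq))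

        climb : ∀ {u v} → level u < level v → Walk G ∣ level u - level v ∣ u v
        climb {u} {v} lt with m≤n⇒∃[o]m+o≡n lt
        ... | t , eq = subst (λ ℓ → Walk G ℓ u v) (sym gap) (up t u v (trans (cong suc (+-comm t (level u))) eq))
          where
          gap : ∣ level u - level v ∣ ≡ suc t
          gap = trans (cong (∣ level u -_∣) (trans (sym eq) (sym (+-suc (level u) t)))) (∣m-m+n∣≡n (level u) (suc t))

        -- A vertex one level below is a common neighbour. Level 0 has nothing below it, and there a
        -- vertex on level 1 is used; this is what `1∈` is for.
        detour : ∀ {u v} → level u ≡ level v → Walk G 2 u v
        detour {u} {v} eq with level u in lu
        ... | zero with atLevel 1∈
        ...   | w , lw = Equivalence.from (adj⇔ u w) (inj₁ (trans (cong suc lu) lw))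
                       ∷ Equivalence.from (adj⇔ w v) (inj₂ (inj₁ (trans (cong suc (sym eq)) lw))) ∷ []
        detour {u} {v} eq | suc i with atLevel (gapFree (subst (_∈ ℓs) lu (level∈ u)))
        ...   | w , lw = Equivalence.from (adj⇔ u w) (inj₂ (inj₁ (trans (cong suc (sym lw)) (sym lu))))
                       ∷ Equivalence.from (adj⇔ w v) (inj₁ (trans (cong suc (sym lw)) eq)) ∷ []

        τ-walk : ∀ {u v} → u ≢ v → Walk G (τ (level u) (level v)) u v
        τ-walk {u} {v} u≢v with level u ≟ level v
        ... | yes eq with E? (level u)
        ...   | yes e = Equivalence.from (adj⇔ u v) (inj₂ (inj₂ (u≢v , eq , e))) ∷ []
        ...   | no _  = detour eq
        τ-walk {u} {v} u≢v | no neq with <-cmp (level u) (level v)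
        ... | tri< lt _ _ = climb lt
        ... | tri≈ _ eq _ = contradiction eq neq
        ... | tri> _ _ gt = subst (λ ℓ → Walk G ℓ u v) (∣-∣-comm (level v) (level u)) (reverseWalk G (climb gt))

        level-lipschitz : ∀ {u v} → Adj G u v → ∣ level u - level v ∣ ≤ 1
        level-lipschitz {u} {v} a with Equivalence.to (adj⇔ u v) a
        ... | inj₁ eq               rewrite sym eq = ≤-reflexive (trans (cong (∣ level u -_∣) (+-comm 1 (level u)))
          (∣m-m+n∣≡n (level u) 1))
        ... | inj₂ (inj₁ eq)        rewrite sym eq = ≤-reflexive (trans (∣-∣-comm (suc (level v)) (level v))
          (trans (cong (∣ level v -_∣) (+-comm 1 (level v))) (∣m-m+n∣≡n (level v) 1)))
        ... | inj₂ (inj₂ (_ , eq , _)) rewrite eq | ∣n-n∣≡0 (level v) = z≤n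

        walk-gap : ∀ {ℓ u v} → Walk G ℓ u v → ∣ level u - level v ∣ ≤ ℓ
        walk-gap {u = u} [] = ≤-reflexive (∣n-n∣≡0 (level u))
        walk-gap {u = u} {v} (_∷_ {w = w} a p) =
          ≤-trans (∣-∣-triangle (level u) (level w) (level v)) (+-mono-≤ (level-lipschitz a) (walk-gap p))

        -- An edge changes the level by at most 1, which settles distinct levels. On one level the
        -- walk is nonempty, and on an independent level a single edge is impossible.
        τ-≤ : ∀ {ℓ u v} → u ≢ v → Walk G ℓ u v → τ (level u) (level v) ≤ ℓ
        τ-≤ {u = u} {v} u≢v p with level u ≟ level v
        τ-≤ u≢v p           | no _ = walk-gap p
        τ-≤ u≢v []          | yes _ = contradiction refl u≢v
        τ-≤ {u = u} u≢v p@(_ ∷ _) | yes eq with E? (level u)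
        τ-≤ u≢v (_ ∷ _)     | yes eq | yes _ = s≤s z≤n
        τ-≤ u≢v (_ ∷ _ ∷ _) | yes eq | no _  = s≤s (s≤s z≤n)
        τ-≤ {u = u} {v} u≢v (a ∷ [])  | yes eq | no ¬e with Equivalence.to (adj⇔ u v) a
        ... | inj₁ e               = contradiction (trans e (sym eq)) 1+n≢n
        ... | inj₂ (inj₁ e)        = contradiction (trans e eq) 1+n≢n
        ... | inj₂ (inj₂ (_ , _ , e)) = contradiction e ¬e

      levelled-connected : Connected G
      levelled-connected u v with u Fin.≟ v
      ... | yes refl = 0 , []
      ... | no u≢v   = -, τ-walk u≢v

      levelled-W : W G ≡ pairs τ ℓs
      levelled-W = begin
        W G                                          ≡⟨ W-pairs G ⟩
        pairs (dist G) (allFin n)                    ≡⟨ pairs-cong (allFin⁺ n) (λ {u} {v} u≢v → ≤-antisym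
                    (dist-≤ G (τ-walk u≢v)) (τ-≤ u≢v (Metric.d-walk G levelled-connected u v))) ⟩
        pairs (λ u v → τ (level u) (level v)) (allFin n) ≡⟨ pairs-map τ level (allFin n) ⟨
        pairs τ (map level (allFin n))               ≡⟨ pairs-↭ τ τ-sym levels ⟩
        pairs τ ℓs                                   ∎
        where open ≡-Reasoning

  -- Levels of the three model graphs

  tabulate-toℕ : ∀ {A : Set} (f : ℕ → A) n → tabulate {n = n} (f ∘ toℕ) ≡ applyUpTo f n
  tabulate-toℕ f zero    = refl
  tabulate-toℕ f (suc n) = cong (f 0 ∷_) (tabulate-toℕ (f ∘ suc) n)

  applyUpTo-+ : ∀ {A : Set} (f : ℕ → A) m n → applyUpTo f (m + n) ≡ applyUpTo f m ++ applyUpTo (f ∘ (m +_)) n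
  applyUpTo-+ f zero    n = refl
  applyUpTo-+ f (suc m) n = cong (f 0 ∷_) (applyUpTo-+ (f ∘ suc) m n)

  applyUpTo-cong : ∀ {A : Set} {f g : ℕ → A} n → (∀ {i} → i < n → f i ≡ g i) → applyUpTo f n ≡ applyUpTo g n
  applyUpTo-cong zero    eq = refl
  applyUpTo-cong (suc n) eq = cong₂ _∷_ (eq z<s) (applyUpTo-cong n (eq ∘ s≤s))

  applyUpTo-const : ∀ {A : Set} (x : A) n → applyUpTo (λ _ → x) n ≡ replicate n x
  applyUpTo-const x zero    = refl
  applyUpTo-const x (suc n) = cong (x ∷_) (applyUpTo-const x n)

  applyUpTo-↭ : ∀ {A : Set} (f : ℕ → A) n → applyUpTo f n ↭ applyDownFrom f n
  applyUpTo-↭ f zero    = refl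
  applyUpTo-↭ f (suc n) = ↭-trans (↭-reflexive (sym (applyUpTo-∷ʳ f n)))
                            (↭-trans (↭-sym (∷↭∷ʳ (f n) (applyUpTo f n))) (prep (f n) (applyUpTo-↭ f n)))

  -- Levels are assigned to natural numbers so that a concrete edge list can be checked without
  -- `Fin`. Since the edge relation is symmetrised, `clique` is required for x < y only.
  levelled-fromEdges : ∀ n es (lv : ℕ → ℕ) (E : ℕ → Set) →
    (∀ {x y} → (x , y) ∈ es → suc (lv x) ≡ lv y ⊎ suc (lv y) ≡ lv x ⊎ (lv x ≡ lv y × E (lv x))) →
    (∀ {x y} → x < n → y < n → suc (lv x) ≡ lv y → (x , y) ∈ es ⊎ (y , x) ∈ es) →
    (∀ {x y} → x < y → y < n → lv x ≡ lv y → E (lv x) → (x , y) ∈ es) →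
    Levelled (fromEdges n es) (applyUpTo lv n) E
  levelled-fromEdges n es lv E sound consecutive clique = record
    { level  = lv ∘ toℕ
    ; levels = ↭-reflexive (trans (map-tabulate id (lv ∘ toℕ)) (tabulate-toℕ lv n))
    ; adj⇔   = λ u v → mk⇔ (forth u v) (back u v)
    }
    where
    forth : ∀ u v → Adj (fromEdges n es) u v → Joined E (lv ∘ toℕ) u v
    forth u v (u≢v , inj₁ e) with sound e
    ... | inj₁ eq        = inj₁ eq
    ... | inj₂ (inj₁ eq) = inj₂ (inj₁ eq)
    ... | inj₂ (inj₂ r)  = inj₂ (inj₂ (u≢v , r))
    forth u v (u≢v , inj₂ e) with sound e
    ... | inj₁ eq        = inj₂ (inj₁ eq)
    ... | inj₂ (inj₁ eq) = inj₁ eq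
    ... | inj₂ (inj₂ (eq , p)) = inj₂ (inj₂ (u≢v , sym eq , subst E eq p))
    back : ∀ u v → Joined E (lv ∘ toℕ) u v → Adj (fromEdges n es) u v
    back u v (inj₁ eq)        = (λ { refl → 1+n≢n eq }) , consecutive (toℕ<n u) (toℕ<n v) eq
    back u v (inj₂ (inj₁ eq)) = (λ { refl → 1+n≢n eq }) , Sum.swap (consecutive (toℕ<n v) (toℕ<n u) eq)
    back u v (inj₂ (inj₂ (u≢v , eq , p))) with <-cmp (toℕ u) (toℕ v)
    ... | tri< lt _ _ = u≢v , inj₁ (clique lt (toℕ<n v) eq p)
    ... | tri≈ _ e _  = contradiction (toℕ-injective e) u≢v
    ... | tri> _ _ gt = u≢v , inj₂ (clique gt (toℕ<n u) (sym eq) (subst E eq p))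

  ∈-pathEdges⁺ : ∀ s p {i} → suc i < p → (s + i , suc (s + i)) ∈ pathEdges s p
  ∈-pathEdges⁺ s (suc p) (s≤s i<p) = ∈-map⁺ (λ i → s + i , suc (s + i)) (∈-upTo⁺ i<p)

  ∈-pathEdges⁻ : ∀ s p {x y} → (x , y) ∈ pathEdges s p → ∃ λ i → suc i < p × x ≡ s + i × y ≡ suc (s + i)
  ∈-pathEdges⁻ s (suc p) e with ∈-map⁻ (λ i → s + i , suc (s + i)) e
  ... | i , i∈ , refl = i , s≤s (∈-upTo⁻ i∈) , refl , refl

  ∈-starEdges⁺ : ∀ c s a {i} → i < a → (c , s + i) ∈ starEdges c s a
  ∈-starEdges⁺ c s a i<a = ∈-map⁺ (λ i → c , s + i) (∈-upTo⁺ i<a)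

  ∈-starEdges⁻ : ∀ c s a {x y} → (x , y) ∈ starEdges c s a → ∃ λ i → i < a × x ≡ c × y ≡ s + i
  ∈-starEdges⁻ c s a e with ∈-map⁻ (λ i → c , s + i) e
  ... | i , i∈ , refl = i , ∈-upTo⁻ i∈ , refl , refl

  module TLevels (a b d′ : ℕ) where

    d = suc d′

    levelsT : List ℕ
    levelsT = replicate a 0 ++ replicate b (suc d) ++ map suc (downFrom d)

    lv : ℕ → ℕ
    lv x with x <? d | x <? d + a
    ... | yes _ | _     = suc x
    ... | no _  | yes _ = 0
    ... | no _  | no _  = suc d

    lv-path : ∀ {x} → x < d → lv x ≡ suc x
    lv-path {x} lt with x <? d | x <? d + a
    ... | yes _ | _ = refl
    ... | no ¬p | _ = contradiction lt ¬p

    lv-left : ∀ {i} → i < a → lv (d + i) ≡ 0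
    lv-left {i} lt with d + i <? d | d + i <? d + a
    ... | yes p | _     = contradiction p (m+n≮m d i)
    ... | no _  | yes _ = refl
    ... | no _  | no ¬p = contradiction (+-monoʳ-< d lt) ¬p

    lv-right : ∀ i → lv (d + a + i) ≡ suc d
    lv-right i with d + a + i <? d | d + a + i <? d + a
    ... | yes p | _     = contradiction (≤-trans p (m≤m+n d a)) (m+n≮m (d + a) i)
    ... | no _  | yes p = contradiction p (m+n≮m (d + a) i)
    ... | no _  | no _  = refl

    data Region : ℕ → Set where
      path  : ∀ {x} → x < d → Region x
      left  : ∀ {i} → i < a → Region (d + i)
      right : ∀ {i} → i < b → Region (d + a + i)

    region : ∀ {x} → x < a + b + d → Region x
    region {x} x<n with x <? d
    ... | yes p = path p
    ... | no ¬p with m≤n⇒∃[o]m+o≡n (≮⇒≥ ¬p)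
    ...   | i , refl with i <? a
    ...     | yes q = left q
    ...     | no ¬q with m≤n⇒∃[o]m+o≡n (≮⇒≥ ¬q)
    ...       | j , refl = subst Region (+-assoc d a j) (right (+-cancelˡ-< (d + a) j b
                  (subst₂ _<_ (sym (+-assoc d a j)) (lemma a b d) x<n)))
      where
      lemma : ∀ a b d → a + b + d ≡ d + a + b
      lemma = solve-∀

    es : List (ℕ × ℕ)
    es = pathEdges 0 d ++ starEdges 0 d a ++ starEdges (d ∸ 1) (d + a) b

    sound : ∀ {x y} → (x , y) ∈ es → suc (lv x) ≡ lv y ⊎ suc (lv y) ≡ lv x ⊎ (lv x ≡ lv y × ⊥)
    sound e with ∈-++⁻ (pathEdges 0 d) e
    ... | inj₁ e₁ with ∈-pathEdges⁻ 0 d e₁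
    ...   | i , lt , refl , refl = inj₁ (trans (cong suc (lv-path (<-trans (n<1+n i) lt))) (sym (lv-path lt)))
    sound e | inj₂ e₁ with ∈-++⁻ (starEdges 0 d a) e₁
    ... | inj₁ e₂ with ∈-starEdges⁻ 0 d a e₂
    ...   | i , lt , refl , refl = inj₂ (inj₁ (trans (cong suc (lv-left lt)) (sym (lv-path z<s))))
    sound e | inj₂ e₁ | inj₂ e₂ with ∈-starEdges⁻ d′ (d + a) b e₂
    ...   | i , lt , refl , refl = inj₁ (trans (cong suc (lv-path ≤-refl)) (sym (lv-right i)))

    consecutive : ∀ {x y} → x < a + b + d → y < a + b + d → suc (lv x) ≡ lv y → (x , y) ∈ es ⊎ (y , x) ∈ es
    consecutive x<n y<n eq with region x<n | region y<n
    ... | path p | path q with refl ← suc-injective (trans (cong suc (sym (lv-path p))) (trans eq (lv-path q))) =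
      inj₁ (∈-++⁺ˡ (∈-pathEdges⁺ 0 d q))
    ... | path p | left q with () ← trans eq (lv-left q)
    ... | path p | right {i} q with refl ← suc-injective (suc-injective (trans (cong suc (sym (lv-path p)))
      (trans eq (lv-right i)))) =
      inj₁ (∈-++⁺ʳ (pathEdges 0 d) (∈-++⁺ʳ (starEdges 0 d a) (∈-starEdges⁺ d′ (d + a) b q)))
    ... | left p | path q with refl ← suc-injective (trans (cong suc (sym (lv-left p))) (trans eq (lv-path q))) =
      inj₂ (∈-++⁺ʳ (pathEdges 0 d) (∈-++⁺ˡ (∈-starEdges⁺ 0 d a p)))
    ... | left p | left q with () ← trans eq (lv-left q)
    ... | left p | right {i} q with () ← trans (cong suc (sym (lv-left p))) (trans eq (lv-right i))
    ... | right {i} p | path q = contradiction (trans (sym (lv-path q)) (trans (sym eq) (cong suc (lv-right i))))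
                                               (λ e → <-irrefl (suc-injective e) (≤-trans q (n≤1+n d)))
    ... | right {i} p | left q with () ← trans eq (lv-left q)
    ... | right {i} p | right {j} q = contradiction (trans (cong suc (sym (lv-right i)))
      (trans eq (lv-right j))) 1+n≢n

    T-levelled : Levelled (T a b d) levelsT (λ _ → ⊥)
    T-levelled = levelled-resp-↭ perm (levelled-fromEdges (a + b + d) es lv (λ _ → ⊥) sound consecutive (λ _ _ _ ()))
      where
      size : a + b + d ≡ d + (a + b)
      size = +-comm (a + b) d
      perm : applyUpTo lv (a + b + d) ↭ levelsT
      perm = ↭-trans (↭-reflexive (begin
          applyUpTo lv (a + b + d)                                ≡⟨ cong (applyUpTo lv) size ⟩
          applyUpTo lv (d + (a + b))                              ≡⟨ applyUpTo-+ lv d (a + b) ⟩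
          applyUpTo lv d ++ applyUpTo (lv ∘ (d +_)) (a + b)       ≡⟨ cong₂ _++_ (applyUpTo-cong d lv-path)
                    (applyUpTo-+ (lv ∘ (d +_)) a b) ⟩
          applyUpTo suc d ++ applyUpTo (λ i → lv (d + i)) a ++ applyUpTo (λ i → lv (d + (a + i))) b
            ≡⟨ cong₂ (λ p q → applyUpTo suc d ++ p ++ q)
                 (trans (applyUpTo-cong a lv-left) (applyUpTo-const 0 a))
                 (trans (applyUpTo-cong b (λ {i} _ → trans (cong lv (sym (+-assoc d a i))) (lv-right i)))
                   (applyUpTo-const (suc d) b)) ⟩
          applyUpTo suc d ++ replicate a 0 ++ replicate b (suc d)  ∎))
        (↭-trans (++⁺ʳ _ (↭-trans (applyUpTo-↭ suc d) (↭-reflexive (sym (map-downFrom suc d)))))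
        (↭-trans (++-comm (map suc (downFrom d)) _) (↭-reflexive (++-assoc (replicate a 0) _ _))))
        where open ≡-Reasoning

  -- Under `pred` the vertices 0 and 1 of the triangle share level 0, and their edge is the only one
  -- inside a level.
  U-levelled : ∀ m → Levelled (Uˡ (4 + m) 3) (0 ∷ upTo (3 + m)) (_≡ 0)
  U-levelled m = levelled-fromEdges (4 + m) es pred (_≡ 0) sound consecutive clique
    where
    es = cycleEdges 0 3 ++ (2 , 3) ∷ pathEdges 3 (suc m)
    sound : ∀ {x y} → (x , y) ∈ es → suc (pred x) ≡ pred y ⊎ suc (pred y) ≡ pred x ⊎ (pred x ≡ pred y × pred x ≡ 0)
    sound (here refl)                         = inj₁ refl
    sound (there (here refl))                 = inj₂ (inj₂ (refl , refl))
    sound (there (there (here refl)))         = inj₁ refl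
    sound (there (there (there (here refl)))) = inj₁ refl
    sound (there (there (there (there e)))) with ∈-pathEdges⁻ 3 (suc m) e
    ... | i , _ , refl , refl = inj₁ refl
    consecutive : ∀ {x y} → x < 4 + m → y < 4 + m → suc (pred x) ≡ pred y → (x , y) ∈ es ⊎ (y , x) ∈ es
    consecutive {0}                 {suc _} _ _   refl = inj₁ (here refl)
    consecutive {1}                 {suc _} _ _   refl = inj₁ (there (there (here refl)))
    consecutive {2}                 {suc _} _ _   refl = inj₁ (there (there (there (here refl))))
    consecutive {suc (suc (suc i))} {suc _} _ y<n refl =
      inj₁ (there (there (there (there (∈-pathEdges⁺ 3 (suc m) (s≤s⁻¹ (s≤s⁻¹ (s≤s⁻¹ y<n))))))))
    clique : ∀ {x y} → x < y → y < 4 + m → pred x ≡ pred y → pred x ≡ 0 → (x , y) ∈ es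
    clique {0}     {1}           _   _ refl _ = there (here refl)
    clique {1}     {1}           (s≤s ()) _ _ _
    clique {suc x} {suc y} x<y _ refl _ = contradiction x<y (<-irrefl refl)

  module CLevels (m : ℕ) where

    e = 4 + m

    -- Truncation at both ends puts 0 and 1 on level 0 and the last two vertices on level `e`; every
    -- other level holds one vertex.
    lv : ℕ → ℕ
    lv x = pred x ⊓ e

    es : List (ℕ × ℕ)
    -- For n = 7 + m, `suc (m + 2)` and `e` are what n + 2 ∸ 6 and n ∸ 3 reduce to.
    es = cycleEdges 0 3 ++ pathEdges 2 (suc (m + 2)) ++ cycleEdges e 3

    E : ℕ → Set
    E i = i ≡ 0 ⊎ i ≡ e

    lv-mid : ∀ {i} → i ≤ e → lv (suc i) ≡ i
    lv-mid = m≤n⇒m⊓n≡m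

    lv-last : lv (2 + e) ≡ e
    lv-last = m≥n⇒m⊓n≡n (n≤1+n e)

    sound : ∀ {x y} → (x , y) ∈ es → suc (lv x) ≡ lv y ⊎ suc (lv y) ≡ lv x ⊎ (lv x ≡ lv y × E (lv x))
    sound (here refl)                 = inj₁ refl
    sound (there (here refl))         = inj₂ (inj₂ (refl , inj₁ refl))
    sound (there (there (here refl))) = inj₁ refl
    sound (there (there (there p))) with ∈-++⁻ (pathEdges 2 (suc (m + 2))) p
    ... | inj₁ q with ∈-pathEdges⁻ 2 (suc (m + 2)) q
    ...   | i , s≤s lt , refl , refl = inj₁ (trans (cong suc (lv-mid (≤-trans (n≤1+n _) le))) (sym (lv-mid le)))
      where
      le : 2 + i ≤ e
      le = ≤-trans (s≤s lt) (≤-trans (≤-reflexive (cong suc (+-comm m 2))) (n≤1+n _))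
    sound (there (there (there p))) | inj₂ (here refl) =
      inj₁ (trans (cong suc (lv-mid (n≤1+n _))) (sym (trans (cong lv (+-comm e 2)) lv-last)))
    sound (there (there (there p))) | inj₂ (there (here refl)) rewrite +-identityʳ m =
      inj₁ (trans (cong suc (lv-mid (n≤1+n _))) (sym (lv-mid ≤-refl)))
    sound (there (there (there p))) | inj₂ (there (there (here refl))) rewrite +-comm m 1 =
      inj₂ (inj₂ (trans (lv-mid ≤-refl) (sym lv-last) , inj₂ (lv-mid ≤-refl)))

    data Position : ℕ → Set where
      first : Position 0
      mid   : ∀ {i} → i ≤ e → Position (suc i)
      last  : Position (2 + e)

    position : ∀ {x} → x < 3 + e → Position x
    position {zero}  _ = first
    position {suc i} (s≤s i<) with i ≤? e
    ... | yes i≤e = mid i≤e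
    ... | no  i≰e with refl ← ≤-antisym (s≤s⁻¹ i<) (≰⇒> i≰e) = last

    cycle∈ : ∀ {p} → p ∈ cycleEdges e 3 → p ∈ es
    cycle∈ p = there (there (there (∈-++⁺ʳ (pathEdges 2 (suc (m + 2))) p)))

    consecutive : ∀ {x y} → x < 3 + e → y < 3 + e → suc (lv x) ≡ lv y → (x , y) ∈ es ⊎ (y , x) ∈ es
    consecutive x< y< eq with position x< | position y<
    ... | p           | first with () ← eq
    ... | last        | mid j≤ = contradiction (trans (cong suc (sym lv-last)) (trans eq (lv-mid j≤)))
                                               (λ { refl → <-irrefl refl j≤ })
    ... | last        | last  = contradiction eq 1+n≢n
    ... | first       | mid j≤ with refl ← trans eq (lv-mid j≤) = inj₁ (here refl)
    ... | first       | last  with () ← trans eq lv-last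
    ... | mid i≤      | last  with refl ← suc-injective (trans (cong suc (sym (lv-mid i≤))) (trans eq lv-last)) =
      inj₁ (cycle∈ (here (cong (e ,_) (+-comm 2 e))))
    ... | mid {i} i≤  | mid j≤ with refl ← trans (cong suc (sym (lv-mid i≤))) (trans eq (lv-mid j≤)) with i
    ...   | zero  = inj₁ (there (there (here refl)))
    ...   | suc k with k <? m + 2
    ...     | yes lt = inj₁ (there (there (there (∈-++⁺ˡ (∈-pathEdges⁺ 2 (suc (m + 2)) (s≤s lt))))))
    ...     | no ¬lt with refl ← ≤-antisym (≤-trans (≮⇒≥ ¬lt) ≤-refl) (≤-trans (s≤s⁻¹ (s≤s⁻¹ j≤))
      (≤-reflexive (+-comm 2 m))) =
      inj₁ (cycle∈ (there (here (cong₂ _,_ e≡ (cong suc e≡)))))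
      where
      e≡ : 2 + (m + 2) ≡ e + 0
      e≡ = trans (cong (2 +_) (+-comm m 2)) (sym (+-identityʳ e))

    clique : ∀ {x y} → x < y → y < 3 + e → lv x ≡ lv y → E (lv x) → (x , y) ∈ es
    clique x<y y< eq E-x with position (<-trans x<y y<) | position y<
    ... | first  | mid j≤ with refl ← trans eq (lv-mid j≤) = there (here refl)
    ... | first  | last with () ← trans eq lv-last
    ... | mid i≤ | mid j≤ with refl ← trans (sym (lv-mid i≤)) (trans eq (lv-mid j≤)) = contradiction x<y
      (<-irrefl refl)
    ... | mid i≤ | last with refl ← trans (sym (lv-mid i≤)) (trans eq lv-last) =
      cycle∈ (there (there (here (cong₂ _,_ (+-comm 1 e) (cong suc (+-comm 1 e))))))
    ... | last   | mid j≤ = contradiction (≤-trans x<y (s≤s j≤)) (<⇒≱ (n≤1+n (2 + e)))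
    ... | last   | last = contradiction x<y (<-irrefl refl)

    C-levelled : Levelled (C 3 3 (7 + m)) (0 ∷ e ∷ upTo (suc e)) E
    C-levelled = levelled-resp-↭ perm (levelled-fromEdges (3 + e) es lv E sound consecutive clique)
      where
      perm : applyUpTo lv (3 + e) ↭ 0 ∷ e ∷ upTo (suc e)
      perm = prep 0 (↭-trans (↭-reflexive (begin
          applyUpTo (lv ∘ suc) (suc (suc e))                       ≡⟨ applyUpTo-∷ʳ (lv ∘ suc) (suc e) ⟨
          applyUpTo (lv ∘ suc) (suc e) ∷ʳ lv (2 + e)               ≡⟨ cong₂ _∷ʳ_ (applyUpTo-cong (suc e)
            (λ { (s≤s le) → lv-mid le })) lv-last ⟩
          upTo (suc e) ∷ʳ e                                        ∎))
        (↭-sym (∷↭∷ʳ e (upTo (suc e)))))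
        where open ≡-Reasoning

  -- Wiener indices of the level structures

  sum-descent : ∀ (f : ℕ → ℕ) m c → (∀ {i} → i < m → f i + i ≡ m + c) → sumOf f (downFrom m) ≡ tri (suc m) + m * c
  sum-descent f zero    c eq = refl
  sum-descent f (suc m) c eq = begin
    -- Below `m` the hypothesis holds for `m` with the offset `suc c`, which is why the offset
    -- varies in the induction.
    f m + sumOf f (downFrom m)          ≡⟨ cong₂ _+_ fm (sum-descent f m (suc c)
      (λ lt → trans (eq (≤-trans lt (n≤1+n m))) (sym (+-suc m c)))) ⟩
    suc c + (tri (suc m) + m * suc c)   ≡⟨ lemma c (tri m) m ⟩
    tri (suc (suc m)) + suc m * c       ∎
    where
    open ≡-Reasoning
    fm : f m ≡ suc c
    fm = +-cancelʳ-≡ m (f m) (suc c) (trans (eq ≤-refl) (cong suc (+-comm m c)))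
    lemma : ∀ c t m → suc c + (m + t + m * suc c) ≡ suc m + (m + t) + suc m * c
    lemma = solve-∀

  private
    gap : ∀ {i m} → i < m → ∣ m - i ∣ + i ≡ m + 0
    gap {i} {m} lt = trans (cong (_+ i) (∣m-i∣)) (trans (m∸n+n≡m (<⇒≤ lt)) (sym (+-identityʳ m)))
      where
      ∣m-i∣ : ∣ m - i ∣ ≡ m ∸ i
      ∣m-i∣ = trans (∣-∣-comm m i) (m≤n⇒∣m-n∣≡n∸m (<⇒≤ lt))

  sum-gaps : ∀ {f : ℕ → ℕ} m → (∀ {i} → i < m → f i ≡ ∣ m - i ∣) → sumOf f (downFrom m) ≡ tri (suc m)
  sum-gaps {f} m eq = trans (sum-descent f m 0 (λ {i} lt → trans (cong (_+ i) (eq lt)) (gap lt)))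
                            (trans (cong (tri (suc m) +_) (*-zeroʳ m)) (+-identityʳ _))

  pairs-downFrom : ∀ {f : ℕ → ℕ → ℕ} → (∀ {i j} → i ≢ j → f i j ≡ ∣ i - j ∣) → ∀ m → pairs f (downFrom m) ≡ tet m
  pairs-downFrom eq zero    = refl
  pairs-downFrom eq (suc m) = cong₂ _+_ (sum-gaps m (λ lt → eq (<⇒≢ lt ∘ sym))) (pairs-downFrom eq m)

  -- The value at 0 stays free because `τ` at (0, 0) is the distance between two vertices of level
  -- 0.
  sum-identity : ∀ m {f : ℕ → ℕ} → (∀ i → f (suc i) ≡ suc i) → sumOf f (downFrom (suc m)) ≡ f 0 + tri (suc m)
  sum-identity zero    eq = refl
  sum-identity (suc m) {f} eq = trans (cong₂ _+_ (eq m) (sum-identity m eq)) (lemma (suc m) (f 0) (tri (suc m)))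
    where
    lemma : ∀ a b c → a + (b + c) ≡ b + (a + c)
    lemma = solve-∀

  module _ {E : ℕ → Set} (E? : Decidable E) where

    pairs-τ-replicate : ∀ a x → pairs (τ E?) (replicate a x) ≡ within E? x * tri a
    pairs-τ-replicate zero    x = sym (*-zeroʳ (within E? x))
    pairs-τ-replicate (suc a) x =
      trans (cong₂ _+_ (trans (sumOf-replicate (τ E? x) a x) (cong (a *_) (τ-≡ E? x))) (pairs-τ-replicate a x))
            (lemma a (within E? x) (tri a))
      where
      lemma : ∀ a w t → a * w + w * t ≡ w * (a + t)
      lemma = solve-∀

    sum-τ-zero : ∀ m → sumOf (τ E? 0) (downFrom (suc m)) ≡ within E? 0 + tri (suc m)
    sum-τ-zero m = trans (sum-identity m (λ i → τ-≢ E? {0} {suc i} λ ())) (cong (_+ tri (suc m)) (τ-≡ E? 0))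

    sum-τ-top : ∀ m → sumOf (τ E? m) (downFrom (suc m)) ≡ within E? m + tri (suc m)
    sum-τ-top m = cong₂ _+_ (τ-≡ E? m) (sum-gaps m (λ lt → τ-≢ E? (<⇒≢ lt ∘ sym)))

    pairs-τ-downFrom : ∀ m → pairs (τ E?) (downFrom m) ≡ tet m
    pairs-τ-downFrom = pairs-downFrom (τ-≢ E?)

    within-yes : ∀ {i} → E i → within E? i ≡ 1
    within-yes {i} p with E? i
    ... | yes _ = refl
    ... | no ¬p = contradiction p ¬p

  gapFree-downFrom : ∀ m → GapFree (downFrom m)
  gapFree-downFrom m t∈ = ∈-downFrom⁺ (<-trans (n<1+n _) (∈-downFrom⁻ t∈))

  -- The Wiener index of U_{n,3}^l for N = n − 1.
  WU : ℕ → ℕ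
  WU N = 1 + tri N + tet N

  WU-pairs : ∀ m → pairs (τ (_≟ 0)) (0 ∷ downFrom (suc m)) ≡ WU (suc m)
  WU-pairs m = cong₂ _+_ (sum-τ-zero (_≟ 0) m) (pairs-τ-downFrom (_≟ 0) (suc m))

  gapFree-∷-downFrom : ∀ {e} m → e < m → GapFree (e ∷ downFrom m)
  gapFree-∷-downFrom m e<m (here refl) = there (∈-downFrom⁺ (<-trans (n<1+n _) e<m))
  gapFree-∷-downFrom m e<m (there t∈)  = there (gapFree-downFrom m t∈)

  W-Uˡ : ∀ {n} {G : Graph n} m → Levelled G (0 ∷ downFrom (2 + m)) (_≡ 0) → W G ≡ WU (2 + m)
  W-Uˡ m L = trans (levelled-W (_≟ 0) L (gapFree-∷-downFrom (2 + m) z<s) (there (∈-downFrom⁺ (s≤s (s≤s z≤n)))))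
    (WU-pairs (suc m))

  -- The Wiener index of C_{3,3}^n for e = n − 3.
  WC : ℕ → ℕ
  WC e = e + (1 + tri (suc e)) + WU (suc e)

  ends? : ∀ e → Decidable (λ i → i ≡ 0 ⊎ i ≡ e)
  ends? e i with i ≟ 0 | i ≟ e
  ... | yes p | _     = yes (inj₁ p)
  ... | no _  | yes q = yes (inj₂ q)
  ... | no ¬p | no ¬q = no [ ¬p , ¬q ]′

  W-C : ∀ {n} {G : Graph n} e → 0 < e → Levelled G (0 ∷ e ∷ downFrom (suc e)) (λ i → i ≡ 0 ⊎ i ≡ e) → W G ≡ WC e
  W-C e 0<e L = trans (levelled-W (ends? e) L gf (there (there (∈-downFrom⁺ (s≤s 0<e))))) (begin
      (τ E? 0 e + sumOf (τ E? 0) (downFrom (suc e))) + (sumOf (τ E? e) (downFrom (suc e)) + pairs (τ E?)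
        (downFrom (suc e)))
        ≡⟨ cong₂ _+_ (cong₂ _+_ (τ-≢ E? (<⇒≢ 0<e)) (trans (sum-τ-zero E? e) (cong (_+ tri (suc e)) (within-yes E?
          (inj₁ refl)))))
                     (cong₂ _+_ (trans (sum-τ-top E? e) (cong (_+ tri (suc e)) (within-yes E? (inj₂ refl))))
                       (pairs-τ-downFrom E? (suc e))) ⟩
      WC e ∎)
    where
    open ≡-Reasoning
    E? = ends? e
    gf : GapFree (0 ∷ e ∷ downFrom (suc e))
    gf (there t∈) = there (gapFree-∷-downFrom (suc e) ≤-refl t∈)

  -- The Wiener index of T(a,b,d).
  WT : ℕ → ℕ → ℕ → ℕ
  WT a b d = tet d + (a + b) * tri (suc d) + 2 * (tri a + tri b) + a * b * suc d

  levelsOf : ℕ → ℕ → ℕ → List ℕ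
  levelsOf a b d = replicate a 0 ++ replicate b (suc d) ++ map suc (downFrom d)

  replicate-∈ : ∀ {A : Set} {x y : A} a → x ∈ replicate a y → x ≡ y
  replicate-∈ (suc a) (here refl) = refl
  replicate-∈ (suc a) (there x∈)  = replicate-∈ a x∈

  W-T : ∀ {n} {G : Graph n} a b d → 0 < a → 0 < d → Levelled G (levelsOf a b d) (λ _ → ⊥) → W G ≡ WT a b d
  W-T (suc a′) b (suc d′) _ _ L = trans (levelled-W E? L gf 1∈) (begin
      pairs t (replicate a 0 ++ R ++ M)
        ≡⟨ pairs-++ t (replicate a 0) (R ++ M) ⟩
      pairs t (replicate a 0) + sumOf (λ x → sumOf (t x) (R ++ M)) (replicate a 0) + pairs t (R ++ M)
        ≡⟨ cong₂ _+_ (cong₂ _+_ (pairs-τ-replicate E? a 0)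
                                (trans (sumOf-replicate (λ x → sumOf (t x) (R ++ M)) a 0)
                                  (cong (a *_) (trans (sumOf-++ (t 0) R M) (cong₂ _+_ (trans (sumOf-replicate (t 0) b
                                    (suc d)) (cong (b *_) (τ-≢ E? {0} {suc d} λ ()))) zeroM)))))
                     (trans (pairs-++ t R M) (cong₂ _+_ (cong₂ _+_ (pairs-τ-replicate E? b (suc d))
                    (trans (sumOf-replicate (λ x → sumOf (t x) M) b (suc d)) (cong (b *_) topM)))
                    pairsM)) ⟩
      -- Left pendant vertices among themselves, then with the right ones and the path; right
      -- pendant vertices among themselves and with the path; finally the path itself.
      2 * tri a + a * (b * suc d + tri (suc d)) + (2 * tri b + b * tri (suc d) + tet d)
        ≡⟨ lemma a b d (tri a) (tri b) (tri (suc d)) (tet d) ⟩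
      WT a b d ∎)
    where
    open ≡-Reasoning
    a = suc a′
    d = suc d′
    E? : Decidable (λ (_ : ℕ) → ⊥)
    E? _ = no id
    t = τ E?
    R = replicate b (suc d)
    M = map suc (downFrom d)
    lemma : ∀ a b d A B T U → 2 * A + a * (b * suc d + T) + (2 * B + b * T + U)
                            ≡ U + (a + b) * T + 2 * (A + B) + a * b * suc d
    lemma = solve-∀
    zeroM : sumOf (t 0) M ≡ tri (suc d)
    zeroM = trans (sumOf-map (t 0) suc (downFrom d))
      (go d)
      where
      go : ∀ m → sumOf (t 0 ∘ suc) (downFrom m) ≡ tri (suc m)
      go zero    = refl
      go (suc m) = cong₂ _+_ (τ-≢ E? {0} {suc m} λ ()) (go m)
    topM : sumOf (t (suc d)) M ≡ tri (suc d)
    topM = trans (sumOf-map (t (suc d)) suc (downFrom d))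
      (sum-gaps d (λ lt → τ-≢ E? (<⇒≢ lt ∘ sym ∘ suc-injective)))
    pairsM : pairs t M ≡ tet d
    pairsM = trans (pairs-map t suc (downFrom d)) (pairs-downFrom (λ i≢j → τ-≢ E? (i≢j ∘ suc-injective)) d)
    M⊆ : ∀ {x} → x ∈ M → x ∈ levelsOf a b d
    M⊆ = ∈-++⁺ʳ (replicate a 0) ∘ ∈-++⁺ʳ R
    1∈ : 1 ∈ levelsOf a b d
    1∈ = M⊆ (∈-map⁺ suc (∈-downFrom⁺ z<s))
    gf : GapFree (levelsOf a b d)
    gf {s} s∈ with ∈-++⁻ (replicate a 0) s∈
    ... | inj₁ p with () ← replicate-∈ a p
    ... | inj₂ p with ∈-++⁻ R p
    ...   | inj₁ q with refl ← replicate-∈ b q = M⊆ (∈-map⁺ suc (∈-downFrom⁺ ≤-refl))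
    ...   | inj₂ q with ∈-map⁻ suc q
    gf {zero}  s∈ | inj₂ p | inj₂ q | _ , i∈ , refl = here refl
    gf {suc s} s∈ | inj₂ p | inj₂ q | _ , i∈ , refl = M⊆ (∈-map⁺ suc (gapFree-downFrom d i∈))

  -- Closed forms and the embedding into the rationals

  tri-closed : ∀ m → 2 * tri m + m ≡ m * m
  tri-closed zero    = refl
  tri-closed (suc m) = trans (lemma₁ m (tri m)) (trans (cong (λ z → z + m + m + 1) (tri-closed m)) (lemma₂ m))
    where
    lemma₁ : ∀ m t → 2 * (m + t) + suc m ≡ 2 * t + m + m + m + 1
    lemma₁ = solve-∀
    lemma₂ : ∀ m → m * m + m + m + 1 ≡ suc m * suc m
    lemma₂ = solve-∀

  tet-closed : ∀ m → 6 * tet m + m ≡ m * m * m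
  tet-closed zero    = refl
  tet-closed (suc m) = trans (lemma₁ m (tri m) (tet m)) (trans (cong₂ (λ z w → z + 3 * w + 3 * m + 1) (tet-closed m)
    (tri-closed m)) (lemma₂ m))
    where
    lemma₁ : ∀ m t u → 6 * (m + t + u) + suc m ≡ (6 * u + m) + 3 * (2 * t + m) + 3 * m + 1
    lemma₁ = solve-∀
    lemma₂ : ∀ m → m * m * m + 3 * (m * m) + 3 * m + 1 ≡ suc m * suc m * suc m
    lemma₂ = solve-∀

  tri≡C : ∀ m → m choose 2 ≡ tri m
  tri≡C zero    = refl
  tri≡C (suc m) = trans (sym (nCk+nC[k+1]≡[n+1]C[k+1] m 1)) (cong₂ _+_ (nC1≡n m) (tri≡C m))

  tet≡C : ∀ m → suc m choose 3 ≡ tet m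
  tet≡C zero    = refl
  tet≡C (suc m) = trans (sym (nCk+nC[k+1]≡[n+1]C[k+1] (suc m) 2)) (cong₂ _+_ (tri≡C (suc m)) (tet≡C m))

  tri-+ : ∀ a b → tri (a + b) ≡ tri a + tri b + a * b
  tri-+ zero    b = sym (+-identityʳ _)
  tri-+ (suc a) b = trans (cong (a + b +_) (tri-+ a b)) (lemma a b (tri a) (tri b))
    where
    lemma : ∀ a b s t → a + b + (s + t + a * b) ≡ a + s + t + suc a * b
    lemma = solve-∀

  -- Since `ι` normalises its fractions, the two sides are compared as unnormalised fractions of
  -- denominator 1.
  ι-+ : ∀ m n → ι (m + n) ≡ ι m ℚ.+ ι n
  ι-+ m n = ℚ.toℚᵘ-injective (begin
    ℚ.toℚᵘ (ι (m + n))                   ≈⟨ ℚ.toℚᵘ-fromℚᵘ (mkℚᵘ (ℤ.+ (m + n)) 0) ⟩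
    mkℚᵘ (ℤ.+ (m + n)) 0                    ≈⟨ *≡* (cong (ℤ._* ℤ.+ 1) (sym (cong₂ ℤ._+_ (ℤ.*-identityʳ (ℤ.+ m))
      (ℤ.*-identityʳ (ℤ.+ n))))) ⟩
    mkℚᵘ (ℤ.+ m) 0 ℚᵘ.+ mkℚᵘ (ℤ.+ n) 0        ≈⟨ ℚᵘ.+-cong (ℚ.toℚᵘ-fromℚᵘ (mkℚᵘ (ℤ.+ m) 0)) (ℚ.toℚᵘ-fromℚᵘ
      (mkℚᵘ (ℤ.+ n) 0)) ⟨
    ℚ.toℚᵘ (ι m) ℚᵘ.+ ℚ.toℚᵘ (ι n)        ≈⟨ ℚ.toℚᵘ-homo-+ (ι m) (ι n) ⟨
    ℚ.toℚᵘ (ι m ℚ.+ ι n)                  ∎)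
    where open ℚᵘ.≃-Reasoning

  ι-* : ∀ m n → ι (m * n) ≡ ι m ℚ.* ι n
  ι-* m n = ℚ.toℚᵘ-injective (begin
    ℚ.toℚᵘ (ι (m * n))                   ≈⟨ ℚ.toℚᵘ-fromℚᵘ (mkℚᵘ (ℤ.+ (m * n)) 0) ⟩
    mkℚᵘ (ℤ.+ (m * n)) 0                    ≈⟨ *≡* (cong (ℤ._* ℤ.+ 1) (ℤ.pos-* m n)) ⟩
    mkℚᵘ (ℤ.+ m) 0 ℚᵘ.* mkℚᵘ (ℤ.+ n) 0        ≈⟨ ℚᵘ.*-cong (ℚ.toℚᵘ-fromℚᵘ (mkℚᵘ (ℤ.+ m) 0)) (ℚ.toℚᵘ-fromℚᵘ
      (mkℚᵘ (ℤ.+ n) 0)) ⟨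
    ℚ.toℚᵘ (ι m) ℚᵘ.* ℚ.toℚᵘ (ι n)        ≈⟨ ℚ.toℚᵘ-homo-* (ι m) (ι n) ⟨
    ℚ.toℚᵘ (ι m ℚ.* ι n)                  ∎)
    where open ℚᵘ.≃-Reasoning

  two-others : ∀ {n} {a b : Fin n} → a ≢ b → ∃ λ rest → allFin n ↭ a ∷ b ∷ rest × 2 + length rest ≡ n
  two-others {n} {a} {b} a≢b with unique-⊆ {xs = a ∷ b ∷ []} ((a≢b ∷ []) ∷ [] ∷ []) (λ {z} _ → ∈-allFin z)
  ... | rest , p = rest , p , trans (sym (↭-length p)) (length-tabulate id)

  third : ∀ {n} {a b : Fin n} → a ≢ b → 3 ≤ n → ∃ λ c → c ≢ a × c ≢ b
  third {n} a≢b 3≤n with two-others a≢b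
  ... | [] , p , len = contradiction 3≤n (<⇒≱ (s≤s (≤-reflexive (sym len))))
  ... | c ∷ _ , p , len with unique-resp-↭ p (allFin⁺ n)
  ...   | (_ ∷ a≢c ∷ _) ∷ (b≢c ∷ _) ∷ _ = c , ≢-sym a≢c , ≢-sym b≢c

  descend-upTo : ∀ k M → applyDownFrom (λ i → k + M ∸ i) (suc M) ≡ applyUpTo (k +_) (suc M)
  descend-upTo k zero    = refl
  descend-upTo k (suc M) = cong₂ _∷_ (trans (m+n∸n≡m k (suc M)) (sym (+-identityʳ k)))
    (trans (cong (λ z → applyDownFrom (λ i → z ∸ i) (suc M)) (+-suc k M))
      (trans (descend-upTo (suc k) M) (applyUpTo-cong (suc M) (λ {i} _ → sym (+-suc k i)))))

  downFrom↭upTo : ∀ m → downFrom m ↭ upTo m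
  downFrom↭upTo m = ↭-sym (applyUpTo-↭ id m)

  flip-downFrom : ∀ M → map (M ∸_) (downFrom (suc M)) ↭ downFrom (suc M)
  flip-downFrom M = ↭-trans (↭-reflexive (trans (map-downFrom (M ∸_) (suc M)) (descend-upTo 0 M)))
    (↭-sym (downFrom↭upTo (suc M)))

  other-than : ∀ {n} (p : Fin n) → 2 ≤ n → ∃ λ v → v ≢ p
  other-than zero    (s≤s (s≤s _)) = suc zero , λ ()
  other-than (suc _) _             = zero , λ ()

  -- Exactly one pendant vertex

  module _ {n} (G : Graph n) (connected : Connected G) where

    open Metric G connected
    open Growth G connected

    -- p is the pendant vertex and x is farthest from it; deleting x and then p leaves ws connected.
    record PendantEnds : Set where
      field
        {p x}    : Fin n
        {ws}     : List (Fin n)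
        perm     : x ∷ p ∷ ws ↭ allFin n
        grown-ws : Grown ws
        grown-vs : Grown (p ∷ ws)
        x-max    : ∀ v → d p v ≤ d p x
        two-nbrs : ∀ {v} → v ≢ p → ∃₂ λ a b → a ≢ b × Adj G v a × Adj G v b

    -- The remaining vertices are ranked by the distance from `p`, with the neighbour `q` of `p` as
    -- root: a parent is nearer to `p` than its child, hence is not `x`, and only `q` has `p` as a
    -- parent.
    onePendant-ends : 3 ≤ n → ∣ pendants G ∣ ≡ 1 → PendantEnds
    onePendant-ends 3≤n one with pendantList G in list≡ | trans (sym (pendants-length G)) one
    ... | p ∷ [] | _ with other-than p (≤-trans (n≤1+n 2) 3≤n) | farthest p
    ...   | o , o≢p | x , x-max with two-others {a = x} {p} x≢p | hasNeighbour (≢-sym o≢p)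
      where
      x≢p : x ≢ p
      x≢p refl = <-irrefl (sym (d-self p)) (≤-trans (d-distinct (≢-sym o≢p)) (x-max o))
    ...     | ws₀ , split , _ | q , pq with ∈ws₀⁺ q≢x q≢p | grown-ranked (d p) unique-ws₀ (∈ws₀⁺ q≢x q≢p) parent
      where
      pendant-p : Pendant G p
      pendant-p = proj₂ (∈-filter⁻ (pendant? G) {xs = allFin n} (subst (p ∈_) (sym list≡) (here refl)))
      unique-all : Unique (x ∷ p ∷ ws₀)
      unique-all = unique-resp-↭ split (allFin⁺ n)
      unique-ws₀ : Unique ws₀
      unique-ws₀ with unique-all
      ... | _ ∷ _ ∷ u = u
      q≢p : q ≢ p
      q≢p eq = irrefl G (sym eq) pq
      -- If `q` were farthest, every vertex other than `p` would be adjacent to `p`.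
      q≢x : q ≢ x
      q≢x refl with third (≢-sym q≢p) 3≤n
      ... | c , c≢p , c≢q = c≢q (pendant-unique G pendant-p (d-one (≤-antisym
        (≤-trans (x-max c) (≤-reflexive (d-adj pq))) (d-distinct (≢-sym c≢p)))) pq)
      ∈ws₀⁺ : ∀ {v} → v ≢ x → v ≢ p → v ∈ ws₀
      ∈ws₀⁺ {v} v≢x v≢p with ∈-resp-↭ split (∈-allFin v)
      ... | here eq          = contradiction eq v≢x
      ... | there (here eq)  = contradiction eq v≢p
      ... | there (there v∈) = v∈
      parent : ∀ {v} → v ∈ ws₀ → v ≢ q → ∃ λ w → w ∈ ws₀ × Adj G v w × d p w < d p v
      parent {v} v∈ v≢q with d p v in eq
      ... | zero with refl ← d-zero eq with unique-all
      ...   | _ ∷ u = contradiction v∈ (Unique[x∷xs]⇒x∉xs u)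
      parent {v} v∈ v≢q | suc t with d-parent eq
      ... | w , vw , dw = w , ∈ws₀⁺ (λ { refl → 1+n≰n (≤-trans (≤-reflexive (sym eq)) (≤-trans (x-max v)
        (≤-reflexive dw))) })
                                (λ { refl → v≢q (pendant-unique G pendant-p (symm G vw) pq) })
                            , vw , s≤s (≤-reflexive dw)
    ...       | q∈ | ws , grown-ws , ws↭ = record
      { perm     = ↭-trans (prep x (prep p ws↭)) (↭-sym split)
      ; grown-ws = grown-ws
      ; grown-vs = grow (p∉ (unique-resp-↭ split (allFin⁺ n))) (∈-resp-↭ (↭-sym ws↭) q∈) pq grown-ws
      ; x-max    = x-max
      ; two-nbrs = λ v≢p → twoNeighbours G (v≢p ∘ pendant⇒p) (proj₂ (hasNeighbour v≢p))
      }
      where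
      p∉ : Unique (x ∷ p ∷ ws₀) → p ∉ ws
      p∉ (_ ∷ u) = Unique[x∷xs]⇒x∉xs u ∘ ∈-resp-↭ ws↭
      pendant⇒p : ∀ {v} → Pendant G v → v ≡ p
      pendant⇒p {v} pv with subst (v ∈_) list≡ (∈-filter⁺ (pendant? G) (∈-allFin v) pv)
      ... | here eq = eq

  module OnePendant {n} (G : Graph n) (connected : Connected G) (ends : PendantEnds G connected) where

    open Metric G connected
    open Growth G connected
    open PendantEnds ends

    private
      φ : Fin n → ℕ
      φ = d p

      φ≤ : ∀ v → φ v ≤ φ x
      φ≤ = x-max

      vs : List (Fin n)
      vs = p ∷ ws

      M = length ws

      ∈vs : ∀ {v} → v ≢ x → v ∈ vs
      ∈vs {v} v≢x with ∈-resp-↭ (↭-sym perm) (∈-allFin v)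
      ... | here eq  = contradiction eq v≢x
      ... | there v∈ = v∈

      x∉vs : x ∉ vs
      x∉vs = Unique[x∷xs]⇒x∉xs (unique-resp-↭ (↭-sym perm) (allFin⁺ n))

      x≢p : x ≢ p
      x≢p refl = x∉vs (here refl)

      adj-≢ : ∀ {u v} → Adj G u v → v ≢ u
      adj-≢ uv refl = irrefl G refl uv

      grown-all-vs : Grown (x ∷ vs)
      grown-all-vs with two-nbrs x≢p
      ... | a , _ , _ , xa , _ = grow x∉vs (∈vs (adj-≢ xa)) xa grown-vs

      D-x : sumOf (d x) vs ≤ 1 + tri (suc M)
      D-x with two-nbrs x≢p
      ... | a , b , a≢b , xa , xb = transmission-two grown-all-vs xa xb (∈vs (adj-≢ xa)) (∈vs (adj-≢ xb)) a≢b

      W≡ : W G ≡ sumOf (d x) vs + (sumOf φ ws + pairs d ws)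
      W≡ = grown-all grown-all-vs perm

      D-p : sumOf φ ws ≤ tri (suc M)
      D-p = transmission grown-vs

      pairs-ws : pairs d ws ≤ tet M
      pairs-ws = grown-pairs grown-ws

    bound : W G ≤ WU (suc (length ws))
    bound = ≤-trans (≤-reflexive W≡) (+-mono-≤ D-x (+-mono-≤ D-p pairs-ws))

    -- Of the equalities only the one for `p` is used: its distances within `vs` are 0, ..., M, once
    -- each. The place of `x` then follows from its being farthest and having two neighbours.
    module Tight (0<M : 0 < M) (values : map φ vs ↭ downFrom (suc M)) where

      φ≤M : ∀ {v} → v ∈ vs → φ v ≤ M
      φ≤M v∈ = s≤s⁻¹ (tight-< φ values v∈)

      φx : φ x ≡ M
      φx with tight-onto φ vs values ≤-refl
      ... | c , c∈ , φc with m≤n⇒m<n∨m≡n (≤-trans (≤-reflexive (sym φc)) (φ≤ c))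
      ...   | inj₂ eq = sym eq
      -- Beyond `M`, the vertex `x` alone would form a new top level and could have only one
      -- neighbour.
      ...   | inj₁ M<φx = contradiction (two-nbrs x≢p) λ (a , b , a≢b , xa , xb) →
              a≢b (top-neighbour p {c = x} all-values (here refl) refl (there (∈vs (adj-≢ xa)))
                (there (∈vs (adj-≢ xb))) xa xb)
        where
        φx≤ : ∀ {t} → φ x ≡ t → t ≤ suc M
        φx≤ {zero}  eq = z≤n
        φx≤ {suc t} eq with d-parent eq
        ... | w , xw , φw = s≤s (≤-trans (≤-reflexive (sym φw)) (φ≤M (∈vs (adj-≢ xw))))
        all-values : map φ (x ∷ vs) ↭ downFrom (suc (φ x))
        all-values = prep (φ x) (subst (λ z → map φ vs ↭ downFrom z) (≤-antisym M<φx (φx≤ refl)) values)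

      top : ∀ {u v} → φ u ≡ φ v → u ≢ v → φ u ≡ M
      top {u} {v} eq u≢v with u Fin.≟ x | v Fin.≟ x
      ... | yes refl | _        = φx
      ... | _        | yes refl = trans eq φx
      ... | no u≢x   | no v≢x   = contradiction (tight-injective φ values (∈vs u≢x) (∈vs v≢x) eq) u≢v

      -- The end of the path in `vs` needs two neighbours, and within `vs` it has at most one; the
      -- other must be `x`, which closes the triangle.
      x-joined : ∀ {v} → v ≢ x → φ v ≡ M → Adj G v x
      x-joined {v} v≢x φv = joined (two-nbrs v≢p)
        where
        v≢p : v ≢ p
        v≢p refl = <-irrefl (trans (sym (d-self p)) φv) 0<M
        joined : (∃₂ λ a b → a ≢ b × Adj G v a × Adj G v b) → Adj G v x
        joined (a , b , a≢b , va , vb) with a Fin.≟ x | b Fin.≟ x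
        ... | yes refl | _        = va
        ... | _        | yes refl = vb
        ... | no a≢x   | no b≢x   =
          contradiction (top-neighbour p values (∈vs v≢x) φv (∈vs a≢x) (∈vs b≢x) va vb) a≢b

      forth : ∀ u v → Adj G u v → Joined (_≡ M) φ u v
      forth u v uv with d-close p uv
      ... | inj₁ eq        = inj₁ eq
      ... | inj₂ (inj₁ eq) = inj₂ (inj₁ eq)
      ... | inj₂ (inj₂ eq) = inj₂ (inj₂ (u≢v , eq , top eq u≢v))
        where
        u≢v : u ≢ v
        u≢v = ≢-sym (adj-≢ uv)

      ascend : ∀ {u v} → suc (φ u) ≡ φ v → Adj G v u
      ascend {u} {v} eq with d-parent (sym eq)
      ... | w , vw , φw = subst (Adj G v) (tight-injective φ values (∈vs (low φw)) (∈vs (low refl)) φw) vw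
        where
        low : ∀ {w} → φ w ≡ φ u → w ≢ x
        low φw refl = 1+n≰n (≤-trans (≤-reflexive (trans (cong suc φw) eq)) (φ≤ v))

      back : ∀ u v → Joined (_≡ M) φ u v → Adj G u v
      back u v (inj₁ eq)        = symm G (ascend eq)
      back u v (inj₂ (inj₁ eq)) = ascend eq
      back u v (inj₂ (inj₂ (u≢v , eq , φu))) with u Fin.≟ x | v Fin.≟ x
      ... | no u≢x   | yes refl = x-joined u≢x φu
      ... | yes refl | no v≢x   = symm G (x-joined v≢x (trans (sym eq) φu))
      ... | yes refl | yes refl = contradiction refl u≢v
      ... | no u≢x   | no v≢x   = contradiction (tight-injective φ values (∈vs u≢x) (∈vs v≢x) eq) u≢v

      ascending : Levelled G (M ∷ downFrom (suc M)) (_≡ M)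
      ascending = record
        { level  = φ
        ; levels = ↭-trans (map⁺ φ (↭-sym perm)) (↭-trans (↭-reflexive (cong (_∷ map φ vs) φx)) (prep M values))
        ; adj⇔   = λ u v → mk⇔ (forth u v) (back u v)
        }

      levelled : Levelled G (0 ∷ downFrom (suc M)) (_≡ 0)
      levelled =
        levelled-resp-↭ (↭-trans (↭-reflexive (cong (_∷ map (M ∸_) (downFrom (suc M))) (n∸n≡0 M)))
          (prep 0 (flip-downFrom M)))
          (flip-levels M ascending (λ u → ≤-trans (φ≤ u) (≤-reflexive φx))
            (λ {i} i≤M → mk⇔ (λ { refl → n∸n≡0 M }) (λ eq → ≤-antisym i≤M (m∸n≡0⇒m≤n eq))))

    tight⇒levelled : 0 < length ws → W G ≡ WU (suc (length ws)) → Levelled G (0 ∷ downFrom (suc (length ws))) (_≡ 0)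
    tight⇒levelled 0<M tight = Tight.levelled 0<M (transmission-tight (grown-gapFree grown-vs (here refl)) eq)
      where
      eq : sumOf φ ws ≡ tri (suc M)
      eq = proj₁ (≤-split {a = sumOf φ ws} {pairs d ws} D-p pairs-ws
        (proj₂ (≤-split {a = sumOf (d x) vs} {sumOf φ ws + pairs d ws} D-x (+-mono-≤ D-p pairs-ws)
          (trans (sym W≡) tight))))

  ++-cancelˡ-↭ : ∀ {A : Set} (xs : List A) {ys zs} → xs ++ ys ↭ xs ++ zs → ys ↭ zs
  ++-cancelˡ-↭ []       p = p
  ++-cancelˡ-↭ (x ∷ xs) p = ++-cancelˡ-↭ xs (drop-∷ p)

  -- No pendant vertices: the bound

  module NoPendants {n} (G : Graph n) (connected : Connected G)
    (two-nbrs : ∀ v → ∃₂ λ a b → a ≢ b × Adj G v a × Adj G v b)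
    (e : ℕ) (4≤e : 4 ≤ e) (n≡ : n ≡ 3 + e) where

    open Metric G connected
    open Growth G connected

    private
      adj-≢ : ∀ {u v} → Adj G u v → u ≢ v
      adj-≢ uv refl = irrefl G refl uv

      tail∈ : ∀ {x vs v} → x ∷ vs ↭ allFin n → x ≢ v → v ∈ vs
      tail∈ {v = v} p x≢v with ∈-resp-↭ (↭-sym p) (∈-allFin v)
      ... | here eq  = contradiction (sym eq) x≢v
      ... | there v∈ = v∈

      tail-length : ∀ {x} {vs : List (Fin n)} → x ∷ vs ↭ allFin n → length vs ≡ 2 + e
      tail-length p = suc-injective (trans (↭-length p) (trans (length-tabulate id) n≡))

      ≢4 : ∀ {k} → k < 4 → ¬ (e ≤ k)
      ≢4 k<4 e≤k = <⇒≱ k<4 (≤-trans 4≤e e≤k)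

    -- If vs has one vertex at each distance from y, then its top vertex has only one neighbour in vs.
    high : ∀ y {rs vs m} → rs ++ vs ↭ allFin n → map (d y) vs ↭ downFrom (2 + m) → ∃ λ r → r ∈ rs × m ≤ d y r
    high y {rs} {vs} {m} p q with tight-onto (d y) vs q ≤-refl
    ... | z , z∈ , dz with two-nbrs z
    ...   | a , b , a≢b , za , zb with ∈-++⁻ rs (∈-resp-↭ (↭-sym p) (∈-allFin a)) | ∈-++⁻ rs (∈-resp-↭ (↭-sym p)
      (∈-allFin b))
    ...     | inj₁ a∈ | _       = a , a∈ , s≤s⁻¹ (≤-trans (≤-reflexive (sym dz)) (d-lipschitz y za))
    ...     | _       | inj₁ b∈ = b , b∈ , s≤s⁻¹ (≤-trans (≤-reflexive (sym dz)) (d-lipschitz y zb))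
    ...     | inj₂ a∈ | inj₂ b∈ = contradiction (top-neighbour y q z∈ dz a∈ b∈ za zb) a≢b

    private
      -- Here `rs` holds neighbours of `x` that were set aside. If the others had one vertex at each
      -- distance, the last of them would need a neighbour in `rs`, and that neighbour would be at
      -- distance at least `m` from `x`.
      loose : ∀ {x rs ts m} → GapFree (map (d x) (x ∷ ts)) → rs ++ x ∷ ts ↭ allFin n → All (λ r → d x r ≡ 1) rs →
              1 < m → length ts ≡ suc m → suc (sumOf (d x) ts) ≤ tri (2 + m)
      loose {x} {rs} {ts} {m} gf p one 1<m len =
        subst₂ (λ i j → suc i ≤ tri j) (sum-self x ts) len′ (gapFree-loose gf not-tight)
        where
        len′ : length (map (d x) (x ∷ ts)) ≡ 2 + m
        len′ = trans (length-map (d x) (x ∷ ts)) (cong suc len)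
        not-tight : ¬ (map (d x) (x ∷ ts) ↭ downFrom (length (map (d x) (x ∷ ts))))
        not-tight q with high x {rs} p (subst (λ l → map (d x) (x ∷ ts) ↭ downFrom l) len′ q)
        ... | r , r∈ , m≤ = <⇒≱ 1<m (≤-trans m≤ (≤-reflexive (All.lookup one r∈)))

      1<e : 1 < e
      1<e = ≤-trans (s≤s (s≤s z≤n)) 4≤e

      omit-perm : ∀ {x a} {vs ts : List (Fin n)} → x ∷ vs ↭ allFin n → vs ↭ a ∷ ts → a ∷ x ∷ ts ↭ allFin n
      omit-perm {x} {a} p q = ↭-trans (swap a x refl) (↭-trans (prep x (↭-sym q)) p)

    -- The neighbour that is set aside adds 1, and by `loose` the others lose at least 1 against a
    -- path, so the two cancel.
    D-bound : ∀ {x vs} → Grown (x ∷ vs) → x ∷ vs ↭ allFin n → sumOf (d x) vs ≤ tri (2 + e)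
    D-bound {x} gr p with two-nbrs x
    ... | a , b , a≢b , xa , xb with omit-neighbour (grown-gapFree gr (here refl)) xa xb (tail∈ p (adj-≢ xa))
      (tail∈ p (adj-≢ xb)) a≢b
    ...   | ts , q , gf , len , sm = ≤-trans (≤-reflexive sm)
      (loose {rs = a ∷ []} gf (omit-perm p q) (d-adj xa ∷ []) 1<e (suc-injective (trans (sym len) (tail-length p))))

    D-tight : ∀ {x vs} → Grown (x ∷ vs) → x ∷ vs ↭ allFin n → sumOf (d x) vs ≡ tri (2 + e) →
              map (d x) (allFin n) ↭ 1 ∷ e ∷ downFrom (suc e)
    D-tight {x} gr p eq with two-nbrs x
    ... | a , b , a≢b , xa , xb with omit-neighbour (grown-gapFree gr (here refl)) xa xb (tail∈ p (adj-≢ xa))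
      (tail∈ p (adj-≢ xb)) a≢b
    ...   | ts , q , gf , len , sm = ↭-trans (map⁺ (d x) (↭-sym (omit-perm p q)))
      (↭-trans (↭-reflexive (cong (_∷ map (d x) (x ∷ ts)) (d-adj xa)))
        (prep 1 (gapFree-almost gf (trans (cong suc (sum-self x ts)) (trans (sym sm)
          (trans eq (cong tri (sym len′))))) len′)))
      where
      len′ : length (map (d x) (x ∷ ts)) ≡ 2 + e
      len′ = trans (length-map (d x) (x ∷ ts)) (trans (sym len) (tail-length p))

    -- Equality would give the vertices of `vs` distinct distances from the head `y`. Then `y` has
    -- only one neighbour in `vs`, so `x` is adjacent to `y`; but the far end also needs `x` as a
    -- second neighbour, which puts `x` at distance at least `e` from `y`.
    pairs-strict : ∀ {x vs} → Grown vs → x ∷ vs ↭ allFin n → suc (pairs d vs) ≤ tet (2 + e)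
    pairs-strict [ r ] p with () ← tail-length p
    pairs-strict {x} {y ∷ ws} gr@(grow _ _ _ gr′) p with sumOf (d y) ws ≟ tri (2 + e)
    ... | no ≢tri = +-mono-≤ (≤∧≢⇒< (≤-trans (transmission gr) (≤-reflexive (cong tri (tail-length p)))) ≢tri)
                             (≤-trans (grown-pairs gr′) (≤-reflexive (cong tet (suc-injective (tail-length p)))))
    ... | yes ≡tri = contradiction e≤1 (≢4 (s≤s (s≤s z≤n)))
      where
      values : map (d y) (y ∷ ws) ↭ downFrom (2 + e)
      values = subst (λ l → map (d y) (y ∷ ws) ↭ downFrom l) (tail-length p)
        (transmission-tight (grown-gapFree gr (here refl)) (trans ≡tri (cong tri (sym (tail-length p)))))
      dyx : d y x ≡ 1
      dyx with two-nbrs y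
      ... | a , b , a≢b , ya , yb with x Fin.≟ a | x Fin.≟ b
      ...   | yes refl | _        = d-adj ya
      ...   | _        | yes refl = d-adj yb
      ...   | no x≢a   | no x≢b   =
        contradiction (tight-injective (d y) values (tail∈ p x≢a) (tail∈ p x≢b) (trans (d-adj ya)
          (sym (d-adj yb)))) a≢b
      e≤1 : e ≤ 1
      e≤1 with high y {x ∷ []} p values
      ... | _ , here refl , le = ≤-trans le (≤-reflexive dyx)

    private
      -- Grouped as the estimates arrive: the first deleted vertex, the second one, and the pairs of
      -- the remaining 1 + e vertices.
      WC-split : WC e ≡ tri (2 + e) + ((1 + tri (1 + e)) + tet (1 + e))
      WC-split = lemma e (tri (suc e)) (tet (suc e))
        where
        lemma : ∀ e t u → e + (1 + t) + (1 + t + u) ≡ suc e + t + (1 + t + u)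
        lemma = solve-∀

      run-one : ∀ m → run 1 m ≡ tri (suc m)
      run-one m = trans (runs m 1) (trans (cong (tri m +_) (*-identityʳ m)) (+-comm (tri m) m))
        where
        runs : ∀ m s → run s m ≡ tri m + m * s
        runs zero    s = refl
        runs (suc m) s = trans (cong (s +_) (runs m (suc s))) (lemma m s (tri m))
          where
          lemma : ∀ m s t → s + (t + m * suc s) ≡ m + t + (s + m * s)
          lemma = solve-∀

      -- Three vertices at distance 1 lower the contribution of `x` to 1 + tri (1 + e). This
      -- balances the generous bound on the other pairs, and `pairs-strict` makes the total strictly
      -- smaller.
      three-nbrs : ∀ {x vs a b c} → Grown (x ∷ vs) → x ∷ vs ↭ allFin n → Adj G x a → Adj G x b → Adj G x c →
                   a ≢ b → c ≢ a → c ≢ b → W G < WC e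
      three-nbrs {x} {vs} {a} {b} {c} gr p xa xb xc a≢b c≢a c≢b
        with omit-neighbour (grown-gapFree gr (here refl)) xa xb (tail∈ p (adj-≢ xa)) (tail∈ p (adj-≢ xb)) a≢b
      ... | ts , q , gf , len , sm with omit-neighbour gf xc xb (∈ts (tail∈ p (adj-≢ xc)) c≢a)
        (∈ts (tail∈ p (adj-≢ xb)) (≢-sym a≢b)) c≢b
        where
        ∈ts : ∀ {v} → v ∈ vs → v ≢ a → v ∈ ts
        ∈ts v∈ v≢a with ∈-resp-↭ q v∈
        ... | here eq  = contradiction eq v≢a
        ... | there v∈ = v∈
      ...   | us , q′ , gf′ , len′ , sm′ with m≤n⇒∃[o]m+o≡n 4≤e
      ...     | o , refl = begin
        suc (W G)                                       ≡⟨ cong suc (grown-all gr p) ⟩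
        suc (sumOf (d x) vs + pairs d vs)               ≡⟨ +-suc (sumOf (d x) vs) (pairs d vs) ⟨
        sumOf (d x) vs + suc (pairs d vs)               ≡⟨ cong (_+ suc (pairs d vs)) (trans sm (cong suc sm′)) ⟩
        2 + sumOf (d x) us + suc (pairs d vs)           ≤⟨ +-mono-≤ (s≤s (loose {rs = a ∷ c ∷ []} gf′ perm
          (d-adj xa ∷ d-adj xc ∷ []) (s≤s (s≤s z≤n)) len″)) (pairs-strict (grown-tail gr (tail∈ p (adj-≢ xa))) p) ⟩
        1 + tri (1 + e) + (tri (2 + e) + tet (1 + e))   ≡⟨ lemma (1 + tri (1 + e)) (tri (2 + e)) (tet (1 + e)) ⟩
        tri (2 + e) + ((1 + tri (1 + e)) + tet (1 + e)) ≡⟨ WC-split ⟨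
        WC e                                            ∎
        where
        open ≤-Reasoning
        lemma : ∀ a b c → a + (b + c) ≡ b + (a + c)
        lemma = solve-∀
        perm : a ∷ c ∷ x ∷ us ↭ allFin n
        perm = ↭-trans (prep a (swap c x refl)) (↭-trans (prep a (prep x (↭-sym q′))) (omit-perm p q))
        len″ : length us ≡ 4 + o
        len″ = suc-injective (suc-injective (trans (cong suc (sym len′)) (trans (sym len) (tail-length p))))

      -- The vertex `x` closes the path to a Hamiltonian cycle, so distances can be bounded from
      -- both ends. A crude use of this for two vertices is already enough.
      hamiltonian : ∀ {x vs a b c} → Grown (x ∷ vs) → x ∷ vs ↭ allFin n → Adj G x a → Adj G x b → a ≢ b →
                    c ↭ vs → Path a b c → W G < WC e
      hamiltonian gr p xa xb a≢b q [ v ] = contradiction refl a≢b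
      hamiltonian {x} {vs} {a} {b} gr p xa xb a≢b q pa@(step {y = y} {c = c} a∉ ay pa′) with m≤n⇒∃[o]m+o≡n 4≤e
      ... | o , refl = begin
        suc (W G)                                               ≡⟨ cong suc (W-pairs G) ⟩
        suc (pairs d (allFin n))                                ≡⟨ cong suc (pairs-↭ d d-sym perm) ⟨
        suc (sumOf (d x) (a ∷ c) + (sumOf (d a) c + pairs d c)) ≤⟨ s≤s (+-mono-≤ Dx (+-mono-≤ Da pairs-c)) ⟩
        suc (tri e + 6 + (tri (1 + e) + 2 + tet (1 + e)))       ≡⟨ lemma₁ (tri e) (tri (1 + e)) (tet (1 + e)) ⟩
        8 + tri e + (1 + tri (1 + e) + tet (1 + e))             ≤⟨ +-monoˡ-≤ (1 + tri (1 + e) + tet (1 + e)) 8≤ ⟩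
        tri (2 + e) + (1 + tri (1 + e) + tet (1 + e))           ≡⟨ WC-split ⟨
        WC e                                                    ∎
        where
        open ≤-Reasoning
        perm : x ∷ a ∷ c ↭ allFin n
        perm = ↭-trans (prep x q) p
        len : length (a ∷ c) ≡ 2 + e
        len = tail-length perm
        -- Both ends of the path are at distance 1 from `x`. The last three vertices, counted from
        -- `b`, give 1 + 2 + 3 = 6, and the other e - 1, counted from `a`, give tri e.
        Dx : sumOf (d x) (a ∷ c) ≤ tri e + 6
        Dx = ≤-trans (path-sum pa (d x) (d-lipschitz x) (≤-reflexive (d-adj xa)) (≤-reflexive (d-adj xb)) (3 + o) 2
                        (trans len (cong (3 +_) (+-comm 3 o))))
                     (≤-reflexive (cong (_+ 6) (run-one (3 + o))))
        -- Only `b` is counted from the far end: it has distance at most 2 from `a` by way of `x`.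
        Da : sumOf (d a) c ≤ tri (1 + e) + 2
        Da = ≤-trans (path-sum pa′ (d a) (d-lipschitz a) (≤-reflexive (d-adj ay))
                        (≤-trans (d-lipschitz a (symm G xb)) (s≤s (≤-reflexive (d-adj (symm G xa))))) e 0
                        (trans (suc-injective len) (+-comm 1 e)))
                     (≤-reflexive (cong (_+ 2) (run-one e)))
        pairs-c : pairs d c ≤ tet (1 + e)
        pairs-c = ≤-trans (grown-pairs (path-grown pa′)) (≤-reflexive (cong tet (suc-injective len)))
        lemma₁ : ∀ a b c → suc (a + 6 + (b + 2 + c)) ≡ 8 + a + (1 + b + c)
        lemma₁ = solve-∀
        -- The difference of the two triangular numbers is 2 e + 1, which is 9 for e = 4 but only 7
        -- for e = 3.
        8≤ : 8 + tri e ≤ tri (2 + e)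
        8≤ = ≤-trans (+-monoˡ-≤ (tri e) (≤-trans (m≤m+n 8 (suc (o + o))) (≤-reflexive (lemma₂ o))))
          (≤-reflexive (+-assoc (suc e) e (tri e)))
          where
          lemma₂ : ∀ o → 8 + suc (o + o) ≡ suc (4 + o) + (4 + o)
          lemma₂ = solve-∀

      strict : ∀ {A : Set} → W G < WC e → W G ≤ WC e × (W G ≡ WC e → A)
      strict lt = <⇒≤ lt , λ eq → contradiction eq (<⇒≢ lt)

    -- If `x` has just the neighbours `a` and `b`, a second deletable vertex `y` different from both
    -- is not adjacent to `x`. Its two neighbours are therefore still present when its distances are
    -- bounded.
    main : ∀ {x vs} → Grown (x ∷ vs) → x ∷ vs ↭ allFin n →
           W G ≤ WC e × (W G ≡ WC e → sumOf (d x) vs ≡ tri (2 + e))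
    main {x} {vs} gr p with two-nbrs x
    ... | a , b , a≢b , xa , xb with Fin.any? (λ c → adj? G x c ×-dec ¬? (c Fin.≟ a) ×-dec ¬? (c Fin.≟ b))
    ...   | yes (c , xc , c≢a , c≢b) = strict (three-nbrs gr p xa xb xc a≢b c≢a c≢b)
    ...   | no only with path-or-deletable (grown-tail gr (tail∈ p (adj-≢ xa))) (tail∈ p (adj-≢ xa))
      (tail∈ p (adj-≢ xb))
    ...     | inj₁ (c , q , pa) = strict (hamiltonian gr p xa xb a≢b q pa)
    ...     | inj₂ (y , ws , gr₂ , q , y≢a , y≢b) =
        ≤-trans (≤-reflexive W≡) (≤-trans (+-mono-≤ (D-bound gr p) rest) (≤-reflexive (sym WC-split)))
      , λ eq → proj₁ (≤-split {a = sumOf (d x) vs} {sumOf (d y) ws + pairs d ws} (D-bound gr p) rest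
                        (trans (sym W≡) (trans eq WC-split)))
      where
      perm : x ∷ y ∷ ws ↭ allFin n
      perm = ↭-trans (prep x q) p
      W≡ : W G ≡ sumOf (d x) vs + (sumOf (d y) ws + pairs d ws)
      W≡ = trans (grown-all gr p) (cong (sumOf (d x) vs +_) (sym (pairs-↭ d d-sym q)))
      x≢nbr : ∀ {v} → Adj G y v → x ≢ v
      x≢nbr yv refl = only (y , symm G yv , y≢a , y≢b)
      ∈ws : ∀ {v} → Adj G y v → v ∈ ws
      ∈ws yv with tail∈ perm (x≢nbr yv)
      ... | here refl = contradiction refl (adj-≢ yv)
      ... | there v∈  = v∈
      len : length ws ≡ 1 + e
      len = suc-injective (tail-length perm)
      rest : sumOf (d y) ws + pairs d ws ≤ (1 + tri (1 + e)) + tet (1 + e)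
      rest with two-nbrs y
      ... | a′ , b′ , a′≢b′ , ya , yb = +-mono-≤
        (≤-trans (transmission-two gr₂ ya yb (∈ws ya) (∈ws yb) a′≢b′) (≤-reflexive (cong (λ l → 1 + tri l) len)))
        (≤-trans (grown-pairs (grown-tail gr₂ (∈ws ya))) (≤-reflexive (cong tet len)))

  -- No pendant vertices: equality

  module Dumbbell {n} (G : Graph n) (connected : Connected G)
    (two-nbrs : ∀ v → ∃₂ λ a b → a ≢ b × Adj G v a × Adj G v b)
    (e : ℕ) (4≤e : 4 ≤ e) where

    open Metric G connected

    joined-sym : ∀ {E : ℕ → Set} {f : Fin n → ℕ} {u v} → Joined E f u v → Joined E f v u
    joined-sym (inj₁ eq)        = inj₂ (inj₁ eq)
    joined-sym (inj₂ (inj₁ eq)) = inj₁ eq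
    joined-sym {E} (inj₂ (inj₂ (u≢v , eq , p))) = inj₂ (inj₂ (≢-sym u≢v , sym eq , subst E eq p))

    -- gs is a geodesic from x to z; s and t are the remaining vertices.
    module Ladder (x z s t : Fin n) (gs : List (Fin n)) (perm : gs ++ s ∷ t ∷ [] ↭ allFin n)
      (φ-gs : map (d x) gs ↭ downFrom (suc e)) (opposite : ∀ {v} → v ∈ gs → d z v + d x v ≡ e)
      (φs : d x s ≡ 1) (θs : d z s ≡ e) (φt : d x t ≡ e) (θt : d z t ≡ 1) where

      private
        φ θ : Fin n → ℕ
        φ = d x
        θ = d z

        Ends : ℕ → Set
        Ends i = i ≡ 0 ⊎ i ≡ e

        -- The vertex `s` is to be the twin of `x`: it is at distance 1 from `x` but belongs on
        -- level 0. The twin `t` of `z` already has the value `e`.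
        ψ : Fin n → ℕ
        ψ v with v Fin.≟ s
        ... | yes _ = 0
        ... | no _  = φ v

        ψs : ψ s ≡ 0
        ψs with s Fin.≟ s
        ... | yes _ = refl
        ... | no ¬p = contradiction refl ¬p

        ψ-≢ : ∀ {v} → v ≢ s → ψ v ≡ φ v
        ψ-≢ {v} v≢s with v Fin.≟ s
        ... | yes p = contradiction p v≢s
        ... | no _  = refl

        e≢1 : e ≢ 1
        e≢1 = ≢-sym (<⇒≢ (≤-trans (s≤s (s≤s z≤n)) 4≤e))

        e≢0 : e ≢ 0
        e≢0 = ≢-sym (<⇒≢ (≤-trans (s≤s z≤n) 4≤e))

        t≢s : t ≢ s
        t≢s refl = e≢1 (trans (sym φt) φs)

        s∉gs : s ∉ gs
        s∉gs s∈ = 1+n≢n (trans (+-comm 1 e) (trans (cong₂ _+_ (sym θs) (sym φs)) (opposite s∈)))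

        t∉gs : t ∉ gs
        t∉gs t∈ = 1+n≢n (trans (cong₂ _+_ (sym θt) (sym φt)) (opposite t∈))

        gs≢s : ∀ {v} → v ∈ gs → v ≢ s
        gs≢s v∈ refl = s∉gs v∈

        ψ-gs : ∀ {v} → v ∈ gs → ψ v ≡ φ v
        ψ-gs = ψ-≢ ∘ gs≢s

        ψt : ψ t ≡ e
        ψt = trans (ψ-≢ t≢s) φt

        φ-injective : ∀ {u v} → u ∈ gs → v ∈ gs → φ u ≡ φ v → u ≡ v
        φ-injective = unique-map-injective φ (unique-resp-↭ (↭-sym φ-gs) (Unique.downFrom⁺ (suc e)))

        φ≤e : ∀ {v} → v ∈ gs → φ v ≤ e
        φ≤e v∈ = s≤s⁻¹ (∈-downFrom⁻ (∈-resp-↭ φ-gs (∈-map⁺ φ v∈)))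

        θ≤e : ∀ {v} → v ∈ gs → θ v ≤ e
        θ≤e v∈ = ≤-trans (m≤m+n _ _) (≤-reflexive (opposite v∈))

        data Kind : Fin n → Set where
          rung  : ∀ {v} → v ∈ gs → Kind v
          sKind : Kind s
          tKind : Kind t

        kind : ∀ v → Kind v
        kind v with ∈-++⁻ gs (∈-resp-↭ (↭-sym perm) (∈-allFin v))
        ... | inj₁ v∈                  = rung v∈
        ... | inj₂ (here refl)         = sKind
        ... | inj₂ (there (here refl)) = tKind

        -- Distances from `x` would also allow the value 2. Those from `z` exclude it, since `s` is
        -- at distance `e` from `z` and on the geodesic the two distances add up to `e`.
        near-s : ∀ {v} → v ∈ gs → Adj G s v → φ v ≡ 1 ⊎ φ v ≡ 0
        near-s {v} v∈ sv with d-close z sv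
        ... | inj₁ eq        = contradiction (θ≤e v∈) (<⇒≱ (≤-reflexive (trans (cong suc (sym θs)) eq)))
        ... | inj₂ (inj₁ eq) = inj₁ (+-cancelˡ-≡ (θ v) (φ v) 1 (trans (opposite v∈) (trans (sym (trans eq θs))
          (+-comm 1 (θ v)))))
        ... | inj₂ (inj₂ eq) = inj₂ (+-cancelˡ-≡ (θ v) (φ v) 0 (trans (opposite v∈) (trans (sym θs)
          (trans eq (sym (+-identityʳ (θ v)))))))

        near-t : ∀ {v} → v ∈ gs → Adj G t v → suc (φ v) ≡ e ⊎ φ v ≡ e
        near-t {v} v∈ tv with d-close x tv
        ... | inj₁ eq        = contradiction (φ≤e v∈) (<⇒≱ (≤-reflexive (trans (cong suc (sym φt)) eq)))
        ... | inj₂ (inj₁ eq) = inj₁ (trans eq φt)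
        ... | inj₂ (inj₂ eq) = inj₂ (trans (sym eq) φt)

        s≁t : ¬ Adj G s t
        s≁t st with ≤-trans (≤-reflexive (sym φt)) (≤-trans (d-lipschitz x (symm G st)) (s≤s (≤-reflexive φs)))
        ... | e≤2 with s≤s (s≤s ()) ← ≤-trans 4≤e e≤2

        nbr-s : ∀ {v} → Adj G s v → v ∈ gs
        nbr-s {v} sv with kind v
        ... | rung v∈ = v∈
        ... | sKind   = contradiction sv (irrefl G refl)
        ... | tKind   = contradiction sv s≁t

        nbr-t : ∀ {v} → Adj G t v → v ∈ gs
        nbr-t {v} tv with kind v
        ... | rung v∈ = v∈
        ... | tKind   = contradiction tv (irrefl G refl)
        ... | sKind   = contradiction (symm G tv) s≁t

        -- Each of the two values is taken by at most one vertex of the geodesic, so two distinct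
        -- neighbours must occupy both places.
        both : ∀ {u i j} → (∀ {v} → Adj G u v → v ∈ gs × (φ v ≡ i ⊎ φ v ≡ j)) →
               ∀ {v} → v ∈ gs → φ v ≡ i ⊎ φ v ≡ j → Adj G u v
        both {u} near v∈ φv with two-nbrs u
        ... | a , b , a≢b , ua , ub with near ua | near ub | φv
        ...   | a∈ , inj₁ φa | b∈ , inj₁ φb | _       = contradiction (φ-injective a∈ b∈ (trans φa (sym φb))) a≢b
        ...   | a∈ , inj₂ φa | b∈ , inj₂ φb | _       = contradiction (φ-injective a∈ b∈ (trans φa (sym φb))) a≢b
        ...   | a∈ , inj₁ φa | _            | inj₁ eq = subst (Adj G u) (φ-injective a∈ v∈ (trans φa (sym eq))) ua
        ...   | a∈ , inj₂ φa | _            | inj₂ eq = subst (Adj G u) (φ-injective a∈ v∈ (trans φa (sym eq))) ua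
        ...   | _            | b∈ , inj₁ φb | inj₁ eq = subst (Adj G u) (φ-injective b∈ v∈ (trans φb (sym eq))) ub
        ...   | _            | b∈ , inj₂ φb | inj₂ eq = subst (Adj G u) (φ-injective b∈ v∈ (trans φb (sym eq))) ub

        s-adj : ∀ {v} → v ∈ gs → φ v ≡ 1 ⊎ φ v ≡ 0 → Adj G s v
        s-adj = both (λ sv → nbr-s sv , near-s (nbr-s sv) sv)

        suc-pred-e : suc (pred e) ≡ e
        suc-pred-e = suc-pred e {{>-nonZero (≤-trans (s≤s z≤n) 4≤e)}}

        t-adj : ∀ {v} → v ∈ gs → φ v ≡ pred e ⊎ φ v ≡ e → Adj G t v
        t-adj = both (λ tv → nbr-t tv , Sum.map₁ (λ eq → suc-injective (trans eq (sym suc-pred-e)))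
          (near-t (nbr-t tv) tv))

        rung-adj : ∀ {u v} → u ∈ gs → v ∈ gs → suc (φ u) ≡ φ v → Adj G v u
        rung-adj {u} {v} u∈ v∈ eq with d-parent (sym eq)
        ... | w , vw , φw with kind w
        ...   | rung w∈ = subst (Adj G v) (φ-injective w∈ u∈ φw) vw
        ...   | tKind   = contradiction (φ≤e v∈) (<⇒≱ (≤-reflexive (trans (cong suc (trans (sym φt) φw)) eq)))
        ...   | sKind with near-s v∈ (symm G vw)
        ...     | inj₁ φv = contradiction (trans (sym φs) (trans φw (suc-injective (trans eq φv)))) 1+n≢0
        ...     | inj₂ φv = contradiction (trans eq φv) 1+n≢0

        forth-s : ∀ {v} → v ∈ gs → Adj G s v → Joined Ends ψ s v
        forth-s v∈ sv with near-s v∈ sv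
        ... | inj₁ φv = inj₁ (trans (cong suc ψs) (sym (trans (ψ-gs v∈) φv)))
        ... | inj₂ φv = inj₂ (inj₂ (≢-sym (gs≢s v∈) , trans ψs (sym (trans (ψ-gs v∈) φv)) , inj₁ ψs))

        forth-t : ∀ {v} → v ∈ gs → Adj G t v → Joined Ends ψ t v
        forth-t v∈ tv with near-t v∈ tv
        ... | inj₁ eq = inj₂ (inj₁ (trans (cong suc (ψ-gs v∈)) (trans eq (sym ψt))))
        ... | inj₂ φv = inj₂ (inj₂ ((λ { refl → t∉gs v∈ }) , trans ψt (sym (trans (ψ-gs v∈) φv)) , inj₂ ψt))

        forth : ∀ u v → Adj G u v → Joined Ends ψ u v
        forth u v uv with kind u | kind v
        ... | sKind   | _       = forth-s (nbr-s uv) uv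
        ... | tKind   | _       = forth-t (nbr-t uv) uv
        ... | rung u∈ | sKind   = joined-sym {E = Ends} {ψ} (forth-s u∈ (symm G uv))
        ... | rung u∈ | tKind   = joined-sym {E = Ends} {ψ} (forth-t u∈ (symm G uv))
        ... | rung u∈ | rung v∈ with d-close x uv
        ...   | inj₁ eq        = inj₁ (trans (cong suc (ψ-gs u∈)) (trans eq (sym (ψ-gs v∈))))
        ...   | inj₂ (inj₁ eq) = inj₂ (inj₁ (trans (cong suc (ψ-gs v∈)) (trans eq (sym (ψ-gs u∈)))))
        ...   | inj₂ (inj₂ eq) = contradiction uv (irrefl G (φ-injective u∈ v∈ eq))

        back-s : ∀ {v} → v ∈ gs → Joined Ends ψ s v → Adj G s v
        back-s v∈ (inj₁ eq)               = s-adj v∈ (inj₁ (trans (sym (ψ-gs v∈)) (trans (sym eq) (cong suc ψs))))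
        back-s v∈ (inj₂ (inj₁ eq))        = contradiction (trans eq ψs) 1+n≢0
        back-s v∈ (inj₂ (inj₂ (_ , eq , _))) = s-adj v∈ (inj₂ (trans (sym (ψ-gs v∈)) (trans (sym eq) ψs)))

        back-t : ∀ {v} → v ∈ gs → Joined Ends ψ t v → Adj G t v
        back-t v∈ (inj₁ eq)               = contradiction (φ≤e v∈) (<⇒≱ (≤-reflexive (trans (cong suc (sym ψt))
          (trans eq (ψ-gs v∈)))))
        back-t v∈ (inj₂ (inj₁ eq))        = t-adj v∈ (inj₁ (suc-injective (trans (cong suc (sym (ψ-gs v∈)))
          (trans eq (trans ψt (sym suc-pred-e))))))
        back-t v∈ (inj₂ (inj₂ (_ , eq , _))) = t-adj v∈ (inj₂ (trans (sym (ψ-gs v∈)) (trans (sym eq) ψt)))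

        ¬joined-st : ¬ Joined Ends ψ s t
        ¬joined-st (inj₁ eq)                  = e≢1 (trans (sym ψt) (trans (sym eq) (cong suc ψs)))
        ¬joined-st (inj₂ (inj₁ eq))           = 1+n≢0 (trans eq ψs)
        ¬joined-st (inj₂ (inj₂ (_ , eq , _))) = e≢0 (trans (sym ψt) (trans (sym eq) ψs))

        ¬joined-refl : ∀ {u} → ¬ Joined Ends ψ u u
        ¬joined-refl (inj₁ eq)                  = 1+n≢n eq
        ¬joined-refl (inj₂ (inj₁ eq))           = 1+n≢n eq
        ¬joined-refl (inj₂ (inj₂ (u≢u , _))) = u≢u refl

        back : ∀ u v → Joined Ends ψ u v → Adj G u v
        back u v j with kind u | kind v
        ... | sKind   | sKind   = contradiction j (¬joined-refl {s})
        ... | tKind   | tKind   = contradiction j (¬joined-refl {t})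
        ... | sKind   | tKind   = contradiction j ¬joined-st
        ... | tKind   | sKind   = contradiction (joined-sym {E = Ends} {ψ} {t} {s} j) ¬joined-st
        ... | sKind   | rung v∈ = back-s v∈ j
        ... | tKind   | rung v∈ = back-t v∈ j
        ... | rung u∈ | sKind   = symm G (back-s u∈ (joined-sym {E = Ends} {ψ} {u} {s} j))
        ... | rung u∈ | tKind   = symm G (back-t u∈ (joined-sym {E = Ends} {ψ} {u} {t} j))
        back u v (inj₁ eq)               | rung u∈ | rung v∈ = symm G (rung-adj u∈ v∈
          (trans (cong suc (sym (ψ-gs u∈))) (trans eq (ψ-gs v∈))))
        back u v (inj₂ (inj₁ eq))        | rung u∈ | rung v∈ = rung-adj v∈ u∈ (trans (cong suc (sym (ψ-gs v∈)))
          (trans eq (ψ-gs u∈)))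
        back u v (inj₂ (inj₂ (u≢v , eq , _))) | rung u∈ | rung v∈ =
          contradiction (φ-injective u∈ v∈ (trans (sym (ψ-gs u∈)) (trans eq (ψ-gs v∈)))) u≢v

        levels : map ψ (allFin n) ↭ 0 ∷ e ∷ downFrom (suc e)
        levels = ↭-trans (map⁺ ψ (↭-trans (↭-sym perm) (++-comm gs (s ∷ t ∷ []))))
          (↭-trans (↭-reflexive (cong₂ _∷_ ψs (cong₂ _∷_ ψt (map-cong-local (All.tabulate ψ-gs)))))
            (prep 0 (prep e φ-gs)))

      levelled : Levelled G (0 ∷ e ∷ downFrom (suc e)) Ends
      levelled = record { level = ψ ; levels = levels ; adj⇔ = λ u v → mk⇔ (forth u v) (back u v) }

    module _ {x z : Fin n} (profile-x : map (d x) (allFin n) ↭ 1 ∷ e ∷ downFrom (suc e))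
             (profile-z : map (d z) (allFin n) ↭ 1 ∷ e ∷ downFrom (suc e)) (z-max : ∀ v → d x v ≤ d x z) where

      private
        φ θ : Fin n → ℕ
        φ = d x
        θ = d z

        φz : φ z ≡ e
        φz = ≤-antisym φz≤e e≤φz
          where
          e≤φz : e ≤ φ z
          e≤φz with ∈-map⁻ φ (∈-resp-↭ (↭-sym profile-x) (there (here refl)))
          ... | v , _ , eq = ≤-trans (≤-reflexive eq) (z-max v)
          φz≤e : φ z ≤ e
          φz≤e with ∈-resp-↭ profile-x (∈-map⁺ φ (∈-allFin z))
          ... | here eq          = ≤-trans (≤-reflexive eq) (≤-trans (s≤s z≤n) 4≤e)
          ... | there (here eq)  = ≤-reflexive eq
          ... | there (there z∈) = s≤s⁻¹ (∈-downFrom⁻ z∈)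

        e≤θ+φ : ∀ v → e ≤ θ v + φ v
        e≤θ+φ v = ≤-trans (≤-reflexive (trans (sym φz) (d-sym x z))) (≤-trans (d-triangle z v x) (+-monoʳ-≤ (θ v)
          (≤-reflexive (d-sym v x))))

        geodesic : ∀ i v → φ v ≡ i → θ v + φ v ≡ e → ∃ λ gs →
          map φ gs ≡ downFrom (suc i) × All (λ g → θ g + φ g ≡ e) gs
        geodesic zero    v φv eq = v ∷ [] , cong (_∷ []) φv , eq ∷ []
        geodesic (suc i) v φv eq with d-parent φv
        ... | w , vw , φw with geodesic i w φw (≤-antisym le (e≤θ+φ w))
          where
          le : θ w + φ w ≤ e
          le = ≤-trans (+-monoˡ-≤ (φ w) (d-lipschitz z (symm G vw)))
            (≤-reflexive (trans (sym (+-suc (θ v) (φ w))) (trans (cong (θ v +_) (trans (cong suc φw) (sym φv))) eq)))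
        ...   | gs , map≡ , all = v ∷ gs , cong₂ _∷_ φv map≡ , eq ∷ all

        geo = geodesic e z φz (trans (cong (_+ φ z) (d-self z)) φz)

      remaining : ∀ (f : Fin n → ℕ) {gs rest} → allFin n ↭ gs ++ rest → map f (allFin n) ↭ 1 ∷ e ∷ downFrom (suc e) →
                  map f gs ↭ downFrom (suc e) → map f rest ↭ 1 ∷ e ∷ []
      remaining f {gs} {rest} split profile f-gs = ++-cancelˡ-↭ (downFrom (suc e)) (↭-trans
        (↭-trans (++⁺ʳ (map f rest) (↭-sym f-gs)) (↭-trans (↭-reflexive (sym (map-++ f gs rest)))
          (map⁺ f (↭-sym split))))
        (↭-trans profile (++-comm (1 ∷ e ∷ []) (downFrom (suc e)))))

      dumbbell : Levelled G (0 ∷ e ∷ downFrom (suc e)) (λ i → i ≡ 0 ⊎ i ≡ e)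
      dumbbell = assemble (proj₁ geo) (proj₁ (proj₂ geo)) (proj₂ (proj₂ geo))
        where
        assemble : ∀ gs → map φ gs ≡ downFrom (suc e) → All (λ g → θ g + φ g ≡ e) gs →
                   Levelled G (0 ∷ e ∷ downFrom (suc e)) (λ i → i ≡ 0 ⊎ i ≡ e)
        assemble gs map≡ opp with unique-⊆ {xs = gs} (Unique.map⁻ (subst Unique (sym map≡) (Unique.downFrom⁺
          (suc e)))) (λ {v} _ → ∈-allFin v)
        ... | rest , split with ↭-map-inv φ (remaining φ split profile-x (↭-reflexive map≡))
        ...   | s ∷ t ∷ [] , st≡ , p = done (∷-injectiveˡ st≡) (∷-injectiveˡ (∷-injectiveʳ st≡))
                (↭-trans (map⁺ θ (↭-sym p)) (remaining θ split profile-z θ-gs))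
          where
          θ-gs : map θ gs ↭ downFrom (suc e)
          θ-gs = ↭-trans (↭-reflexive (trans
            (map-cong-local (All.map (λ {g} eq → trans (sym (m+n∸n≡m (θ g) (φ g))) (cong (_∸ φ g) eq)) opp))
            (trans (map-∘ gs) (cong (map (e ∸_)) map≡)))) (flip-downFrom e)
          done : 1 ≡ φ s → e ≡ φ t → θ s ∷ θ t ∷ [] ↭ 1 ∷ e ∷ [] → _
          done φs φt q with ∈-resp-↭ q (here refl)
          -- With `s` adjacent to both `x` and `z`, the distance between these would be at most 2.
          ... | here θs = contradiction (≤-trans 4≤e (≤-trans (e≤θ+φ s) (≤-reflexive (cong₂ _+_ θs (sym φs)))))
            λ { (s≤s (s≤s ())) }
          ... | there (here θs) = Ladder.levelled x z s t gs (↭-trans (++⁺ˡ gs (↭-sym p)) (↭-sym split))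
            (↭-reflexive map≡)
                (All.lookup opp) (sym φs) θs (sym φt)
                (∷-injectiveˡ (↭-singleton-inv (drop-∷ (↭-trans q (↭-trans (swap 1 e refl)
                  (↭-reflexive (cong (_∷ 1 ∷ []) (sym θs))))))))

  -- The bound of part (i): pairs of pendant vertices, mixed pairs, and pairs of inner vertices.
  WTmax : ℕ → ℕ → ℕ
  WTmax k d = 2 * tri k + pred d * balanced k + (k * tri (suc d) + tet d)

  -- The index of T(a, b, d + 1) misses the bound by `d` times the defect of the product a b,
  -- written additively. This gives the value for balanced a and b, and conversely forces balance
  -- when the bound is attained.
  WT-balanced : ∀ a b d → WT a b (suc d) + d * balanced (a + b) ≡ WTmax (a + b) (suc d) + d * (a * b)
  WT-balanced a b d = trans (lemma a b d (tri a) (tri b) (tri (2 + d)) (tet (suc d)) (balanced (a + b)))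
    (cong (λ z → 2 * z + d * balanced (a + b) + ((a + b) * tri (2 + d) + tet (suc d)) + d * (a * b))
      (sym (tri-+ a b)))
    where
    lemma : ∀ a b d A B T U q → U + (a + b) * T + 2 * (A + B) + a * b * suc (suc d) + d * q
                              ≡ 2 * (A + B + a * b) + d * q + ((a + b) * T + U) + d * (a * b)
    lemma = solve-∀

  WT-half : ∀ k d → WT ⌊ k /2⌋ ⌈ k /2⌉ (suc d) ≡ WTmax k (suc d)
  WT-half k d = trans (+-cancelʳ-≡ (d * balanced (f + c)) _ _
      (trans (WT-balanced f c d) (cong (λ z → WTmax (f + c) (suc d) + d * z) (cong balanced
        (sym (⌊n/2⌋+⌈n/2⌉≡n k))))))
    (cong (λ z → WTmax z (suc d)) (⌊n/2⌋+⌈n/2⌉≡n k))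
    where
    f = ⌊ k /2⌋
    c = ⌈ k /2⌉

  levelsOf-flip : ∀ a b d → map (2 + d ∸_) (levelsOf a b (suc d)) ↭ levelsOf b a (suc d)
  levelsOf-flip a b d = ↭-trans (↭-reflexive (begin
      map (2 + d ∸_) (replicate a 0 ++ replicate b (2 + d) ++ map suc (downFrom (suc d)))
        ≡⟨ map-++ (2 + d ∸_) (replicate a 0) _ ⟩
      map (2 + d ∸_) (replicate a 0) ++ map (2 + d ∸_) (replicate b (2 + d) ++ map suc (downFrom (suc d)))
        ≡⟨ cong₂ _++_ (map-replicate (2 + d ∸_) a 0) (trans (map-++ (2 + d ∸_) (replicate b (2 + d)) _)
             (cong₂ _++_ (trans (map-replicate (2 + d ∸_) b (2 + d)) (cong (replicate b) (n∸n≡0 d)))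
               (trans (sym (map-∘ (downFrom (suc d)))) (trans (map-cong-local (All.tabulate (λ i∈ → +-∸-assoc 1
                 (s≤s⁻¹ (∈-downFrom⁻ i∈)))))
                 (map-∘ (downFrom (suc d))))))) ⟩
      replicate a (2 + d) ++ replicate b 0 ++ map suc (map (d ∸_) (downFrom (suc d))) ∎))
    (↭-trans (shifts (replicate a (2 + d)) (replicate b 0))
      (++⁺ˡ (replicate b 0) (++⁺ˡ (replicate a (2 + d)) (map⁺ suc (flip-downFrom d)))))
    where open ≡-Reasoning

  levelsOf-≤ : ∀ a b d {i} → i ∈ levelsOf a b d → i ≤ suc d
  levelsOf-≤ a b d i∈ with ∈-++⁻ (replicate a 0) i∈
  ... | inj₁ p = ≤-trans (≤-reflexive (replicate-∈ a p)) z≤n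
  ... | inj₂ p with ∈-++⁻ (replicate b (suc d)) p
  ...   | inj₁ q = ≤-reflexive (replicate-∈ b q)
  ...   | inj₂ q with ∈-map⁻ suc q
  ...     | j , j∈ , refl = ≤-trans (∈-downFrom⁻ j∈) (n≤1+n d)

  -- The numbering starts from an arbitrary pendant vertex, and its side may be the larger one.
  levelsOf-swap : ∀ {n} {G : Graph n} a b d → Levelled G (levelsOf a b (suc d)) (λ _ → ⊥) →
    Levelled G (levelsOf b a (suc d)) (λ _ → ⊥)
  levelsOf-swap a b d L = levelled-resp-↭ (levelsOf-flip a b d)
    (flip-levels (2 + d) L (λ u → levelsOf-≤ a b (suc d) (∈-resp-↭ (Levelled.levels L) (∈-map⁺ (Levelled.level L)
      (∈-allFin u))))
      (λ _ → mk⇔ id id))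

  -- At least two pendant vertices

  module _ {n} (G : Graph n) (connected : Connected G) where

    open Metric G connected
    open Growth G connected

    -- The vertex `w` has one neighbour farther from `r` and another one nearer to it.
    between-inner : ∀ r {v w t} → Adj G v w → d r v ≡ 2 + t → d r w ≡ suc t → ¬ Pendant G w
    between-inner r vw dv dw with d-parent dw
    ... | w′ , ww′ , dw′ = nonPendant G (symm G vw) ww′ λ { refl → m+1+n≢n 1 (trans (sym dv) dw′) }

    -- A walk starting on an edge between two pendant vertices never leaves it, so by connectedness
    -- the graph is that edge.
    no-pendant-edge : ∀ {p q r} → Adj G p q → Pendant G p → Pendant G q → Pendant G r
    no-pendant-edge {p} {q} {r} pq pp pq′ = [ (λ { refl → pp }) , (λ { refl → pq′ }) ]′ (closed (d-walk p r)
      (inj₁ refl))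
      where
      closed : ∀ {ℓ u v} → Walk G ℓ u v → u ≡ p ⊎ u ≡ q → v ≡ p ⊎ v ≡ q
      closed []      u∈          = u∈
      closed (a ∷ w) (inj₁ refl) = closed w (inj₂ (pendant-unique G pp a pq))
      closed (a ∷ w) (inj₂ refl) = closed w (inj₁ (pendant-unique G pq′ a (symm G pq)))

    record PendantSplit : Set where
      field
        {ns ps}     : List (Fin n)
        perm        : ps ++ ns ↭ allFin n
        grown-ns    : Grown ns
        ns-inner    : ∀ {v} → v ∈ ns → ¬ Pendant G v
        ps-pendant  : ∀ {v} → v ∈ ps → Pendant G v
        nb          : Fin n → Fin n
        nb-adj      : ∀ v → Adj G v (nb v)
        nb∈         : ∀ {v} → v ∈ ps → nb v ∈ ns
        length-ps   : length ps ≡ ∣ pendants G ∣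

    private
      inner? = ¬? ∘ pendant? G

      inners : List (Fin n)
      inners = filter inner? (allFin n)

      ∈-inners⁺ : ∀ {v} → ¬ Pendant G v → v ∈ inners
      ∈-inners⁺ {v} ¬p = ∈-filter⁺ inner? (∈-allFin v) ¬p

      ∈-inners⁻ : ∀ {v} → v ∈ inners → ¬ Pendant G v
      ∈-inners⁻ v∈ = proj₂ (∈-filter⁻ inner? {xs = allFin n} v∈)

      ∈-pendantList⁻ : ∀ {v} → v ∈ pendantList G → Pendant G v
      ∈-pendantList⁻ v∈ = proj₂ (∈-filter⁻ (pendant? G) {xs = allFin n} v∈)

      length-inners : n ≡ ∣ pendants G ∣ + length inners
      length-inners = trans (sym (length-tabulate id)) (trans (↭-length (filter-partition (pendant? G) (allFin n)))
        (trans (length-++ (pendantList G)) (cong (_+ length inners) (sym (pendants-length G)))))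

      two-members : ∀ {A : Set} (xs : List A) → Unique xs → 2 ≤ length xs → ∃₂ λ x y → x ∈ xs × x ≢ y
      two-members (x ∷ y ∷ _) ((x≢y ∷ _) ∷ _) _ = x , y , here refl , x≢y
      two-members (_ ∷ [])    _ (s≤s ())

      -- Inner vertices are ranked by their distance from the inner vertex `r`; parents are inner by
      -- `between-inner`. The vertex `o` provides `r` with a neighbour, so that `nb` is total.
      splitAt : ∀ {r o} → r ∈ inners → r ≢ o → PendantSplit
      splitAt {r} {o} r∈ r≢o with grown-ranked (d r) (filter⁺ inner? (allFin⁺ n)) r∈ parent
        where
        parent : ∀ {v} → v ∈ inners → v ≢ r → ∃ λ w → w ∈ inners × Adj G v w × d r w < d r v
        parent {v} v∈ v≢r with d r v in eq
        ... | zero = contradiction (sym (d-zero eq)) v≢r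
        parent {v} v∈ v≢r | suc zero with d-parent eq
        ... | w , vw , dw with refl ← d-zero dw = w , r∈ , vw , s≤s (≤-reflexive dw)
        parent {v} v∈ v≢r | suc (suc t) with d-parent eq
        ... | w , vw , dw = w , ∈-inners⁺ (between-inner r vw eq dw) , vw , s≤s (≤-reflexive dw)
      ... | ns , grown-ns , ns↭ = record
        { perm       = ↭-trans (++⁺ˡ (pendantList G) ns↭) (↭-sym (filter-partition (pendant? G) (allFin n)))
        ; grown-ns   = grown-ns
        ; ns-inner   = ∈-inners⁻ ∘ ∈-resp-↭ ns↭
        ; ps-pendant = ∈-pendantList⁻
        ; nb         = proj₁ ∘ neighbour
        ; nb-adj     = proj₂ ∘ neighbour
        ; nb∈        = λ {v} v∈ → ∈-resp-↭ (↭-sym ns↭) (∈-inners⁺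
                         (∈-inners⁻ r∈ ∘ no-pendant-edge (proj₂ (neighbour v)) (∈-pendantList⁻ v∈)))
        ; length-ps  = sym (pendants-length G)
        }
        where
        neighbour : ∀ v → ∃ (Adj G v)
        neighbour v with v Fin.≟ r
        ... | yes refl = hasNeighbour r≢o
        ... | no v≢r   = hasNeighbour v≢r

    pendantSplit : ∣ pendants G ∣ + 2 ≤ n → PendantSplit
    pendantSplit le with two-members inners (filter⁺ inner? (allFin⁺ n))
                           (+-cancelˡ-≤ ∣ pendants G ∣ 2 (length inners) (≤-trans le (≤-reflexive length-inners)))
    ... | r , o , r∈ , r≢o = splitAt r∈ r≢o

  module ManyPendants {n} (G : Graph n) (connected : Connected G) (split : PendantSplit G connected) where

    open Metric G connected
    open Growth G connected
    open PendantSplit split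

    private
      k = length ps
      m = length ns

      ps∉ns : ∀ {p} → p ∈ ps → p ∉ ns
      ps∉ns p∈ p∈′ = ns-inner p∈′ (ps-pendant p∈)

      grown-p : ∀ {p} → p ∈ ps → Grown (p ∷ ns)
      grown-p p∈ = grow (ps∉ns p∈) (nb∈ p∈) (nb-adj _) grown-ns

      -- Passing from both pendant vertices to their neighbours shortens each distance by at most 2,
      -- and there are `tri (length qs)` pairs.
      pairs-lift : ∀ qs → pairs d qs ≤ pairs d (map nb qs) + 2 * tri (length qs)
      pairs-lift []       = z≤n
      pairs-lift (p ∷ qs) = ≤-trans (+-mono-≤ lift (pairs-lift qs))
        (≤-reflexive (lemma (length qs) (sumOf (d (nb p)) (map nb qs)) (pairs d (map nb qs)) (tri (length qs))))
        where
        step-d : ∀ v → d p v ≤ 2 + d (nb p) (nb v)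
        step-d v = ≤-trans (d-triangle p (nb p) v) (+-mono-≤ (≤-reflexive (d-adj (nb-adj p))) (d-lipschitz (nb p)
          (nb-adj v)))
        lift : sumOf (d p) qs ≤ length qs * 2 + sumOf (d (nb p)) (map nb qs)
        lift = ≤-trans (sumOf-≤ {g = λ v → 2 + d (nb p) (nb v)} qs (All.tabulate (λ {v} _ → step-d v)))
          (≤-reflexive (trans (sumOf-+ (λ _ → 2) (λ v → d (nb p) (nb v)) qs)
            (cong₂ _+_ (sumOf-const 2 qs) (sym (sumOf-map (d (nb p)) nb qs)))))
        lemma : ∀ l s P t → l * 2 + s + (P + 2 * t) ≡ s + P + 2 * (l + t)
        lemma = solve-∀

      pairs-ps : pairs d ps ≤ 2 * tri k + pred m * balanced k
      pairs-ps = ≤-trans (pairs-lift ps) (≤-trans (≤-reflexive (+-comm (pairs d (map nb ps)) _))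
        (+-monoʳ-≤ (2 * tri k) (≤-trans (multiset-pairs grown-ns (All.map⁺ (All.tabulate nb∈)))
          (≤-reflexive (cong (λ l → pred m * balanced l) (length-map nb ps))))))

      D-ps : All (λ p → sumOf (d p) ns ≤ tri (suc m)) ps
      D-ps = All.tabulate (λ p∈ → transmission (grown-p p∈))

      W≡ : W G ≡ pairs d ps + sumOf (λ p → sumOf (d p) ns) ps + pairs d ns
      W≡ = trans (W-pairs G) (trans (sym (pairs-↭ d d-sym perm)) (pairs-++ d ps ns))

      cross : sumOf (λ p → sumOf (d p) ns) ps ≤ k * tri (suc m)
      cross = sumOf-≤-const ps D-ps

      cross-tight : sumOf (λ p → sumOf (d p) ns) ps ≡ k * tri (suc m) → All (λ p → sumOf (d p) ns ≡ tri (suc m)) ps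
      cross-tight = sumOf-≡-const {f = λ p → sumOf (d p) ns} {tri (suc m)} ps D-ps

      profile : ∀ {p} → p ∈ ps → sumOf (d p) ns ≡ tri (suc m) → map (d p) (p ∷ ns) ↭ downFrom (suc m)
      profile {p} p∈ = transmission-tight {p} {ns} (grown-gapFree {p} {p ∷ ns} (grown-p p∈) (here refl))

      pairs-ns : pairs d ns ≤ tet m
      pairs-ns = grown-pairs grown-ns

    bound : W G ≤ WTmax k m
    bound = ≤-trans (≤-reflexive (trans W≡ (+-assoc (pairs d ps) _ _))) (+-mono-≤ pairs-ps (+-mono-≤ cross pairs-ns))

    -- φ is the distance from the pendant vertex p₀; it numbers the inner vertices 1, …, 2 + m′ along a path.
    module Tight (m′ : ℕ) {p₀ : Fin n} (p₀∈ : p₀ ∈ ps)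
      (values : ∀ {p} → p ∈ ps → map (d p) (p ∷ ns) ↭ downFrom (3 + m′)) where

      φ : Fin n → ℕ
      φ = d p₀

      D = 2 + m′

      φ-injective : ∀ {u v} → u ∈ ns → v ∈ ns → φ u ≡ φ v → u ≡ v
      φ-injective u∈ v∈ = tight-injective φ (values p₀∈) (there u∈) (there v∈)

      φ≤D : ∀ {v} → v ∈ ns → φ v ≤ D
      φ≤D v∈ = s≤s⁻¹ (tight-< φ (values p₀∈) (there v∈))

      φ>0 : ∀ {v} → v ∈ ns → 0 < φ v
      φ>0 v∈ = d-distinct (λ { refl → ps∉ns p₀∈ v∈ })

      kind : ∀ v → v ∈ ps ⊎ v ∈ ns
      kind v = ∈-++⁻ ps (∈-resp-↭ (↭-sym perm) (∈-allFin v))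

      inner∈ : ∀ {v} → ¬ Pendant G v → v ∈ ns
      inner∈ {v} ¬p with kind v
      ... | inj₁ v∈ = contradiction (ps-pendant v∈) ¬p
      ... | inj₂ v∈ = v∈

      parent∈ : ∀ {u v} → u ∈ ns → suc (φ u) ≡ φ v → Adj G v u
      parent∈ {u} {v} u∈ eq with φ u in φu | φ>0 u∈
      ... | suc i | _ with d-parent (sym eq)
      ...   | w , vw , φw = subst (Adj G v) (φ-injective (inner∈ (between-inner G connected p₀ vw (sym eq) φw)) u∈
        (trans φw (sym φu))) vw

      -- Parents lead from `v` down to the level of `u`, where injectivity identifies the vertex
      -- reached with `u`.
      chain : ∀ t {u v} → u ∈ ns → v ∈ ns → φ v ≡ t + φ u → d u v ≤ t
      chain zero u∈ v∈ eq with refl ← φ-injective v∈ u∈ eq = ≤-reflexive (d-self _)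
      chain (suc t) {u} {v} u∈ v∈ eq with d-parent eq
      ... | w , vw , φw with t + φ u in tφ | ≤-trans (φ>0 u∈) (m≤n+m (φ u) t)
      ...   | suc i | _ = ≤-trans (d-lipschitz u vw)
              (s≤s (chain t u∈ (inner∈ (between-inner G connected p₀ vw eq φw)) (trans φw (sym tφ))))

      -- Some inner vertex is at distance `D` from `p`, hence at distance at least D - 1 from
      -- `nb p`. The inner vertices are numbered 1, ..., D along a path, so only its ends are that
      -- far from another one.
      nb-end : ∀ {p} → p ∈ ps → φ (nb p) ≡ 1 ⊎ φ (nb p) ≡ D
      nb-end {p} p∈ with tight-onto (d p) (p ∷ ns) (values p∈) ≤-refl
      ... | _ , here refl , dv with () ← trans (sym (d-self p)) dv
      ... | v , there v∈ , dv with ≤-total (φ (nb p)) (φ v)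
      ...   | inj₁ le with m≤n⇒∃[o]m+o≡n le
      ...     | t , eq = inj₁ (≤-antisym (+-cancelˡ-≤ t (φ (nb p)) 1 (≤-trans (≤-reflexive (trans (+-comm t _) eq))
                           (≤-trans (φ≤D v∈) (≤-trans D≤ (≤-reflexive (+-comm 1 t)))))) (φ>0 (nb∈ p∈)))
        where
        D≤ : D ≤ suc t
        D≤ = ≤-trans (≤-reflexive (sym dv)) (≤-trans (d-triangle p (nb p) v)
               (+-mono-≤ (≤-reflexive (d-adj (nb-adj p))) (chain t (nb∈ p∈) v∈ (trans (sym eq) (+-comm _ t)))))
      nb-end {p} p∈ | v , there v∈ , dv | inj₂ ge with m≤n⇒∃[o]m+o≡n ge
      ...     | t , eq = inj₂ (≤-antisym (φ≤D (nb∈ p∈)) (≤-trans D≤ (≤-trans (+-monoˡ-≤ t (φ>0 v∈))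
        (≤-reflexive eq))))
        where
        D≤ : D ≤ suc t
        D≤ = ≤-trans (≤-reflexive (sym dv)) (≤-trans (d-triangle p (nb p) v)
               (+-mono-≤ (≤-reflexive (d-adj (nb-adj p))) (≤-trans (≤-reflexive (d-sym (nb p) v)) (chain t v∈ (nb∈ p∈)
                 (trans (sym eq) (+-comm _ t))))))

      ψ : Fin n → ℕ
      ψ v with pendant? G v | φ (nb v) ≟ 1
      ... | no _  | _     = φ v
      ... | yes _ | yes _ = 0
      ... | yes _ | no _  = suc D

      ψ-inner : ∀ {v} → v ∈ ns → ψ v ≡ φ v
      ψ-inner {v} v∈ with pendant? G v | φ (nb v) ≟ 1
      ... | no _  | _ = refl
      ... | yes p | _ = contradiction p (ns-inner v∈)

      ψ-pendant : ∀ {v} → v ∈ ps → (φ (nb v) ≡ 1 × ψ v ≡ 0) ⊎ (φ (nb v) ≡ D × ψ v ≡ suc D)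
      ψ-pendant {v} v∈ with pendant? G v | φ (nb v) ≟ 1
      ... | no ¬p | _     = contradiction (ps-pendant v∈) ¬p
      ... | yes _ | yes e = inj₁ (e , refl)
      ... | yes _ | no ¬e = inj₂ ([ (λ e → contradiction e ¬e) , id ]′ (nb-end v∈) , refl)

      pendant-forth : ∀ {u v} → u ∈ ps → Adj G u v → v ∈ ns × (suc (ψ u) ≡ ψ v ⊎ suc (ψ v) ≡ ψ u)
      pendant-forth {u} u∈ uv with refl ← pendant-unique G (ps-pendant u∈) (nb-adj u) uv | ψ-pendant u∈
      ... | inj₁ (φ≡ , ψ≡) = nb∈ u∈ , inj₁ (trans (cong suc ψ≡) (sym (trans (ψ-inner (nb∈ u∈)) φ≡)))
      ... | inj₂ (φ≡ , ψ≡) = nb∈ u∈ , inj₂ (trans (cong suc (trans (ψ-inner (nb∈ u∈)) φ≡)) (sym ψ≡))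

      forth : ∀ u v → Adj G u v → Joined (λ _ → ⊥) ψ u v
      forth u v uv with kind u | kind v
      ... | inj₁ u∈ | _       = Sum.map₂ inj₁ (proj₂ (pendant-forth u∈ uv))
      ... | inj₂ u∈ | inj₁ v∈ = Sum.map₂ inj₁ (Sum.swap (proj₂ (pendant-forth v∈ (symm G uv))))
      ... | inj₂ u∈ | inj₂ v∈ with d-close p₀ uv
      ...   | inj₁ eq        = inj₁ (trans (cong suc (ψ-inner u∈)) (trans eq (sym (ψ-inner v∈))))
      ...   | inj₂ (inj₁ eq) = inj₂ (inj₁ (trans (cong suc (ψ-inner v∈)) (trans eq (sym (ψ-inner u∈)))))
      ...   | inj₂ (inj₂ eq) = contradiction uv (irrefl G (φ-injective u∈ v∈ eq))

      ascend : ∀ {u v} → suc (ψ u) ≡ ψ v → Adj G v u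
      ascend {u} {v} eq with kind u | kind v
      ... | inj₂ u∈ | inj₂ v∈ = parent∈ u∈ (trans (cong suc (sym (ψ-inner u∈))) (trans eq (ψ-inner v∈)))
      ... | inj₁ u∈ | inj₂ v∈ with ψ-pendant u∈
      ...   | inj₁ (φ≡ , ψ≡) = subst (λ w → Adj G w u) (φ-injective (nb∈ u∈) v∈ (trans φ≡ (trans (cong suc (sym ψ≡))
        (trans eq (ψ-inner v∈))))) (symm G (nb-adj u))
      ...   | inj₂ (φ≡ , ψ≡) = contradiction (φ≤D v∈) (<⇒≱ (≤-trans (n≤1+n (suc D))
        (≤-reflexive (trans (cong suc (sym ψ≡)) (trans eq (ψ-inner v∈))))))
      ascend {u} {v} eq | inj₂ u∈ | inj₁ v∈ with ψ-pendant v∈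
      ...   | inj₁ (φ≡ , ψ≡) = contradiction (trans eq ψ≡) 1+n≢0
      ...   | inj₂ (φ≡ , ψ≡) = subst (Adj G v) (φ-injective (nb∈ v∈) u∈
        (trans φ≡ (sym (suc-injective (trans (cong suc (sym (ψ-inner u∈))) (trans eq ψ≡)))))) (nb-adj v)
      ascend {u} {v} eq | inj₁ u∈ | inj₁ v∈ with ψ-pendant u∈ | ψ-pendant v∈
      ...   | inj₁ (_ , e₁) | inj₁ (_ , e₂) with () ← trans (cong suc (sym e₁)) (trans eq e₂)
      ...   | inj₁ (_ , e₁) | inj₂ (_ , e₂) with () ← trans (cong suc (sym e₁)) (trans eq e₂)
      ...   | inj₂ (_ , e₁) | inj₁ (_ , e₂) with () ← trans (cong suc (sym e₁)) (trans eq e₂)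
      ...   | inj₂ (_ , e₁) | inj₂ (_ , e₂) = contradiction (trans (cong suc (sym e₁)) (trans eq e₂)) 1+n≢n

      back : ∀ u v → Joined (λ _ → ⊥) ψ u v → Adj G u v
      back u v (inj₁ eq)        = symm G (ascend eq)
      back u v (inj₂ (inj₁ eq)) = ascend eq

      ψ-ns : map ψ ns ↭ map suc (downFrom D)
      ψ-ns = ↭-trans (↭-reflexive (map-cong-local (All.tabulate ψ-inner))) (drop-∷ {x = 0}
        (↭-trans (↭-reflexive (cong (_∷ map φ ns) (sym (d-self p₀)))) (↭-trans (values p₀∈)
          (↭-trans (↭-reflexive (trans (sym (downFrom-∷ʳ D)) (cong (_∷ʳ 0) (sym (map-downFrom suc D)))))
            (↭-sym (∷↭∷ʳ 0 _))))))

      levelled : ∃₂ λ a b → 0 < a × a + b ≡ k × Levelled G (levelsOf a b D) (λ _ → ⊥)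
      levelled with two-valued 0 (suc D) (map ψ ps) (All.map⁺ (All.tabulate (λ v∈ → Sum.map proj₂ proj₂
        (ψ-pendant v∈))))
      ... | a , b , p , len = a , b , 0<a a p , trans len (length-map ψ ps) , record
        { level  = ψ
        ; levels = ↭-trans (map⁺ ψ (↭-sym perm)) (↭-trans (↭-reflexive (map-++ ψ ps ns))
                     (↭-trans (++⁺ p ψ-ns) (↭-reflexive (++-assoc (replicate a 0) _ _))))
        ; adj⇔   = λ u v → mk⇔ (forth u v) (back u v)
        }
        where
        ψp₀ : ψ p₀ ≡ 0
        ψp₀ with ψ-pendant p₀∈
        ... | inj₁ (_ , eq) = eq
        ... | inj₂ (φ≡ , _) with () ← trans (sym φ≡) (d-adj (nb-adj p₀))
        0<a : ∀ a → map ψ ps ↭ replicate a 0 ++ replicate b (suc D) → 0 < a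
        0<a (suc a) _ = z<s
        0<a zero    q with () ← replicate-∈ b (∈-resp-↭ q (subst (_∈ map ψ ps) ψp₀ (∈-map⁺ ψ p₀∈)))

    module _ (m′ : ℕ) (m≡ : length ns ≡ 2 + m′) {p₀ : Fin n} (p₀∈ : p₀ ∈ ps) where

      private
        balanced-levels : ∀ a b → a + b ≡ k → a * b ≡ balanced (a + b) →
          Levelled G (levelsOf a b (2 + m′)) (λ _ → ⊥) →
                          Levelled G (levelsOf ⌊ k /2⌋ ⌈ k /2⌉ (2 + m′)) (λ _ → ⊥)
        balanced-levels a b a+b≡ eq L with m*n≡balanced a b eq
        ... | inj₁ (a≡ , b≡) = subst₂ (λ i j → Levelled G (levelsOf i j (2 + m′)) (λ _ → ⊥))
          (trans a≡ (cong ⌊_/2⌋ a+b≡)) (trans b≡ (cong ⌈_/2⌉ a+b≡)) L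
        ... | inj₂ (b≡ , a≡) = subst₂ (λ i j → Levelled G (levelsOf i j (2 + m′)) (λ _ → ⊥))
          (trans b≡ (cong ⌊_/2⌋ a+b≡)) (trans a≡ (cong ⌈_/2⌉ a+b≡)) (levelsOf-swap a b (suc m′) L)

        finish : W G ≡ WTmax k (2 + m′) →
          (∃₂ λ a b → 0 < a × a + b ≡ k × Levelled G (levelsOf a b (2 + m′)) (λ _ → ⊥)) →
                 Levelled G (levelsOf ⌊ k /2⌋ ⌈ k /2⌉ (2 + m′)) (λ _ → ⊥)
        finish tight (a , b , 0<a , a+b≡ , L) = balanced-levels a b a+b≡ product L
          where
          W-ab : WTmax (a + b) (2 + m′) ≡ WT a b (2 + m′)
          W-ab = trans (cong (λ z → WTmax z (2 + m′)) a+b≡) (trans (sym tight) (W-T a b (2 + m′) 0<a z<s L))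
          product : a * b ≡ balanced (a + b)
          -- The factor `suc m′` is the length of the inner path. It is positive because there are
          -- at least two inner vertices, so the defect of a b must vanish.
          product = *-cancelˡ-≡ (a * b) (balanced (a + b)) (suc m′) (+-cancelˡ-≡ (WT a b (2 + m′)) _ _
            (trans (cong (_+ suc m′ * (a * b)) (sym W-ab)) (sym (WT-balanced a b (suc m′)))))

        values : W G ≡ WTmax k (2 + m′) → ∀ {p} → p ∈ ps → map (d p) (p ∷ ns) ↭ downFrom (3 + m′)
        values tight {p} p∈ = subst (λ l → map (d p) (p ∷ ns) ↭ downFrom (suc l)) m≡
          (profile p∈ (All.lookup {P = λ p → sumOf (d p) ns ≡ tri (suc m)} (cross-tight cross≡) p∈))
          where
          tight′ : pairs d ps + (sumOf (λ p → sumOf (d p) ns) ps + pairs d ns) ≡ WTmax k m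
          tight′ = trans (sym (trans W≡ (+-assoc (pairs d ps) _ _))) (trans tight (cong (WTmax k) (sym m≡)))
          cross≡ : sumOf (λ p → sumOf (d p) ns) ps ≡ k * tri (suc m)
          cross≡ = proj₁ (≤-split {a = sumOf (λ p → sumOf (d p) ns) ps} {pairs d ns} cross pairs-ns
            (proj₂ (≤-split {a = pairs d ps} {sumOf (λ p → sumOf (d p) ns) ps + pairs d ns} pairs-ps
              (+-mono-≤ cross pairs-ns) tight′)))

      tight⇒levelled : W G ≡ WTmax (length ps) (2 + m′) →
        Levelled G (levelsOf ⌊ length ps /2⌋ ⌈ length ps /2⌉ (2 + m′)) (λ _ → ⊥)
      tight⇒levelled tight = finish tight (Tight.levelled m′ p₀∈ (values tight))

  -- The three comparisons

  AtMost : ∀ {n n′} → Graph n → Graph n′ → Set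
  AtMost G H = W G ≤ W H × (W G ≡ W H ⇔ G ≅ H)

  -- The number `B` separates the estimates, which are proved against a formula, from the model
  -- graph. The converse of the equality case is the invariance of `W`.
  extremal : ∀ {n n′ B} (G : Graph n) (H : Graph n′) → Connected G → W H ≡ B → W G ≤ B → (W G ≡ B → G ≅ H) →
             AtMost G H
  extremal G H conn refl bound tight = bound , mk⇔ tight (λ iso → ≅-W {G = G} {H} iso conn)

  W-T-half : ∀ k m → 2 ≤ k → W (T ⌊ k /2⌋ ⌈ k /2⌉ (2 + m)) ≡ WTmax k (2 + m)
  W-T-half k m 2≤k = trans (W-T {G = T ⌊ k /2⌋ ⌈ k /2⌉ (2 + m)} ⌊ k /2⌋ ⌈ k /2⌉ (2 + m) (⌊n/2⌋-mono 2≤k) z<s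
    (TLevels.T-levelled ⌊ k /2⌋ ⌈ k /2⌉ (suc m)))
                           (WT-half k (suc m))

  many-pendants : ∀ {n k} m → n ≡ k + (2 + m) → 2 ≤ k → (G : Graph n) → InH k G →
    AtMost G (T ⌊ k /2⌋ ⌈ k /2⌉ (2 + m))
  many-pendants {n} {k} m n≡ 2≤k G (conn , k≡) = conclude (pendantSplit G conn enough)
    where
    enough : ∣ pendants G ∣ + 2 ≤ n
    enough = ≤-trans (+-mono-≤ (≤-reflexive k≡) (m≤m+n 2 m)) (≤-reflexive (sym n≡))
    conclude : PendantSplit G conn → AtMost G (T ⌊ k /2⌋ ⌈ k /2⌉ (2 + m))
    conclude split = extremal G (T ⌊ k /2⌋ ⌈ k /2⌉ (2 + m)) conn (W-T-half k m 2≤k)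
      (subst₂ (λ i j → W G ≤ WTmax i j) length-ps≡ length-ns≡ bound)
      (λ eq → levelled-≅ (subst (λ i → Levelled G (levelsOf ⌊ i /2⌋ ⌈ i /2⌉ (2 + m)) (λ _ → ⊥)) length-ps≡
                (tight⇒levelled m length-ns≡
                  (proj₂ (member (≤-trans (s≤s z≤n) (≤-trans 2≤k (≤-reflexive (sym length-ps≡))))))
                  (trans eq (cong (λ i → WTmax i (2 + m)) (sym length-ps≡)))))
                (TLevels.T-levelled ⌊ k /2⌋ ⌈ k /2⌉ (suc m)))
      where
      open PendantSplit split
      open ManyPendants G conn split
      length-ps≡ : length ps ≡ k
      length-ps≡ = trans length-ps k≡
      length-ns≡ : length ns ≡ 2 + m
      length-ns≡ = +-cancelˡ-≡ k (length ns) (2 + m) (trans (cong (_+ length ns) (sym length-ps≡))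
        (trans (sym (length-++ ps)) (trans (↭-length perm) (trans (length-tabulate id) n≡))))
      member : ∀ {A : Set} {xs : List A} → 0 < length xs → ∃ λ x → x ∈ xs
      member {xs = x ∷ _} _ = x , here refl

  U-levelled↓ : ∀ m → Levelled (Uˡ (4 + m) 3) (0 ∷ downFrom (3 + m)) (_≡ 0)
  U-levelled↓ m = levelled-resp-↭ (prep 0 (↭-sym (downFrom↭upTo (3 + m)))) (U-levelled m)

  W-U : ∀ m → W (Uˡ (4 + m) 3) ≡ WU (3 + m)
  W-U m = W-Uˡ {G = Uˡ (4 + m) 3} (suc m) (U-levelled↓ m)

  one-pendant : ∀ {n} m → n ≡ 4 + m → (G : Graph n) → InH 1 G →
    AtMost G (Uˡ (4 + m) 3)
  one-pendant {n} m n≡ G (conn , one) = conclude (onePendant-ends G conn (≤-trans (m≤m+n 3 (suc m))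
    (≤-reflexive (trans (+-suc 3 m) (sym n≡)))) one)
    where
    conclude : PendantEnds G conn → AtMost G (Uˡ (4 + m) 3)
    conclude ends = extremal G (Uˡ (4 + m) 3) conn (W-U m) (subst (λ l → W G ≤ WU (suc l)) length-ws bound)
      (λ eq → levelled-≅ (subst (λ l → Levelled G (0 ∷ downFrom (suc l)) (_≡ 0)) length-ws
                (tight⇒levelled (subst (0 <_) (sym length-ws) z<s) (trans eq (cong (WU ∘ suc) (sym length-ws)))))
                (U-levelled↓ m))
      where
      open PendantEnds ends
      open OnePendant G conn ends
      length-ws : length ws ≡ 2 + m
      length-ws = suc-injective (suc-injective (trans (↭-length perm) (trans (length-tabulate id) n≡)))

  C-levelled↓ : ∀ m → Levelled (C 3 3 (7 + m)) (0 ∷ 4 + m ∷ downFrom (5 + m)) (λ i → i ≡ 0 ⊎ i ≡ 4 + m)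
  C-levelled↓ m = levelled-resp-↭ (prep 0 (prep (4 + m) (↭-sym (downFrom↭upTo (5 + m))))) (CLevels.C-levelled m)

  W-C33 : ∀ m → W (C 3 3 (7 + m)) ≡ WC (4 + m)
  W-C33 m = W-C {G = C 3 3 (7 + m)} (4 + m) z<s (C-levelled↓ m)

  -- `N.main` is applied at two deletable vertices: `x`, farthest from an arbitrary vertex, and `z`,
  -- farthest from `x`. In the equality case they carry the two triangles.
  no-pendants : ∀ {n} m → n ≡ 7 + m → (G : Graph n) → InH 0 G →
    AtMost G (C 3 3 (7 + m))
  no-pendants {n} m n≡ G (conn , none) =
    from-x (proj₁ (farthest (some n≡))) (grown-farthest (farthest-≢ (some n≡) (proj₂ (farthest (some n≡))))
      (proj₂ (farthest (some n≡))))
    where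
    open Metric G conn
    open Growth G conn
    some : ∀ {n m} → n ≡ 7 + m → Fin n
    some refl = zero
    2≤n : 2 ≤ n
    2≤n = ≤-trans (s≤s (s≤s z≤n)) (≤-reflexive (sym n≡))
    empty : ∀ {A : Set} {xs : List A} {x} → length xs ≡ 0 → ¬ (x ∈ xs)
    empty {xs = []} _ ()
    two-nbrs : ∀ v → ∃₂ λ a b → a ≢ b × Adj G v a × Adj G v b
    two-nbrs v = twoNeighbours G (empty (trans (sym (pendants-length G)) none) ∘ ∈-filter⁺ (pendant? G) (∈-allFin v))
                   (proj₂ (hasNeighbour (≢-sym (proj₂ (other-than v 2≤n)))))
    farthest-≢ : ∀ r {x} → (∀ v → d r v ≤ d r x) → r ≢ x
    farthest-≢ r max refl = <-irrefl refl (≤-trans (d-distinct (≢-sym (proj₂ (other-than r 2≤n))))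
                              (≤-trans (max (proj₁ (other-than r 2≤n))) (≤-reflexive (d-self r))))
    module N = NoPendants G conn two-nbrs (4 + m) (m≤m+n 4 m) n≡
    module D = Dumbbell G conn two-nbrs (4 + m) (m≤m+n 4 m)
    finish : ∀ {x z vs us} → Grown (x ∷ vs) → x ∷ vs ↭ allFin n → Grown (z ∷ us) → z ∷ us ↭ allFin n →
      (∀ v → d x v ≤ d x z) →
             AtMost G (C 3 3 (7 + m))
    finish gx px gz pz z-max = extremal G (C 3 3 (7 + m)) conn (W-C33 m) (proj₁ (N.main gx px))
      (λ eq → levelled-≅ (D.dumbbell (N.D-tight gx px (proj₂ (N.main gx px) eq)) (N.D-tight gz pz
        (proj₂ (N.main gz pz) eq)) z-max)
                (C-levelled↓ m))
    from-x : ∀ x → (∃ λ vs → Grown (x ∷ vs) × x ∷ vs ↭ allFin n) →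
             AtMost G (C 3 3 (7 + m))
    from-x x (_ , gx , px) = from-z (grown-farthest (farthest-≢ x z-max) z-max)
      where
      z-max = proj₂ (farthest x)
      from-z : (∃ λ us → Grown (proj₁ (farthest x) ∷ us) × proj₁ (farthest x) ∷ us ↭ allFin n) →
               AtMost G (C 3 3 (7 + m))
      from-z (_ , gz , pz) = finish gx px gz pz z-max

-- The formulas for the extremal values

module Formulas where

  open WienerIndex
  open import Data.Nat.Base using (ℕ; suc; zero; _^_) renaming (_+_ to _+ℕ_; _*_ to _*ℕ_)
  import Data.Nat.Properties as ℕ
  open import Data.Nat.Combinatorics using () renaming (_C_ to _choose_)
  import Data.Nat.Tactic.RingSolver as ℕSolver
  open import Data.Product.Base using (∃; _,_)
  open import Data.Rational.Base using (_+_; _-_; _*_; _÷_; 1/_)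
  open import Data.Rational.Solver using (module +-*-Solver)
  open import Data.Sum.Base using (_⊎_; inj₁; inj₂)
  open import Relation.Binary.PropositionalEquality hiding ([_])

  open +-*-Solver using (solve; _:+_; _:*_; _:-_; _:=_; con)

  even-or-odd : ∀ k → (∃ λ q → k ≡ q +ℕ q) ⊎ (∃ λ q → k ≡ suc (q +ℕ q))
  even-or-odd zero = inj₁ (0 , refl)
  even-or-odd (suc k) with even-or-odd k
  ... | inj₁ (q , refl) = inj₂ (q , refl)
  ... | inj₂ (q , refl) = inj₁ (suc q , cong suc (sym (ℕ.+-suc q q)))

  -- The term 2 q on the left is the -2 of the bracket in the formula, multiplied by k / 2 = q and
  -- moved across.
  WTmax-even : ∀ q d → WTmax (q +ℕ q) (suc d) +ℕ 2 *ℕ q ≡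
               tet (suc d) +ℕ q *ℕ q *ℕ (suc d +ℕ 3) +ℕ q *ℕ (suc d *ℕ suc d +ℕ suc d)
  -- The added q (2 + d) completes the doubled triangular number of 2 + d to a square.
  WTmax-even q d = ℕ.+-cancelʳ-≡ (q *ℕ (2 +ℕ d)) _ _ (begin
    2 *ℕ t +ℕ d *ℕ balanced (q +ℕ q) +ℕ ((q +ℕ q) *ℕ t₁ +ℕ u) +ℕ 2 *ℕ q +ℕ q *ℕ (2 +ℕ d)
      ≡⟨ cong (λ z → 2 *ℕ t +ℕ d *ℕ z +ℕ ((q +ℕ q) *ℕ t₁ +ℕ u) +ℕ 2 *ℕ q +ℕ q *ℕ (2 +ℕ d))
        (sym (cong₂ _*ℕ_ (ℕ.n≡⌊n+n/2⌋ q) (ℕ.n≡⌈n+n/2⌉ q))) ⟩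
    2 *ℕ t +ℕ d *ℕ (q *ℕ q) +ℕ ((q +ℕ q) *ℕ t₁ +ℕ u) +ℕ 2 *ℕ q +ℕ q *ℕ (2 +ℕ d)
      ≡⟨ lemma₁ q d t t₁ u ⟩
    (2 *ℕ t +ℕ (q +ℕ q)) +ℕ q *ℕ (2 *ℕ t₁ +ℕ (2 +ℕ d)) +ℕ d *ℕ (q *ℕ q) +ℕ u
      ≡⟨ cong₂ (λ y z → y +ℕ q *ℕ z +ℕ d *ℕ (q *ℕ q) +ℕ u) (tri-closed (q +ℕ q)) (tri-closed (2 +ℕ d)) ⟩
    (q +ℕ q) *ℕ (q +ℕ q) +ℕ q *ℕ ((2 +ℕ d) *ℕ (2 +ℕ d)) +ℕ d *ℕ (q *ℕ q) +ℕ u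
      ≡⟨ lemma₂ q d u ⟩
    u +ℕ q *ℕ q *ℕ (suc d +ℕ 3) +ℕ q *ℕ (suc d *ℕ suc d +ℕ suc d) +ℕ q *ℕ (2 +ℕ d) ∎)
    where
    open ≡-Reasoning
    t = tri (q +ℕ q)
    t₁ = tri (2 +ℕ d)
    u = tet (suc d)
    lemma₁ : ∀ q d t t₁ u → 2 *ℕ t +ℕ d *ℕ (q *ℕ q) +ℕ ((q +ℕ q) *ℕ t₁ +ℕ u) +ℕ 2 *ℕ q +ℕ q *ℕ (2 +ℕ d)
                         ≡ (2 *ℕ t +ℕ (q +ℕ q)) +ℕ q *ℕ (2 *ℕ t₁ +ℕ (2 +ℕ d)) +ℕ d *ℕ (q *ℕ q) +ℕ u
    lemma₁ = ℕSolver.solve-∀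
    lemma₂ : ∀ q d u → (q +ℕ q) *ℕ (q +ℕ q) +ℕ q *ℕ ((2 +ℕ d) *ℕ (2 +ℕ d)) +ℕ d *ℕ (q *ℕ q) +ℕ u
                     ≡ u +ℕ q *ℕ q *ℕ (suc d +ℕ 3) +ℕ q *ℕ (suc d *ℕ suc d +ℕ suc d) +ℕ q *ℕ (2 +ℕ d)
    lemma₂ = ℕSolver.solve-∀

  -- Doubled, because k (d² + d) / 2 is not an integral polynomial when k is odd.
  WTmax-odd : ∀ q d → let k = suc (q +ℕ q) in
              2 *ℕ WTmax k (suc d) +ℕ 4 *ℕ q ≡
              2 *ℕ tet (suc d) +ℕ 2 *ℕ (q *ℕ suc q *ℕ (suc d +ℕ 3)) +ℕ k *ℕ (suc d *ℕ suc d +ℕ suc d)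
  WTmax-odd q d = ℕ.+-cancelʳ-≡ (k *ℕ (2 +ℕ d) +ℕ 2 *ℕ k) _ _ (begin
    2 *ℕ (2 *ℕ t +ℕ d *ℕ balanced k +ℕ (k *ℕ t₁ +ℕ u)) +ℕ 4 *ℕ q +ℕ (k *ℕ (2 +ℕ d) +ℕ 2 *ℕ k)
      ≡⟨ cong (λ z → 2 *ℕ (2 *ℕ t +ℕ d *ℕ z +ℕ (k *ℕ t₁ +ℕ u)) +ℕ 4 *ℕ q +ℕ (k *ℕ (2 +ℕ d) +ℕ 2 *ℕ k))
           (sym (cong₂ _*ℕ_ (ℕ.n≡⌈n+n/2⌉ q) (cong suc (ℕ.n≡⌊n+n/2⌋ q)))) ⟩
    2 *ℕ (2 *ℕ t +ℕ d *ℕ (q *ℕ suc q) +ℕ (k *ℕ t₁ +ℕ u)) +ℕ 4 *ℕ q +ℕ (k *ℕ (2 +ℕ d) +ℕ 2 *ℕ k)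
      ≡⟨ lemma₁ q d k t t₁ u ⟩
    2 *ℕ (2 *ℕ t +ℕ k) +ℕ k *ℕ (2 *ℕ t₁ +ℕ (2 +ℕ d)) +ℕ 2 *ℕ (d *ℕ (q *ℕ suc q)) +ℕ 2 *ℕ u +ℕ 4 *ℕ q
      ≡⟨ cong₂ (λ y z → 2 *ℕ y +ℕ k *ℕ z +ℕ 2 *ℕ (d *ℕ (q *ℕ suc q)) +ℕ 2 *ℕ u +ℕ 4 *ℕ q) (tri-closed k)
        (tri-closed (2 +ℕ d)) ⟩
    2 *ℕ (k *ℕ k) +ℕ k *ℕ ((2 +ℕ d) *ℕ (2 +ℕ d)) +ℕ 2 *ℕ (d *ℕ (q *ℕ suc q)) +ℕ 2 *ℕ u +ℕ 4 *ℕ q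
      ≡⟨ lemma₂ q d u ⟩
    2 *ℕ u +ℕ 2 *ℕ (q *ℕ suc q *ℕ (suc d +ℕ 3)) +ℕ k *ℕ (suc d *ℕ suc d +ℕ suc d) +ℕ (k *ℕ (2 +ℕ d) +ℕ 2 *ℕ k) ∎)
    where
    open ≡-Reasoning
    k = suc (q +ℕ q)
    t = tri k
    t₁ = tri (2 +ℕ d)
    u = tet (suc d)
    lemma₁ : ∀ q d k t t₁ u →
      2 *ℕ (2 *ℕ t +ℕ d *ℕ (q *ℕ suc q) +ℕ (k *ℕ t₁ +ℕ u)) +ℕ 4 *ℕ q +ℕ (k *ℕ (2 +ℕ d) +ℕ 2 *ℕ k)
           ≡ 2 *ℕ (2 *ℕ t +ℕ k) +ℕ k *ℕ (2 *ℕ t₁ +ℕ (2 +ℕ d)) +ℕ 2 *ℕ (d *ℕ (q *ℕ suc q)) +ℕ 2 *ℕ u +ℕ 4 *ℕ q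
    lemma₁ = ℕSolver.solve-∀
    lemma₂ : ∀ q d u → 2 *ℕ (suc (q +ℕ q) *ℕ suc (q +ℕ q)) +ℕ suc (q +ℕ q) *ℕ ((2 +ℕ d) *ℕ (2 +ℕ d)) +ℕ 2 *ℕ
      (d *ℕ (q *ℕ suc q)) +ℕ 2 *ℕ u +ℕ 4 *ℕ q
           ≡ 2 *ℕ u +ℕ 2 *ℕ (q *ℕ suc q *ℕ (suc d +ℕ 3)) +ℕ suc (q +ℕ q) *ℕ (suc d *ℕ suc d +ℕ suc d) +ℕ
             (suc (q +ℕ q) *ℕ (2 +ℕ d) +ℕ 2 *ℕ suc (q +ℕ q))
    lemma₂ = ℕSolver.solve-∀

  WU-closed : ∀ m → 6 *ℕ WU (3 +ℕ m) +ℕ 7 *ℕ (4 +ℕ m) ≡ (4 +ℕ m) ^ 3 +ℕ 12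
  WU-closed m = begin
    6 *ℕ (1 +ℕ t +ℕ u) +ℕ 7 *ℕ (4 +ℕ m)                            ≡⟨ lemma₁ m t u ⟩
    3 *ℕ (2 *ℕ t +ℕ (3 +ℕ m)) +ℕ (6 *ℕ u +ℕ (3 +ℕ m)) +ℕ 3 *ℕ m +ℕ 22 ≡⟨ cong₂ (λ y z → 3 *ℕ y +ℕ z +ℕ 3 *ℕ m +ℕ 22)
      (tri-closed (3 +ℕ m)) (tet-closed (3 +ℕ m)) ⟩
    3 *ℕ ((3 +ℕ m) *ℕ (3 +ℕ m)) +ℕ (3 +ℕ m) *ℕ (3 +ℕ m) *ℕ (3 +ℕ m) +ℕ 3 *ℕ m +ℕ 22 ≡⟨ lemma₂ m ⟩
    (4 +ℕ m) ^ 3 +ℕ 12 ∎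
    where
    open ≡-Reasoning
    t = tri (3 +ℕ m)
    u = tet (3 +ℕ m)
    lemma₁ : ∀ m t u → 6 *ℕ (1 +ℕ t +ℕ u) +ℕ 7 *ℕ (4 +ℕ m) ≡ 3 *ℕ (2 *ℕ t +ℕ (3 +ℕ m)) +ℕ (6 *ℕ u +ℕ (3 +ℕ m)) +ℕ 3 *ℕ
      m +ℕ 22
    lemma₁ = ℕSolver.solve-∀
    lemma₂ : ∀ m → 3 *ℕ ((3 +ℕ m) *ℕ (3 +ℕ m)) +ℕ (3 +ℕ m) *ℕ (3 +ℕ m) *ℕ (3 +ℕ m) +ℕ 3 *ℕ m +ℕ 22
                 ≡ (4 +ℕ m) *ℕ ((4 +ℕ m) *ℕ ((4 +ℕ m) *ℕ 1)) +ℕ 12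
    lemma₂ = ℕSolver.solve-∀

  WC-closed : ∀ m → 6 *ℕ WC (4 +ℕ m) +ℕ 13 *ℕ (7 +ℕ m) ≡ (7 +ℕ m) ^ 3 +ℕ 24
  WC-closed m = begin
    6 *ℕ ((4 +ℕ m) +ℕ (1 +ℕ t) +ℕ (1 +ℕ t +ℕ u)) +ℕ 13 *ℕ (7 +ℕ m)  ≡⟨ lemma₁ m t u ⟩
    6 *ℕ (2 *ℕ t +ℕ (5 +ℕ m)) +ℕ (6 *ℕ u +ℕ (5 +ℕ m)) +ℕ 12 *ℕ m +ℕ 92 ≡⟨ cong₂ (λ y z → 6 *ℕ y +ℕ z +ℕ 12 *ℕ m +ℕ 92)
      (tri-closed (5 +ℕ m)) (tet-closed (5 +ℕ m)) ⟩
    6 *ℕ ((5 +ℕ m) *ℕ (5 +ℕ m)) +ℕ (5 +ℕ m) *ℕ (5 +ℕ m) *ℕ (5 +ℕ m) +ℕ 12 *ℕ m +ℕ 92 ≡⟨ lemma₂ m ⟩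
    (7 +ℕ m) ^ 3 +ℕ 24 ∎
    where
    open ≡-Reasoning
    t = tri (5 +ℕ m)
    u = tet (5 +ℕ m)
    lemma₁ : ∀ m t u → 6 *ℕ ((4 +ℕ m) +ℕ (1 +ℕ t) +ℕ (1 +ℕ t +ℕ u)) +ℕ 13 *ℕ (7 +ℕ m)
                     ≡ 6 *ℕ (2 *ℕ t +ℕ (5 +ℕ m)) +ℕ (6 *ℕ u +ℕ (5 +ℕ m)) +ℕ 12 *ℕ m +ℕ 92
    lemma₁ = ℕSolver.solve-∀
    lemma₂ : ∀ m → 6 *ℕ ((5 +ℕ m) *ℕ (5 +ℕ m)) +ℕ (5 +ℕ m) *ℕ (5 +ℕ m) *ℕ (5 +ℕ m) +ℕ 12 *ℕ m +ℕ 92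
                 ≡ (7 +ℕ m) *ℕ ((7 +ℕ m) *ℕ ((7 +ℕ m) *ℕ 1)) +ℕ 24
    lemma₂ = ℕSolver.solve-∀

  -- Denominator and negative term are cleared in the natural numbers and restored only after the
  -- embedding.
  ι-sixth : ∀ {w a n c b} → 6 *ℕ w +ℕ a *ℕ n ≡ c +ℕ b → ι w ≡ (ι c - ι a * ι n + ι b) ÷ ι 6
  ι-sixth {w} {a} {n} {c} {b} eq = begin
    ι w                                                       ≡⟨ lemma (ι w) (ι a) (ι n) ⟩
    (ι 6 * ι w + ι a * ι n - ι a * ι n) * 1/ ι 6              ≡⟨ cong (λ z → (z - ι a * ι n) * 1/ ι 6) hyp ⟩
    (ι c + ι b - ι a * ι n) * 1/ ι 6                          ≡⟨ cong (_* 1/ ι 6) (rearrange (ι c) (ι b)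
      (ι a * ι n)) ⟩
    (ι c - ι a * ι n + ι b) ÷ ι 6                             ∎
    where
    open ≡-Reasoning
    hyp : ι 6 * ι w + ι a * ι n ≡ ι c + ι b
    hyp = begin
      ι 6 * ι w + ι a * ι n      ≡⟨ cong₂ _+_ (ι-* 6 w) (ι-* a n) ⟨
      ι (6 *ℕ w) + ι (a *ℕ n)    ≡⟨ ι-+ (6 *ℕ w) (a *ℕ n) ⟨
      ι (6 *ℕ w +ℕ a *ℕ n)       ≡⟨ cong ι eq ⟩
      ι (c +ℕ b)                 ≡⟨ ι-+ c b ⟩
      ι c + ι b                  ∎
    lemma : ∀ w a n → w ≡ (ι 6 * w + a * n - a * n) * 1/ ι 6
    lemma = solve 3 (λ w a n → w := (con (ι 6) :* w :+ a :* n :- a :* n) :* con (1/ ι 6)) refl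
    rearrange : ∀ c b x → c + b - x ≡ c - x + b
    rearrange = solve 3 (λ c b x → c :+ b :- x := c :- x :+ b) refl

  ι-square : ∀ k → ι (k ^ 2) ≡ ι k * ι k
  ι-square k = trans (cong ι (cong (k *ℕ_) (ℕ.*-identityʳ k))) (ι-* k k)

  ι-suc : ∀ k → ι (suc k) ≡ ι 1 + ι k
  ι-suc k = ι-+ 1 k

  private
    -- Q is k / 2 and E is n - k. After the equations are matched, both sides are polynomials in Q
    -- and E, within reach of the ring solver.
    even-identity : ∀ {w c k k² n d² Q E} → k ≡ Q + Q → k² ≡ k * k → n ≡ k + E → d² ≡ E * E →
      w + ι 2 * Q ≡ c + Q * Q * (E + ι 3) + Q * (E * E + E) →
      w ≡ c + (k² ÷ ι 4) * (n - k + ι 3) + (k ÷ ι 2) * (d² + n - k - ι 2)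
    even-identity {w} {c} {Q = Q} {E} refl refl refl refl hyp = begin
      w                                                                      ≡⟨ isolate w Q ⟩
      (w + ι 2 * Q) - ι 2 * Q                                                ≡⟨ cong (_- ι 2 * Q) hyp ⟩
      (c + Q * Q * (E + ι 3) + Q * (E * E + E)) - ι 2 * Q                    ≡⟨ final c Q E ⟩
      _                                                                      ∎
      where
      open ≡-Reasoning
      isolate : ∀ w Q → w ≡ (w + ι 2 * Q) - ι 2 * Q
      isolate = solve 2 (λ w Q → w := (w :+ con (ι 2) :* Q) :- con (ι 2) :* Q) refl
      final : ∀ x Q E → (x + Q * Q * (E + ι 3) + Q * (E * E + E)) - ι 2 * Q ≡
        x + ((Q + Q) * (Q + Q) * 1/ ι 4) * ((Q + Q + E) - (Q + Q) + ι 3) + ((Q + Q) * 1/ ι 2) * (E * E + (Q + Q + E) -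
          (Q + Q) - ι 2)
      final = solve 3 (λ x Q E → (x :+ Q :* Q :* (E :+ con (ι 3)) :+ Q :* (E :* E :+ E)) :- con (ι 2) :* Q :=
        x :+ ((Q :+ Q) :* (Q :+ Q) :* con (1/ ι 4)) :* ((Q :+ Q :+ E) :- (Q :+ Q) :+ con (ι 3))
          :+ ((Q :+ Q) :* con (1/ ι 2)) :* (E :* E :+ (Q :+ Q :+ E) :- (Q :+ Q) :- con (ι 2))) refl

    odd-identity : ∀ {w c k k² n d² Q E} → k ≡ ι 1 + (Q + Q) → k² ≡ k * k → n ≡ k + E → d² ≡ E * E →
      ι 2 * w + ι 4 * Q ≡ ι 2 * c + ι 2 * (Q * (ι 1 + Q) * (E + ι 3)) + k * (E * E + E) →
      w ≡ c + ((k² - ι 1) ÷ ι 4) * (n - k + ι 3) + (k ÷ ι 2) * (d² + n - k - ι 2) + ι 1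
    odd-identity {w} {c} {Q = Q} {E} refl refl refl refl hyp = begin
      w                                                                      ≡⟨ isolate w Q ⟩
      ((ι 2 * w + ι 4 * Q) - ι 4 * Q) * 1/ ι 2                               ≡⟨ cong
        (λ z → (z - ι 4 * Q) * 1/ ι 2) hyp ⟩
      ((ι 2 * c + ι 2 * (Q * (ι 1 + Q) * (E + ι 3)) + (ι 1 + (Q + Q)) * (E * E + E)) - ι 4 * Q) * 1/ ι 2  ≡⟨ final c Q
        E ⟩
      _                                                                      ∎
      where
      open ≡-Reasoning
      isolate : ∀ w Q → w ≡ ((ι 2 * w + ι 4 * Q) - ι 4 * Q) * 1/ ι 2
      isolate = solve 2 (λ w Q → w := ((con (ι 2) :* w :+ con (ι 4) :* Q) :- con (ι 4) :* Q) :* con (1/ ι 2)) refl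
      final : ∀ x Q E → let K = ι 1 + (Q + Q) in
        ((ι 2 * x + ι 2 * (Q * (ι 1 + Q) * (E + ι 3)) + K * (E * E + E)) - ι 4 * Q) * 1/ ι 2 ≡
        x + ((K * K - ι 1) * 1/ ι 4) * ((K + E) - K + ι 3) + (K * 1/ ι 2) * (E * E + (K + E) - K - ι 2) + ι 1
      final = solve 3 (λ x Q E → let K = con (ι 1) :+ (Q :+ Q) in
        ((con (ι 2) :* x :+ con (ι 2) :* (Q :* (con (ι 1) :+ Q) :* (E :+ con (ι 3))) :+ K :* (E :* E :+ E)) :- con
          (ι 4) :* Q) :* con (1/ ι 2) :=
        x :+ ((K :* K :- con (ι 1)) :* con (1/ ι 4)) :* ((K :+ E) :- K :+ con (ι 3))
          :+ (K :* con (1/ ι 2)) :* (E :* E :+ (K :+ E) :- K :- con (ι 2)) :+ con (ι 1)) refl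

    choose-tet : ∀ d → ι ((d +ℕ 1) choose 3) ≡ ι (tet d)
    choose-tet d = cong ι (trans (cong (_choose 3) (ℕ.+-comm d 1)) (tet≡C d))

  formula-even : ∀ q d → let k = q +ℕ q; D = suc d in ι (WTmax k D) ≡
    ι ((D +ℕ 1) choose 3) + (ι (k ^ 2) ÷ ι 4) * (ι (k +ℕ D) - ι k + ι 3)
    + (ι k ÷ ι 2) * (ι (D ^ 2) + ι (k +ℕ D) - ι k - ι 2)
  formula-even q d = even-identity {w = ι w} {c = ι ((D +ℕ 1) choose 3)} {Q = Q} {E} (ι-+ q q) (ι-square k) (ι-+ k D)
    (ι-square D) (begin
    ι w + ι 2 * Q                                        ≡⟨ cong (ι w +_) (ι-* 2 q) ⟨
    ι w + ι (2 *ℕ q)                                     ≡⟨ ι-+ w (2 *ℕ q) ⟨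
    ι (w +ℕ 2 *ℕ q)                                      ≡⟨ cong ι (WTmax-even q d) ⟩
    ι (tet D +ℕ a +ℕ b)                                  ≡⟨ trans (ι-+ (tet D +ℕ a) b) (cong (_+ ι b)
      (ι-+ (tet D) a)) ⟩
    ι (tet D) + ι a + ι b                                ≡⟨ cong₂ (λ y z → ι (tet D) + y + z)
                    (trans (ι-* (q *ℕ q) (D +ℕ 3)) (cong₂ _*_ (ι-* q q) (ι-+ D 3)))
                    (trans (ι-* q (D *ℕ D +ℕ D)) (cong (Q *_) (trans (ι-+ (D *ℕ D) D) (cong (_+ E) (ι-* D D))))) ⟩
    ι (tet D) + Q * Q * (E + ι 3) + Q * (E * E + E)      ≡⟨ cong (λ c → c + Q * Q * (E + ι 3) + Q * (E * E + E))
      (choose-tet D) ⟨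
    ι ((D +ℕ 1) choose 3) + Q * Q * (E + ι 3) + Q * (E * E + E) ∎)
    where
    open ≡-Reasoning
    k = q +ℕ q
    D = suc d
    w = WTmax k D
    Q = ι q
    E = ι D
    a = q *ℕ q *ℕ (D +ℕ 3)
    b = q *ℕ (D *ℕ D +ℕ D)

  formula-odd : ∀ q d → let k = suc (q +ℕ q); D = suc d in ι (WTmax k D) ≡
    ι ((D +ℕ 1) choose 3) + ((ι (k ^ 2) - ι 1) ÷ ι 4) * (ι (k +ℕ D) - ι k + ι 3)
    + (ι k ÷ ι 2) * (ι (D ^ 2) + ι (k +ℕ D) - ι k - ι 2) + ι 1
  formula-odd q d = odd-identity {w = ι w} {c = ι ((D +ℕ 1) choose 3)} {Q = Q} {E}
    (trans (ι-suc (q +ℕ q)) (cong (λ z → ι 1 + z) (ι-+ q q))) (ι-square k) (ι-+ k D) (ι-square D) (begin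
    ι 2 * ι w + ι 4 * Q                                  ≡⟨ cong₂ _+_ (ι-* 2 w) (ι-* 4 q) ⟨
    ι (2 *ℕ w) + ι (4 *ℕ q)                              ≡⟨ ι-+ (2 *ℕ w) (4 *ℕ q) ⟨
    ι (2 *ℕ w +ℕ 4 *ℕ q)                                 ≡⟨ cong ι (WTmax-odd q d) ⟩
    ι (2 *ℕ tet D +ℕ 2 *ℕ a +ℕ b)                        ≡⟨ trans (ι-+ (2 *ℕ tet D +ℕ 2 *ℕ a) b) (cong (_+ ι b)
      (ι-+ (2 *ℕ tet D) (2 *ℕ a))) ⟩
    ι (2 *ℕ tet D) + ι (2 *ℕ a) + ι b                    ≡⟨ cong₂ _+_ (cong₂ _+_ (trans (ι-* 2 (tet D)) (cong (ι 2 *_)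
      (sym (choose-tet D))))
                    (trans (ι-* 2 a) (cong (ι 2 *_) (trans (ι-* (q *ℕ suc q) (D +ℕ 3))
                      (cong₂ _*_ (trans (ι-* q (suc q)) (cong (Q *_) (ι-suc q))) (ι-+ D 3))))))
                    (trans (ι-* k (D *ℕ D +ℕ D)) (cong (ι k *_) (trans (ι-+ (D *ℕ D) D) (cong (_+ E) (ι-* D D))))) ⟩
    ι 2 * ι ((D +ℕ 1) choose 3) + ι 2 * (Q * (ι 1 + Q) * (E + ι 3)) + ι k * (E * E + E) ∎)
    where
    open ≡-Reasoning
    k = suc (q +ℕ q)
    D = suc d
    w = WTmax k D
    Q = ι q
    E = ι D
    a = q *ℕ suc q *ℕ (D +ℕ 3)
    b = k *ℕ (D *ℕ D +ℕ D)

  double : ∀ q → q *ℕ 2 ≡ q +ℕ q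
  double q = trans (ℕ.*-comm q 2) (cong (q +ℕ_) (ℕ.+-identityʳ q))

open import Data.Nat.Base using (ℕ; suc; _≤_; _∸_; _^_; ⌊_/2⌋; ⌈_/2⌉) renaming (_+_ to _+ℕ_)
open import Data.Nat.Combinatorics using () renaming (_C_ to _choose_)
open import Data.Nat.Divisibility using (_∣_; divides)
open import Data.Nat.Properties using (m≤n⇒∃[o]m+o≡n; m+n∸m≡n; m+[n∸m]≡n; m≤m+n; ≤-trans; +-assoc)
open import Data.Product.Base using (∃; _×_; _,_)
open import Data.Rational.Base using (_+_; _-_; _*_; _÷_)
open import Data.Sum.Base using (_⊎_; inj₁; inj₂)
open import Function.Bundles using (_⇔_)
open import Relation.Binary.PropositionalEquality.Core using (_≡_; refl; sym; trans; cong)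
open import Relation.Nullary.Negation.Core using (¬_; contradiction)
open WienerIndex
open Formulas

private
  -- The difference n ∸ k enters as a variable with two equations. Matching them removes truncated
  -- subtraction and exposes the form 2 + m that the earlier results expect.
  part-i : ∀ {n k d} m → d ≡ 2 +ℕ m → n ≡ k +ℕ d → 2 ≤ k →
    ((G : Graph n) → InH k G → AtMost G (T ⌊ k /2⌋ ⌈ k /2⌉ d)) ×
    (2 ∣ k → ι (W (T ⌊ k /2⌋ ⌈ k /2⌉ d)) ≡
      ι ((d +ℕ 1) choose 3) + (ι (k ^ 2) ÷ ι 4) * (ι n - ι k + ι 3) +
      (ι k ÷ ι 2) * (ι (d ^ 2) + ι n - ι k - ι 2)) ×
    (¬ (2 ∣ k) → ι (W (T ⌊ k /2⌋ ⌈ k /2⌉ d)) ≡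
      ι ((d +ℕ 1) choose 3) + ((ι (k ^ 2) - ι 1) ÷ ι 4) * (ι n - ι k + ι 3) +
      (ι k ÷ ι 2) * (ι (d ^ 2) + ι n - ι k - ι 2) + ι 1)
  part-i {k = k} m refl refl 2≤k = many-pendants m refl 2≤k , even , odd
    where
    even : 2 ∣ k → _
    even (divides q k≡) = trans (cong ι (W-T-half k m 2≤k)) (evenCase (trans k≡ (double q)))
      where
      evenCase : k ≡ q +ℕ q → _
      evenCase refl = formula-even q (suc m)
    odd : ¬ (2 ∣ k) → _
    odd ¬2∣k = trans (cong ι (W-T-half k m 2≤k)) (oddCase (even-or-odd k))
      where
      oddCase : (∃ λ q → k ≡ q +ℕ q) ⊎ (∃ λ q → k ≡ suc (q +ℕ q)) → _
      oddCase (inj₁ (q , k≡))   = contradiction (divides q (trans k≡ (sym (double q)))) ¬2∣k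
      oddCase (inj₂ (q , refl)) = formula-odd q (suc m)

  part-ii : ∀ {n} m → 4 +ℕ m ≡ n →
    ((G : Graph n) → InH 1 G → AtMost G (Uˡ n 3)) ×
    ι (W (Uˡ n 3)) ≡ (ι (n ^ 3) - ι 7 * ι n + ι 12) ÷ ι 6
  part-ii m refl = one-pendant m refl , trans (cong ι (W-U m))
    (ι-sixth {w = WU (3 +ℕ m)} {a = 7} {n = 4 +ℕ m} {c = (4 +ℕ m) ^ 3} {b = 12} (WU-closed m))

  part-iii : ∀ {n} m → 7 +ℕ m ≡ n →
    ((G : Graph n) → InH 0 G → AtMost G (C 3 3 n)) ×
    ι (W (C 3 3 n)) ≡ (ι (n ^ 3) - ι 13 * ι n + ι 24) ÷ ι 6
  part-iii m refl = no-pendants m refl , trans (cong ι (W-C33 m))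
    (ι-sixth {w = WC (4 +ℕ m)} {a = 13} {n = 7 +ℕ m} {c = (7 +ℕ m) ^ 3} {b = 24} (WC-closed m))

theorem1p1 : (n k : ℕ) → k +ℕ 2 ≤ n →
  (2 ≤ k →
    ((G : Graph n) → InH k G →
      W G ≤ W (T ⌊ k /2⌋ ⌈ k /2⌉ (n ∸ k)) ×
      (W G ≡ W (T ⌊ k /2⌋ ⌈ k /2⌉ (n ∸ k)) ⇔ G ≅ T ⌊ k /2⌋ ⌈ k /2⌉ (n ∸ k))) ×
    (2 ∣ k →
      ι (W (T ⌊ k /2⌋ ⌈ k /2⌉ (n ∸ k))) ≡
        ι ((n ∸ k +ℕ 1) choose 3) +
        (ι (k ^ 2) ÷ ι 4) * (ι n - ι k + ι 3) +
        (ι k ÷ ι 2) * (ι ((n ∸ k) ^ 2) + ι n - ι k - ι 2)) ×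
    (¬ (2 ∣ k) →
      ι (W (T ⌊ k /2⌋ ⌈ k /2⌉ (n ∸ k))) ≡
        ι ((n ∸ k +ℕ 1) choose 3) +
        ((ι (k ^ 2) - ι 1) ÷ ι 4) * (ι n - ι k + ι 3) +
        (ι k ÷ ι 2) * (ι ((n ∸ k) ^ 2) + ι n - ι k - ι 2) +
        ι 1)) ×
  (k ≡ 1 → 4 ≤ n →
    ((G : Graph n) → InH k G →
      W G ≤ W (Uˡ n 3) × (W G ≡ W (Uˡ n 3) ⇔ G ≅ Uˡ n 3)) ×
    ι (W (Uˡ n 3)) ≡ (ι (n ^ 3) - ι 7 * ι n + ι 12) ÷ ι 6) ×
  (k ≡ 0 → 7 ≤ n →
    ((G : Graph n) → InH k G →
      W G ≤ W (C 3 3 n) × (W G ≡ W (C 3 3 n) ⇔ G ≅ C 3 3 n)) ×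
    ι (W (C 3 3 n)) ≡ (ι (n ^ 3) - ι 13 * ι n + ι 24) ÷ ι 6)
theorem1p1 n k k+2≤n =
  (λ 2≤k → large (m≤n⇒∃[o]m+o≡n k+2≤n) 2≤k) ,
  (λ { refl 4≤n → let m , eq = m≤n⇒∃[o]m+o≡n 4≤n in part-ii m eq }) ,
  (λ { refl 7≤n → let m , eq = m≤n⇒∃[o]m+o≡n 7≤n in part-iii m eq })
  where
  large : (∃ λ o → k +ℕ 2 +ℕ o ≡ n) → 2 ≤ k → _
  large (o , eq) = part-i {n} {k} {n ∸ k} o
    (trans (cong (_∸ k) (trans (sym eq) (+-assoc k 2 o))) (m+n∸m≡n k (2 +ℕ o)))
    (sym (m+[n∸m]≡n (≤-trans (m≤m+n k 2) k+2≤n)))
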